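{- Let $d, D, p \geq 1$ be integers and let $\mathbf{x}, \mathbf{y} \in \mathbb{R}^d$. Let $h_1, \ldots, h_p : [d] \to [D]$ be random functions, each sampled from a 2-wise independent family, and let $s_1, \ldots, s_p : [d] \to \{ -1, 1\}$ be random functions, each sampled from a 4-wise independent family, where all $2p$ functions are chosen independently. Let $\mathbf{Cx}^{(p)}, \mathbf{Cy}^{(p)} \in \mathbb{R}^D$ denote the Count Sketches of the tensor powers $\mathbf{x}^{(p)}, \mathbf{y}^{(p)} \in \mathbb{R}^{d^p}$ with respect to the composite hash functions $$H(i_1, \ldots, i_p) = \Big(\sum_{j=1}^p h_j(i_j)\Big) \bmod D, \qquad S(i_1, \ldots, i_p) = \prod_{j=1}^p s_j(i_j),$$ that is, $\big(\mathbf{Cx}^{(p)}\big)_k = \sum_{\mathbf{u} \in [d]^p :\, H(\mathbf{u}) = k} S(\mathbf{u})\, \mathbf{x}^{(p)}_{\mathbf{u}}$ for each residue $k$ modulo $D$, and similarly for $\mathbf{y}$ with the same $H$ and $S$. Then $$\mathbb{E}\left[\left\langle \mathbf{Cx}^{(p)}, \mathbf{Cy}^{(p)} \right\rangle\right] = \left\langle \mathbf{x}^{(p)}, \mathbf{y}^{(p)} \right\rangle = \langle \mathbf{x}, \mathbf{y} \rangle^p,$$ $$\mathrm{Var}\left[\left\langle \mathbf{Cx}^{(p)}, \mathbf{Cy}^{(p)} \right\rangle\right] \leq \frac{3^p - 1}{D}\, \|\mathbf{x}\|_2^{2p}\, \|\mathbf{y}\|_2^{2p}.$$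
   Context: For an integer $m \ge 1$, $[m] = \{1, \ldots, m\}$. $\langle \cdot, \cdot \rangle$ is the standard inner product and $\|\cdot\|_2$ the Euclidean norm. The $p$-th tensor power of $\mathbf{x} = (x_1, \ldots, x_d) \in \mathbb{R}^d$ is the vector $\mathbf{x}^{(p)} \in \mathbb{R}^{d^p}$ indexed by $[d]^p$ with entries $\mathbf{x}^{(p)}_{(i_1, \ldots, i_p)} = \prod_{j=1}^p x_{i_j}$. A family $\mathcal{H}$ of functions $f : U \to R$ between finite sets is $k$-wise independent if, for every set $I \subseteq U$ of at most $k$ distinct elements and $f$ chosen at random from $\mathcal{H}$, the vector of hash values $(f(i))_{i \in I}$ is uniformly distributed on $R^{I}$. A function "sampled from a $k$-wise independent family" is such a random $f$. The set $[D]$ is identified with the residues modulo $D$, so that $H$ takes values in the coordinate index set of $\mathbb{R}^D$. -}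

module Defs where

open import Algebra.Bundles.Raw using (RawRing)
import Algebra.Definitions.RawSemiring as RawSemiring
open import Data.Bool.Base using (if_then_else_)
open import Data.Fin.Base using (Fin; toℕ; finToFun)
import Data.Fin.Base as Fin
import Data.Fin.Properties as Fin
open import Data.Fin.Patterns using (0F; 1F)
open import Data.Fin.Subset using (Subset; _∈_; ∣_∣)
open import Data.Fin.Subset.Properties using (_∈?_)
open import Data.Integer.Base using (ℤ; +_)
import Data.Integer.Base as ℤ
import Data.Integer.Properties as ℤ
import Data.List.Base as List
open import Data.List.NonEmpty.Base as List⁺ using (List⁺; toList)
open import Data.Nat.Base as ℕ using (ℕ; zero; suc; NonZero)
open import Data.Nat.DivMod using (_mod_)
import Data.Nat.Properties as ℕ
open import Data.Nat.Solver as ℕ-Solver using ()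
open import Data.Product.Base using (_×_; _,_; ∃-syntax)
open import Data.Rational.Base as ℚ using (ℚ; mkℚ; 0ℚ; 1ℚ; ½)
import Data.Rational.Properties as ℚ
open import Data.Rational.Solver as ℚ-Solver using ()
import Data.Rational.Unnormalised.Base as ℚᵘ
import Data.Rational.Unnormalised.Properties as ℚᵘ
open import Data.Sign.Base as Sign using (Sign)
open import Data.Sum.Base using (inj₁; inj₂)
open import Data.Vec.Functional as Vector using (Vector)
open import Function.Bundles using (_↔_; mk↔ₛ′)
open import Function.Properties.Inverse using (↔⇒↣)
open import Level using (0ℓ)
open import Relation.Binary.PropositionalEquality
open import Relation.Nullary.Decidable using (yes; no; does; _→-dec_)
open import Relation.Unary using (Pred; Decidable)

Cauchy : (ℕ → ℚ) → Set
Cauchy a = ∀ ε → 0ℚ ℚ.< ε →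
  ∃[ N ] ∀ m n → N ℕ.≤ m → N ℕ.≤ n → ℚ.∣ a m ℚ.- a n ∣ ℚ.< ε

-- ℝ is the setoid of rational Cauchy sequences with _≃_, equality up to a
-- null sequence. All operations are pointwise.
record ℝ : Set where
  constructor mkℝ
  field
    seq    : ℕ → ℚ
    cauchy : Cauchy seq

open ℝ public

infix 4 _≃_ _≤_

_≃_ : ℝ → ℝ → Set
x ≃ y = ∀ ε → 0ℚ ℚ.< ε →
  ∃[ N ] ∀ n → N ℕ.≤ n → ℚ.∣ seq x n ℚ.- seq y n ∣ ℚ.< ε

_≤_ : ℝ → ℝ → Set
x ≤ y = ∀ ε → 0ℚ ℚ.< ε →
  ∃[ N ] ∀ n → N ℕ.≤ n → seq x n ℚ.≤ seq y n ℚ.+ ε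

fromℚ : ℚ → ℝ
fromℚ q = mkℝ (λ _ → q) λ ε 0<ε → 0 , λ _ _ _ _ →
  subst (ℚ._< ε) (sym (cong ℚ.∣_∣ (ℚ.+-inverseʳ q))) 0<ε

module _ where
  open ℚ-Solver.+-*-Solver
  open ℚ.≤-Reasoning

  half-pos : ∀ {ε} → 0ℚ ℚ.< ε → 0ℚ ℚ.< ½ ℚ.* ε
  half-pos {ε} 0<ε = subst (ℚ._< ½ ℚ.* ε) (ℚ.*-zeroʳ ½) (ℚ.*-monoʳ-<-pos ½ 0<ε)

  half+half : ∀ ε → ½ ℚ.* ε ℚ.+ ½ ℚ.* ε ≡ ε
  half+half = solve 1 (λ e → con ½ :* e :+ con ½ :* e := e) refl

  +-cauchy : ∀ a b → Cauchy a → Cauchy b → Cauchy (λ n → a n ℚ.+ b n)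
  +-cauchy a b ca cb ε 0<ε with ca (½ ℚ.* ε) (half-pos 0<ε) | cb (½ ℚ.* ε) (half-pos 0<ε)
  ... | N , p | M , q = N ℕ.⊔ M , λ m n N≤m N≤n → begin-strict
    ℚ.∣ (a m ℚ.+ b m) ℚ.- (a n ℚ.+ b n) ∣
      ≡⟨ cong ℚ.∣_∣ (solve 4 (λ x y z w → (x :+ y) :- (z :+ w) := (x :- z) :+ (y :- w))
                         refl (a m) (b m) (a n) (b n)) ⟩
    ℚ.∣ (a m ℚ.- a n) ℚ.+ (b m ℚ.- b n) ∣
      ≤⟨ ℚ.∣p+q∣≤∣p∣+∣q∣ (a m ℚ.- a n) (b m ℚ.- b n) ⟩
    ℚ.∣ a m ℚ.- a n ∣ ℚ.+ ℚ.∣ b m ℚ.- b n ∣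
      <⟨ ℚ.+-mono-< (p m n (ℕ.m⊔n≤o⇒m≤o N M N≤m) (ℕ.m⊔n≤o⇒m≤o N M N≤n))
                    (q m n (ℕ.m⊔n≤o⇒n≤o N M N≤m) (ℕ.m⊔n≤o⇒n≤o N M N≤n)) ⟩
    ½ ℚ.* ε ℚ.+ ½ ℚ.* ε
      ≡⟨ half+half ε ⟩
    ε ∎

  neg-cauchy : ∀ a → Cauchy a → Cauchy (λ n → ℚ.- a n)
  neg-cauchy a ca ε 0<ε with ca ε 0<ε
  ... | N , p = N , λ m n N≤m N≤n → subst (ℚ._< ε) (eq m n) (p m n N≤m N≤n)
    where
    eq : ∀ m n → ℚ.∣ a m ℚ.- a n ∣ ≡ ℚ.∣ (ℚ.- a m) ℚ.- (ℚ.- a n) ∣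
    eq m n = trans (sym (ℚ.∣-p∣≡∣p∣ (a m ℚ.- a n)))
      (cong ℚ.∣_∣ (solve 2 (λ x y → :- (x :- y) := (:- x) :- (:- y)) refl (a m) (a n)))

  eventualBound : ∀ a → Cauchy a →
    ∃[ B ] 0ℚ ℚ.< B × ∃[ N ] (∀ n → N ℕ.≤ n → ℚ.∣ a n ∣ ℚ.≤ B)
  eventualBound a ca with ca 1ℚ (ℚ.positive⁻¹ 1ℚ)
  ... | N , p = 1ℚ ℚ.+ ℚ.∣ a N ∣ , 0<B , N , bound
    where
    0<B : 0ℚ ℚ.< 1ℚ ℚ.+ ℚ.∣ a N ∣
    0<B = ℚ.+-mono-<-≤ (ℚ.positive⁻¹ 1ℚ) (ℚ.0≤∣p∣ (a N))

    bound : ∀ n → N ℕ.≤ n → ℚ.∣ a n ∣ ℚ.≤ 1ℚ ℚ.+ ℚ.∣ a N ∣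
    bound n N≤n = begin
      ℚ.∣ a n ∣
        ≡⟨ cong ℚ.∣_∣ (solve 2 (λ x y → x := (x :- y) :+ y) refl (a n) (a N)) ⟩
      ℚ.∣ (a n ℚ.- a N) ℚ.+ a N ∣
        ≤⟨ ℚ.∣p+q∣≤∣p∣+∣q∣ (a n ℚ.- a N) (a N) ⟩
      ℚ.∣ a n ℚ.- a N ∣ ℚ.+ ℚ.∣ a N ∣
        ≤⟨ ℚ.+-monoˡ-≤ ℚ.∣ a N ∣ (ℚ.<⇒≤ (p n N N≤n ℕ.≤-refl)) ⟩
      1ℚ ℚ.+ ℚ.∣ a N ∣ ∎

  ∣uv∣<Cδ : ∀ {u v C δ} → 0ℚ ℚ.< C → ℚ.∣ u ∣ ℚ.≤ C → ℚ.∣ v ∣ ℚ.< δ →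
            ℚ.∣ u ℚ.* v ∣ ℚ.< C ℚ.* δ
  ∣uv∣<Cδ {u} {v} {C} {δ} 0<C u≤C v<δ = begin-strict
    ℚ.∣ u ℚ.* v ∣         ≡⟨ ℚ.∣p*q∣≡∣p∣*∣q∣ u v ⟩
    ℚ.∣ u ∣ ℚ.* ℚ.∣ v ∣   ≤⟨ ℚ.*-monoʳ-≤-nonNeg ℚ.∣ v ∣ {{ℚ.∣-∣-nonNeg v}} u≤C ⟩
    C ℚ.* ℚ.∣ v ∣         <⟨ ℚ.*-monoʳ-<-pos C {{ℚ.positive 0<C}} v<δ ⟩
    C ℚ.* δ               ∎

  *-cauchy-step : ∀ a b → Cauchy a → Cauchy b → ∀ C δ ε → 0ℚ ℚ.< C → 0ℚ ℚ.< δ →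
    C ℚ.* δ ≡ ½ ℚ.* ε →
    ∃[ N ] (∀ n → N ℕ.≤ n → ℚ.∣ a n ∣ ℚ.≤ C) →
    ∃[ N ] (∀ n → N ℕ.≤ n → ℚ.∣ b n ∣ ℚ.≤ C) →
    ∃[ N ] ∀ m n → N ℕ.≤ m → N ℕ.≤ n → ℚ.∣ a m ℚ.* b m ℚ.- a n ℚ.* b n ∣ ℚ.< ε
  *-cauchy-step a b ca cb C δ ε 0<C 0<δ Cδ≡ε/2 (N₁ , a≤C) (M₁ , b≤C)
    with ca δ 0<δ | cb δ 0<δ
  ... | N₂ , p | M₂ , q = (N₁ ℕ.⊔ N₂) ℕ.⊔ (M₁ ℕ.⊔ M₂) , λ m n K≤m K≤n →
    let N≤m = ℕ.m⊔n≤o⇒m≤o (N₁ ℕ.⊔ N₂) (M₁ ℕ.⊔ M₂) K≤m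
        M≤m = ℕ.m⊔n≤o⇒n≤o (N₁ ℕ.⊔ N₂) (M₁ ℕ.⊔ M₂) K≤m
        N≤n = ℕ.m⊔n≤o⇒m≤o (N₁ ℕ.⊔ N₂) (M₁ ℕ.⊔ M₂) K≤n
        M≤n = ℕ.m⊔n≤o⇒n≤o (N₁ ℕ.⊔ N₂) (M₁ ℕ.⊔ M₂) K≤n
        am≤C = a≤C m (ℕ.m⊔n≤o⇒m≤o N₁ N₂ N≤m)
        bn≤C = b≤C n (ℕ.m⊔n≤o⇒m≤o M₁ M₂ M≤n)
        a-a = p m n (ℕ.m⊔n≤o⇒n≤o N₁ N₂ N≤m) (ℕ.m⊔n≤o⇒n≤o N₁ N₂ N≤n)
        b-b = q m n (ℕ.m⊔n≤o⇒n≤o M₁ M₂ M≤m) (ℕ.m⊔n≤o⇒n≤o M₁ M₂ M≤n)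
    in begin-strict
    ℚ.∣ a m ℚ.* b m ℚ.- a n ℚ.* b n ∣
      ≡⟨ cong ℚ.∣_∣ (solve 4 (λ x y z w → x :* y :- z :* w := x :* (y :- w) :+ w :* (x :- z))
                         refl (a m) (b m) (a n) (b n)) ⟩
    ℚ.∣ a m ℚ.* (b m ℚ.- b n) ℚ.+ b n ℚ.* (a m ℚ.- a n) ∣
      ≤⟨ ℚ.∣p+q∣≤∣p∣+∣q∣ (a m ℚ.* (b m ℚ.- b n)) (b n ℚ.* (a m ℚ.- a n)) ⟩
    ℚ.∣ a m ℚ.* (b m ℚ.- b n) ∣ ℚ.+ ℚ.∣ b n ℚ.* (a m ℚ.- a n) ∣
      <⟨ ℚ.+-mono-< (∣uv∣<Cδ {a m} 0<C am≤C b-b) (∣uv∣<Cδ {b n} 0<C bn≤C a-a) ⟩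
    C ℚ.* δ ℚ.+ C ℚ.* δ
      ≡⟨ cong₂ ℚ._+_ Cδ≡ε/2 Cδ≡ε/2 ⟩
    ½ ℚ.* ε ℚ.+ ½ ℚ.* ε
      ≡⟨ half+half ε ⟩
    ε ∎

  quotient-pos : ∀ ε C → 0ℚ ℚ.< ε → .{{_ : ℚ.Positive C}} →
                 0ℚ ℚ.< ε ℚ.* (ℚ.1/ C) {{ℚ.pos⇒nonZero C}}
  quotient-pos ε C 0<ε = ℚ.positive⁻¹ _ {{ℚ.pos*pos⇒pos ε {{ℚ.positive 0<ε}} _ {{ℚ.1/pos⇒pos C}}}}

  C*[ε/C] : ∀ ε C .{{_ : ℚ.NonZero C}} → C ℚ.* (ε ℚ.* ℚ.1/ C) ≡ ε
  C*[ε/C] ε C = trans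
    (solve 3 (λ c e i → c :* (e :* i) := (c :* i) :* e) refl C ε (ℚ.1/ C))
    (trans (cong (ℚ._* ε) (ℚ.*-inverseʳ C)) (ℚ.*-identityˡ ε))

  p≤p+q : ∀ p q → 0ℚ ℚ.< q → p ℚ.≤ p ℚ.+ q
  p≤p+q p q 0<q = subst (ℚ._≤ p ℚ.+ q) (ℚ.+-identityʳ p) (ℚ.+-monoʳ-≤ p (ℚ.<⇒≤ 0<q))

  q≤p+q : ∀ p q → 0ℚ ℚ.< p → q ℚ.≤ p ℚ.+ q
  q≤p+q p q 0<p = subst (ℚ._≤ p ℚ.+ q) (ℚ.+-identityˡ q) (ℚ.+-monoˡ-≤ q (ℚ.<⇒≤ 0<p))

  bounded-*-cauchy : ∀ a b → Cauchy a → Cauchy b → ∀ C → 0ℚ ℚ.< C →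
    ∃[ N ] (∀ n → N ℕ.≤ n → ℚ.∣ a n ∣ ℚ.≤ C) →
    ∃[ N ] (∀ n → N ℕ.≤ n → ℚ.∣ b n ∣ ℚ.≤ C) →
    Cauchy (λ n → a n ℚ.* b n)
  bounded-*-cauchy a b ca cb C 0<C a≤C b≤C ε 0<ε =
    *-cauchy-step a b ca cb C (½ ℚ.* ε ℚ.* (ℚ.1/ C) {{C≢0}}) ε 0<C
      (quotient-pos (½ ℚ.* ε) C (half-pos 0<ε) {{ℚ.positive 0<C}})
      (C*[ε/C] (½ ℚ.* ε) C {{C≢0}}) a≤C b≤C
    where
    C≢0 : ℚ.NonZero C
    C≢0 = ℚ.>-nonZero 0<C

  *-cauchy : ∀ a b → Cauchy a → Cauchy b → Cauchy (λ n → a n ℚ.* b n)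
  *-cauchy a b ca cb =
    let A , 0<A , N , a≤A = eventualBound a ca
        B , 0<B , M , b≤B = eventualBound b cb
    in bounded-*-cauchy a b ca cb (A ℚ.+ B) (ℚ.+-mono-< 0<A 0<B)
         (N , λ n N≤n → ℚ.≤-trans (a≤A n N≤n) (p≤p+q A B 0<B))
         (M , λ n M≤n → ℚ.≤-trans (b≤B n M≤n) (q≤p+q A B 0<A))

ℝ-rawRing : RawRing 0ℓ 0ℓ
ℝ-rawRing = record
  { Carrier = ℝ
  ; _≈_     = _≃_
  ; _+_     = λ x y → mkℝ (λ n → seq x n ℚ.+ seq y n) (+-cauchy (seq x) (seq y) (cauchy x) (cauchy y))
  ; _*_     = λ x y → mkℝ (λ n → seq x n ℚ.* seq y n) (*-cauchy (seq x) (seq y) (cauchy x) (cauchy y))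
  ; -_      = λ x → mkℝ (λ n → ℚ.- seq x n) (neg-cauchy (seq x) (cauchy x))
  ; 0#      = fromℚ 0ℚ
  ; 1#      = fromℚ 1ℚ
  }

open RawRing ℝ-rawRing public
  using (_+_; _*_; -_)
  renaming (0# to 0ℝ; 1# to 1ℝ)

open RawSemiring (RawRing.rawSemiring ℝ-rawRing) public
  using (sum; product; _^_)

infixl 6 _-_

_-_ : ℝ → ℝ → ℝ
x - y = x + (- y)

isqrt : ℕ → ℕ
isqrt zero    = 0
isqrt (suc m) with suc (isqrt m) ℕ.* suc (isqrt m) ℕ.≤? suc m
... | yes _ = suc (isqrt m)
... | no _  = isqrt m

isqrt-lower : ∀ m → isqrt m ℕ.* isqrt m ℕ.≤ m
isqrt-lower zero = ℕ.z≤n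
isqrt-lower (suc m) with suc (isqrt m) ℕ.* suc (isqrt m) ℕ.≤? suc m
... | yes p = p
... | no _  = ℕ.m≤n⇒m≤1+n (isqrt-lower m)

isqrt-upper : ∀ m → m ℕ.< suc (isqrt m) ℕ.* suc (isqrt m)
isqrt-upper zero = ℕ.s≤s ℕ.z≤n
isqrt-upper (suc m) with suc (isqrt m) ℕ.* suc (isqrt m) ℕ.≤? suc m
... | yes _ = ℕ.≤-<-trans (isqrt-upper m) (ℕ.*-mono-< k<1+k k<1+k)
  where
  k<1+k : suc (isqrt m) ℕ.< suc (suc (isqrt m))
  k<1+k = ℕ.n<1+n (suc (isqrt m))
... | no p  = ℕ.≰⇒> p

-- √(a/b) = √(ab)/b, rounded down to a multiple of 1/(b(n+1)).
root : ℚ → ℕ → ℚ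
root q n = (+ isqrt (a ℕ.* b ℕ.* (suc n ℕ.* suc n))) ℚ./ (b ℕ.* suc n)
  where
  a b : ℕ
  a = ℤ.∣ ℚ.↥ q ∣
  b = ℚ.↧ₙ q

approxRoot : ℚ → ℕ → ℚ
approxRoot q = root (q ℚ.⊔ 0ℚ)

0≤root : ∀ q n → 0ℚ ℚ.≤ root q n
0≤root q@(mkℚ i b-1 _) n = ℚ.nonNegative⁻¹ (root q n)
  {{ℚ.normalize-nonNeg (isqrt (ℤ.∣ i ∣ ℕ.* suc b-1 ℕ.* (suc n ℕ.* suc n))) (suc b-1 ℕ.* suc n)}}

root²≤ : ∀ q n → .{{ℚ.NonNegative q}} → root q n ℚ.* root q n ℚ.≤ q
root²≤ q@(mkℚ (+ a) b-1 _) n =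
  ℚ.toℚᵘ-cancel-≤ (ℚᵘ.≤-respˡ-≃ (ℚᵘ.≃-sym eq) (ℚᵘ.*≤* ineq))
  where
  b N C K : ℕ
  b = suc b-1
  N = suc n
  C = b ℕ.* N
  K = isqrt (a ℕ.* b ℕ.* (N ℕ.* N))

  r : ℚᵘ.ℚᵘ
  r = (+ K) ℚᵘ./ C

  eq : ℚ.toℚᵘ (root q n ℚ.* root q n) ℚᵘ.≃ r ℚᵘ.* r
  eq = ℚᵘ.≃-trans (ℚ.toℚᵘ-homo-* (root q n) (root q n))
         (ℚᵘ.*-cong (ℚ.toℚᵘ-fromℚᵘ r) (ℚ.toℚᵘ-fromℚᵘ r))

  ineqℕ : K ℕ.* K ℕ.* b ℕ.≤ a ℕ.* (C ℕ.* C)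
  ineqℕ = ℕ.≤-trans (ℕ.*-monoˡ-≤ b (isqrt-lower (a ℕ.* b ℕ.* (N ℕ.* N))))
    (ℕ.≤-reflexive (solve 3 (λ a b N → a :* b :* (N :* N) :* b := a :* ((b :* N) :* (b :* N)))
                      refl a b N))
    where open ℕ-Solver.+-*-Solver

  ineq : (+ K ℤ.* + K) ℤ.* + b ℤ.≤ + a ℤ.* + (C ℕ.* C)
  ineq = subst₂ ℤ._≤_
    (trans (ℤ.pos-* (K ℕ.* K) b) (cong (ℤ._* + b) (ℤ.pos-* K K)))
    (ℤ.pos-* a (C ℕ.* C))
    (ℤ.+≤+ ineqℕ)

<[root+1/suc]² : ∀ q n → .{{ℚ.NonNegative q}} →
  ∃[ s ] q ℚ.< s ℚ.* s × s ℚ.≤ root q n ℚ.+ + 1 ℚ./ suc n × 0ℚ ℚ.≤ s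
<[root+1/suc]² q@(mkℚ (+ a) b-1 _) n =
  s , ℚ.toℚᵘ-cancel-< (ℚᵘ.<-respʳ-≃ (ℚᵘ.≃-sym eq) (ℚᵘ.*<* ineq))
    , ℚ.toℚᵘ-cancel-≤ (ℚᵘ.≤-respˡ-≃ (ℚᵘ.≃-sym (ℚ.toℚᵘ-fromℚᵘ sᵘ))
        (ℚᵘ.≤-respʳ-≃ (ℚᵘ.≃-sym eq′) (ℚᵘ.*≤* ineq′)))
    , ℚ.nonNegative⁻¹ s {{ℚ.normalize-nonNeg (suc K) C}}
  where
  b N C K : ℕ
  b = suc b-1
  N = suc n
  C = b ℕ.* N
  K = isqrt (a ℕ.* b ℕ.* (N ℕ.* N))

  s : ℚ
  s = (+ suc K) ℚ./ C

  sᵘ r : ℚᵘ.ℚᵘ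
  sᵘ = (+ suc K) ℚᵘ./ C
  r  = (+ K) ℚᵘ./ C

  eq : ℚ.toℚᵘ (s ℚ.* s) ℚᵘ.≃ sᵘ ℚᵘ.* sᵘ
  eq = ℚᵘ.≃-trans (ℚ.toℚᵘ-homo-* s s)
         (ℚᵘ.*-cong (ℚ.toℚᵘ-fromℚᵘ sᵘ) (ℚ.toℚᵘ-fromℚᵘ sᵘ))

  eq′ : ℚ.toℚᵘ (root q n ℚ.+ + 1 ℚ./ suc n) ℚᵘ.≃ r ℚᵘ.+ + 1 ℚᵘ./ suc n
  eq′ = ℚᵘ.≃-trans (ℚ.toℚᵘ-homo-+ (root q n) (+ 1 ℚ./ suc n))
          (ℚᵘ.+-cong (ℚ.toℚᵘ-fromℚᵘ r) (ℚ.toℚᵘ-fromℚᵘ (+ 1 ℚᵘ./ suc n)))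

  open ℕ-Solver.+-*-Solver

  ineqℕ : a ℕ.* (C ℕ.* C) ℕ.< suc K ℕ.* suc K ℕ.* b
  ineqℕ = ℕ.≤-<-trans
    (ℕ.≤-reflexive (solve 3 (λ a b N → a :* ((b :* N) :* (b :* N)) := a :* b :* (N :* N) :* b)
                      refl a b N))
    (ℕ.*-monoˡ-< b (isqrt-upper (a ℕ.* b ℕ.* (N ℕ.* N))))

  ineq : + a ℤ.* + (C ℕ.* C) ℤ.< (+ suc K ℤ.* + suc K) ℤ.* + b
  ineq = subst₂ ℤ._<_
    (ℤ.pos-* a (C ℕ.* C))
    (trans (ℤ.pos-* (suc K ℕ.* suc K) b) (cong (ℤ._* + b) (ℤ.pos-* (suc K) (suc K))))
    (ℤ.+<+ ineqℕ)

  ineqℕ′ : suc K ℕ.* (C ℕ.* N) ℕ.≤ (K ℕ.* N ℕ.+ 1 ℕ.* C) ℕ.* C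
  ineqℕ′ = ℕ.≤-trans
    (ℕ.≤-reflexive (solve 3 (λ K C N → (con 1 :+ K) :* (C :* N) := K :* N :* C :+ C :* N)
                      refl K C N))
    (ℕ.≤-trans (ℕ.+-monoʳ-≤ (K ℕ.* N ℕ.* C) (ℕ.*-monoʳ-≤ C (ℕ.m≤n*m N b)))
      (ℕ.≤-reflexive (solve 3 (λ K C N → K :* N :* C :+ C :* C := (K :* N :+ con 1 :* C) :* C)
                        refl K C N)))

  ineq′ : + suc K ℤ.* + (C ℕ.* N) ℤ.≤ (+ K ℤ.* + N ℤ.+ + 1 ℤ.* + C) ℤ.* + C
  ineq′ = subst₂ ℤ._≤_
    (ℤ.pos-* (suc K) (C ℕ.* N))
    (trans (ℤ.pos-* (K ℕ.* N ℕ.+ 1 ℕ.* C) C)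
      (cong (ℤ._* + C) (trans (ℤ.pos-+ (K ℕ.* N) (1 ℕ.* C))
        (cong₂ ℤ._+_ (ℤ.pos-* K N) (ℤ.pos-* 1 C)))))
    (ℤ.+≤+ ineqℕ′)

module _ where
  open ℚ-Solver.+-*-Solver
  open ℚ.≤-Reasoning

  archimedean : ∀ ε → 0ℚ ℚ.< ε → ∃[ N ] ∀ n → N ℕ.≤ n → + 1 ℚ./ suc n ℚ.≤ ε
  archimedean ε@(mkℚ (+ suc u) d _) _ = d , λ n d≤n →
    ℚ.toℚᵘ-cancel-≤ (ℚᵘ.≤-respˡ-≃ (ℚᵘ.≃-sym (ℚ.toℚᵘ-fromℚᵘ (+ 1 ℚᵘ./ suc n)))
      (ℚᵘ.*≤* (subst₂ ℤ._≤_ (ℤ.pos-* 1 (suc d)) (ℤ.pos-* (suc u) (suc n))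
        (ℤ.+≤+ (ℕ.*-mono-≤ {1} {suc u} (ℕ.s≤s ℕ.z≤n) (ℕ.s≤s d≤n))))))
  archimedean (mkℚ (+ zero) _ _)  (ℚ.*<* (ℤ.+<+ ()))
  archimedean (mkℚ ℤ.-[1+ _ ] _ _) (ℚ.*<* ())

  p≤∣p∣ : ∀ p → p ℚ.≤ ℚ.∣ p ∣
  p≤∣p∣ p with ℚ.≤-total 0ℚ p
  ... | inj₁ 0≤p = ℚ.≤-reflexive (sym (ℚ.0≤p⇒∣p∣≡p 0≤p))
  ... | inj₂ p≤0 = ℚ.≤-trans p≤0 (ℚ.0≤∣p∣ p)

  ∣p-q∣<ε : ∀ p q ε → p ℚ.< q ℚ.+ ε → q ℚ.< p ℚ.+ ε → ℚ.∣ p ℚ.- q ∣ ℚ.< ε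
  ∣p-q∣<ε p q ε p<q+ε q<p+ε with ℚ.∣p∣≡p∨∣p∣≡-p (p ℚ.- q)
  ... | inj₁ eq = subst₂ ℚ._<_ (sym eq)
    (solve 2 (λ q e → (q :+ e) :- q := e) refl q ε) (ℚ.+-monoˡ-< (ℚ.- q) p<q+ε)
  ... | inj₂ eq = subst₂ ℚ._<_
    (trans (solve 2 (λ p q → q :- p := :- (p :- q)) refl p q) (sym eq))
    (solve 2 (λ p e → (p :+ e) :- p := e) refl p ε) (ℚ.+-monoˡ-< (ℚ.- p) q<p+ε)

  square-mono : ∀ {p q} → 0ℚ ℚ.≤ p → p ℚ.≤ q → p ℚ.* p ℚ.≤ q ℚ.* q
  square-mono {p} {q} 0≤p p≤q = ℚ.≤-trans
    (ℚ.*-monoˡ-≤-nonNeg p {{ℚ.nonNegative 0≤p}} p≤q)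
    (ℚ.*-monoʳ-≤-nonNeg q {{ℚ.nonNegative (ℚ.≤-trans 0≤p p≤q)}} p≤q)

  0≤p+q : ∀ {p q} → 0ℚ ℚ.≤ p → 0ℚ ℚ.≤ q → 0ℚ ℚ.≤ p ℚ.+ q
  0≤p+q 0≤p 0≤q = ℚ.+-mono-≤ 0≤p 0≤q

  0≤p*q : ∀ {p q} → 0ℚ ℚ.≤ p → 0ℚ ℚ.≤ q → 0ℚ ℚ.≤ p ℚ.* q
  0≤p*q {p} {q} 0≤p 0≤q = ℚ.nonNegative⁻¹ _
    {{ℚ.nonNeg*nonNeg⇒nonNeg p {{ℚ.nonNegative 0≤p}} q {{ℚ.nonNegative 0≤q}}}}

  -- If p ≤ q + η² with r² ≤ p and q < s², s ≤ t + η, then r < t + 2η.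
  root-step : ∀ {p q r s t η} → 0ℚ ℚ.≤ t → 0ℚ ℚ.≤ η → 0ℚ ℚ.≤ s →
    p ℚ.≤ q ℚ.+ η ℚ.* η → r ℚ.* r ℚ.≤ p → q ℚ.< s ℚ.* s → s ℚ.≤ t ℚ.+ η →
    r ℚ.< t ℚ.+ (η ℚ.+ η)
  root-step {p} {q} {r} {s} {t} {η} 0≤t 0≤η 0≤s p≤q+η² r²≤p q<s² s≤t+η =
    ℚ.≰⇒> λ t+2η≤r → ℚ.<-irrefl refl (begin-strict
      (t ℚ.+ (η ℚ.+ η)) ℚ.* (t ℚ.+ (η ℚ.+ η))
        ≤⟨ square-mono (0≤p+q 0≤t (0≤p+q 0≤η 0≤η)) t+2η≤r ⟩
      r ℚ.* r
        ≤⟨ ℚ.≤-trans r²≤p p≤q+η² ⟩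
      q ℚ.+ η ℚ.* η
        <⟨ ℚ.+-monoˡ-< (η ℚ.* η) q<s² ⟩
      s ℚ.* s ℚ.+ η ℚ.* η
        ≤⟨ ℚ.+-monoˡ-≤ (η ℚ.* η) (square-mono 0≤s s≤t+η) ⟩
      (t ℚ.+ η) ℚ.* (t ℚ.+ η) ℚ.+ η ℚ.* η
        ≡⟨ sym (ℚ.+-identityʳ ((t ℚ.+ η) ℚ.* (t ℚ.+ η) ℚ.+ η ℚ.* η)) ⟩
      (t ℚ.+ η) ℚ.* (t ℚ.+ η) ℚ.+ η ℚ.* η ℚ.+ 0ℚ
        ≤⟨ ℚ.+-monoʳ-≤ ((t ℚ.+ η) ℚ.* (t ℚ.+ η) ℚ.+ η ℚ.* η)
             (0≤p+q (0≤p*q 0≤t+η 0≤η) (0≤p*q 0≤t+η 0≤η)) ⟩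
      (t ℚ.+ η) ℚ.* (t ℚ.+ η) ℚ.+ η ℚ.* η ℚ.+ ((t ℚ.+ η) ℚ.* η ℚ.+ (t ℚ.+ η) ℚ.* η)
        ≡⟨ solve 2 (λ t e → (t :+ e) :* (t :+ e) :+ e :* e :+ ((t :+ e) :* e :+ (t :+ e) :* e)
                          := (t :+ (e :+ e)) :* (t :+ (e :+ e))) refl t η ⟩
      (t ℚ.+ (η ℚ.+ η)) ℚ.* (t ℚ.+ (η ℚ.+ η)) ∎)
    where
    0≤t+η : 0ℚ ℚ.≤ t ℚ.+ η
    0≤t+η = 0≤p+q 0≤t 0≤η

  ⊔0-step : ∀ p q η → 0ℚ ℚ.≤ η → ℚ.∣ p ℚ.- q ∣ ℚ.< η → p ℚ.⊔ 0ℚ ℚ.≤ (q ℚ.⊔ 0ℚ) ℚ.+ η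
  ⊔0-step p q η 0≤η p-q = ℚ.⊔-lub
    (begin
      p                        ≡⟨ solve 2 (λ p q → p := q :+ (p :- q)) refl p q ⟩
      q ℚ.+ (p ℚ.- q)          ≤⟨ ℚ.+-mono-≤ (ℚ.p≤p⊔q q 0ℚ) (ℚ.≤-trans (p≤∣p∣ (p ℚ.- q)) (ℚ.<⇒≤ p-q)) ⟩
      (q ℚ.⊔ 0ℚ) ℚ.+ η         ∎)
    (0≤p+q (ℚ.p≤q⊔p q 0ℚ) 0≤η)

  approxRoot-step : ∀ p q η m n → 0ℚ ℚ.≤ η → + 1 ℚ./ suc n ℚ.≤ η →
    ℚ.∣ p ℚ.- q ∣ ℚ.< η ℚ.* η → approxRoot p m ℚ.< approxRoot q n ℚ.+ (η ℚ.+ η)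
  approxRoot-step p q η m n 0≤η 1/n≤η p-q =
    let instance p⁺≥0 = ℚ.nonNegative (ℚ.p≤q⊔p p 0ℚ)
                 q⁺≥0 = ℚ.nonNegative (ℚ.p≤q⊔p q 0ℚ)
        s , q<s² , s≤ , 0≤s = <[root+1/suc]² (q ℚ.⊔ 0ℚ) n
    in root-step (0≤root (q ℚ.⊔ 0ℚ) n) 0≤η 0≤s (⊔0-step p q (η ℚ.* η) (0≤p*q 0≤η 0≤η) p-q)
         (root²≤ (p ℚ.⊔ 0ℚ) m) q<s²
         (ℚ.≤-trans s≤ (ℚ.+-monoʳ-≤ (approxRoot q n) 1/n≤η))

  approxRoot-cauchy′ : ∀ a → Cauchy a → ∀ η → 0ℚ ℚ.< η →
    ∃[ N ] ∀ m n → N ℕ.≤ m → N ℕ.≤ n →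
      ℚ.∣ approxRoot (a m) m ℚ.- approxRoot (a n) n ∣ ℚ.< η ℚ.+ η
  approxRoot-cauchy′ a ca η 0<η =
    let N , 1/n≤η = archimedean η 0<η
        M , p     = ca (η ℚ.* η) (ℚ.positive⁻¹ _
                      {{ℚ.pos*pos⇒pos η {{ℚ.positive 0<η}} η {{ℚ.positive 0<η}}}})
        0≤η       = ℚ.<⇒≤ 0<η
    in N ℕ.⊔ M , λ m n K≤m K≤n →
      let N≤m = ℕ.m⊔n≤o⇒m≤o N M K≤m
          M≤m = ℕ.m⊔n≤o⇒n≤o N M K≤m
          N≤n = ℕ.m⊔n≤o⇒m≤o N M K≤n
          M≤n = ℕ.m⊔n≤o⇒n≤o N M K≤n
      in ∣p-q∣<ε (approxRoot (a m) m) (approxRoot (a n) n) (η ℚ.+ η)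
           (approxRoot-step (a m) (a n) η m n 0≤η (1/n≤η n N≤n) (p m n M≤m M≤n))
           (approxRoot-step (a n) (a m) η n m 0≤η (1/n≤η m N≤m) (p n m M≤n M≤m))

  approxRoot-cauchy : ∀ a → Cauchy a → Cauchy (λ n → approxRoot (a n) n)
  approxRoot-cauchy a ca ε 0<ε =
    let N , p = approxRoot-cauchy′ a ca (½ ℚ.* ε) (half-pos 0<ε)
    in N , λ m n N≤m N≤n →
         subst (ℚ.∣ approxRoot (a m) m ℚ.- approxRoot (a n) n ∣ ℚ.<_) (half+half ε) (p m n N≤m N≤n)

-- √ x is the root of max(x,0); it is 0 for negative x.
√ : ℝ → ℝ
√ x = mkℝ (λ n → approxRoot (seq x n) n) (approxRoot-cauchy (seq x) (cauchy x))

⟨_,_⟩ : ∀ {n} → Vector ℝ n → Vector ℝ n → ℝ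
⟨ x , y ⟩ = sum (Vector.zipWith _*_ x y)

‖_‖₂ : ∀ {n} → Vector ℝ n → ℝ
‖ x ‖₂ = √ ⟨ x , x ⟩

-- The index set [d]ᵖ is identified with Fin (d ^ p) through finToFun.
infix 9 _^⊗_

_^⊗_ : ∀ {d} → Vector ℝ d → ∀ p → Vector ℝ (d ℕ.^ p)
_^⊗_ {d} x p u = product λ j → x (finToFun {d} {p} u j)

-- A non-empty list stands for the uniform
-- distribution on its entries, counted with multiplicity.
ℙ : ∀ {A : Set} {P : Pred A 0ℓ} → List⁺ A → Decidable P → ℚ
ℙ Ω P? = (+ List.length (List.filter P? (toList Ω))) ℚ./ List⁺.length Ω

𝔼 : ∀ {A : Set} → List⁺ A → (A → ℝ) → ℝ
𝔼 Ω X = fromℚ (+ 1 ℚ./ List⁺.length Ω) * List.foldr _+_ 0ℝ (List.map X (toList Ω))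

Var : ∀ {A : Set} → List⁺ A → (A → ℝ) → ℝ
Var Ω X = 𝔼 Ω λ ω → (X ω - 𝔼 Ω X) ^ 2

-- Independence is modelled by the product space.
infixr 2 _⊗_

_⊗_ : ∀ {A B : Set} → List⁺ A → List⁺ B → List⁺ (A × B)
Ω ⊗ Ω′ = List⁺.concatMap (λ ω → List⁺.map (ω ,_) Ω′) Ω

⨂ : ∀ {A : Set} {p} → (Fin p → List⁺ A) → List⁺ (Vector A p)
⨂ {p = zero}  Ω = List⁺.[ Vector.[] ]
⨂ {p = suc p} Ω = List⁺.map (λ (a , v) → a Vector.∷ v) (Vector.head Ω ⊗ ⨂ (Vector.tail Ω))

AgreeOn : ∀ {d} {R : Set} → Subset d → (f g : Fin d → R) → Set
AgreeOn I f g = ∀ i → i ∈ I → f i ≡ g i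

agreeOn? : ∀ {d r} {R : Set} → R ↔ Fin r → (I : Subset d) (g : Fin d → R) →
           Decidable (λ f → AgreeOn I f g)
agreeOn? e I g f =
  Fin.all? λ i → (i ∈? I) →-dec Fin.inj⇒≟ (↔⇒↣ e) (f i) (g i)

-- A point of Rᴵ is given as the restriction to I of some g : [d] → R.
KWiseIndependent : ∀ {d r} {R : Set} .{{_ : NonZero r}} →
                   ℕ → R ↔ Fin r → List⁺ (Fin d → R) → Set
KWiseIndependent {d} {r} {R} k e H =
  (I : Subset d) → ∣ I ∣ ℕ.≤ k → (g : Fin d → R) →
  ℙ H (agreeOn? e I g) ≡ (+ 1 ℚ./ (r ℕ.^ ∣ I ∣)) {{ℕ.m^n≢0 r ∣ I ∣}}

Sign↔Fin2 : Sign ↔ Fin 2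
Sign↔Fin2 = mk↔ₛ′
  (λ { Sign.- → 0F ; Sign.+ → 1F }) (λ { 0F → Sign.- ; 1F → Sign.+ })
  (λ { 0F → refl ; 1F → refl }) (λ { Sign.- → refl ; Sign.+ → refl })

±1 : Sign → ℝ
±1 Sign.+ = 1ℝ
±1 Sign.- = - 1ℝ

countSketch : ∀ {n D} → (Fin n → Fin D) → (Fin n → Sign) → Vector ℝ n → Vector ℝ D
countSketch H S x k = sum λ u → if does (H u Fin.≟ k) then ±1 (S u) * x u else 0ℝ

-- The residue of m modulo D is represented in Fin D by m mod D.
compositeHash : ∀ {d D p} .{{_ : NonZero D}} →
                Vector (Fin d → Fin D) p → Fin (d ℕ.^ p) → Fin D
compositeHash {D = D} h u =
  Vector.foldr ℕ._+_ 0 (λ j → toℕ (h j (finToFun u j))) mod D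

compositeSign : ∀ {d p} → Vector (Fin d → Sign) p → Fin (d ℕ.^ p) → Sign
compositeSign s u = Vector.foldr Sign._*_ Sign.+ (λ j → s j (finToFun u j))

{-# OPTIONS --safe #-}
module Submission where

open import Algebra.Bundles using (CommutativeRing)
import Algebra.Properties.CommutativeMonoid.Sum as CommutativeMonoidSum
import Algebra.Properties.CommutativeSemiring.Exp as Exp
import Algebra.Properties.Semiring.Sum as SemiringSum
open import Data.Bool.Base using (if_then_else_)
open import Data.Empty using (⊥-elim)
open import Data.Fin.Base as Fin using (Fin; zero; suc; toℕ; _↑ˡ_; _↑ʳ_; combine; finToFun)
import Data.Fin.Properties as Fin
open import Data.Fin.Subset as Subset using (Subset; inside; outside; _∈_; _∉_; ⊥)
import Data.Fin.Subset.Properties as Subset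
import Data.Integer.Base as ℤ
import Data.Integer.Properties as ℤ
open import Data.List.Base as List using (List; []; _∷_)
open import Data.List.NonEmpty.Base as List⁺ using (List⁺; toList)
import Data.List.NonEmpty.Properties as List⁺
import Data.List.Properties as List
open import Data.List.Relation.Unary.All as All using (All; []; _∷_)
open import Data.List.Relation.Unary.AllPairs using (AllPairs; []; _∷_)
open import Data.Nat.Base as ℕ using (ℕ; zero; suc; NonZero)
import Data.Nat.Divisibility as ℕ
open import Data.Nat.DivMod as ℕ using (_mod_; _%_)
import Data.Nat.Properties as ℕ
open import Data.Product.Base using (_×_; _,_; proj₁; proj₂; ∃-syntax)
open import Data.Rational.Base as ℚ using (ℚ)
open import Data.Rational.Solver using (module +-*-Solver)
import Data.Rational.Unnormalised.Base as ℚᵘ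
import Data.Rational.Unnormalised.Properties as ℚᵘ
open import Data.Sign.Base as Sign using (Sign)
open import Data.Sum.Base using (inj₁; inj₂)
open import Data.Vec.Base as Vec using (_[_]≔_; here; there)
import Data.Vec.Properties as Vec
open import Data.Vec.Functional as Vector using (Vector)
import Data.Vec.Functional.Properties as Vector
open import Function.Base using (_∘_)
open import Function.Bundles using (_↔_; Inverse)
open import Function.Construct.Identity using (↔-id)
open import Function.Properties.Inverse using (↔⇒↣)
open import Level using (0ℓ)
open import Relation.Binary.PropositionalEquality
open import Relation.Nullary.Decidable using (Dec; yes; no; does)
open import Relation.Nullary.Negation using (¬_)
open import Relation.Unary using (Pred; Decidable)
import Defs as ℝ

-- Except for √, all operations on ℝ act termwise on Cauchy sequences, so that
-- the claims are identities and inequalities over ℚ at every index, once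
-- √ a * √ a ≃ a is known for a ≥ 0.
--
-- Over ℚ, expand Z² as a sum over quadruples (u, v, u′, v′) of tensor indices.
-- The expectation of the signs factors over the coordinates j, and it vanishes
-- unless u_j, v_j, u′_j, v′_j match in pairs for every j. The terms with u = v
-- and u′ = v′ sum to (E Z)²; in every other term the hash collision has
-- probability at most 1/D. With entries replaced by absolute values, the other
-- terms sum to t ^ p - s ^ p, where s = ⟨∣x∣,∣y∣⟩² ≤ n = ‖x‖²‖y‖² and
-- t - s ≤ 2 n by Cauchy-Schwarz, and so t ^ p - s ^ p ≤ (3 ^ p - 1) n ^ p.

-- The moments of the signs factor over the coordinates, but the collision probability does not,
-- because `compositeHash` adds up the coordinates before reducing modulo D. It has to be replaced
-- by the constant 1/D before the sum over quadruples can become a p-th power. The weights may have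
-- either sign, so the replacement is made on absolute values; it costs nothing on the terms with u
-- = v and u′ = v′, which cancel exactly against the squared mean. A quadruple outside this diagonal
-- may still satisfy u_j = v_j and u′_j = v′_j at some coordinates, hence a difference of powers t ^
-- p - s ^ p rather than (t - s) ^ p. The 3 counts the pairings of four points, and the 1 is the
-- diagonal that was removed. Only one of the two collisions is charged, since the other may be
-- certain. So pairs of hash values are enough, whereas four signs are multiplied at each
-- coordinate.

module Moments where
  open import Data.Rational.Base using
    ( 0ℚ; 1ℚ; ½; _+_; _*_; -_; _-_; _≤_; _<_; ∣_∣; _/_; _⊔_; fromℚᵘ
    ; nonNegative; positive; >-nonZero)
  open import Data.Rational.Properties
  open ℝ using
    ( ℝ; seq; cauchy; _≃_; fromℚ; √; ⟨_,_⟩; ‖_‖₂; _^⊗_; ℙ; 𝔼; Var; _⊗_; ⨂; AgreeOn; agreeOn?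
    ; KWiseIndependent; Sign↔Fin2; ±1; countSketch; compositeHash; compositeSign; p≤∣p∣)
  open Exp (CommutativeRing.commutativeSemiring +-*-commutativeRing) using (_^_; ^-distrib-*; ^-assocʳ)

  private
    module S = SemiringSum (CommutativeRing.semiring +-*-commutativeRing)
    module Π = CommutativeMonoidSum *-1-commutativeMonoid

    variable
      A B : Set
      P Q S : Set

  -- Rational arithmetic

  0≤* : ∀ {p q} → 0ℚ ≤ p → 0ℚ ≤ q → 0ℚ ≤ p * q
  0≤* {p} {q} 0≤p 0≤q =
    nonNegative⁻¹ _ {{nonNeg*nonNeg⇒nonNeg p {{nonNegative 0≤p}} q {{nonNegative 0≤q}}}}

  *-monoˡ-≤ : ∀ {r p q} → 0ℚ ≤ r → p ≤ q → r * p ≤ r * q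
  *-monoˡ-≤ {r} 0≤r = *-monoˡ-≤-nonNeg r {{nonNegative 0≤r}}

  *-monoʳ-≤ : ∀ {r p q} → 0ℚ ≤ r → p ≤ q → p * r ≤ q * r
  *-monoʳ-≤ {r} 0≤r = *-monoʳ-≤-nonNeg r {{nonNegative 0≤r}}

  *-mono-≤ : ∀ {p q r s} → 0ℚ ≤ p → 0ℚ ≤ s → p ≤ q → r ≤ s → p * r ≤ q * s
  *-mono-≤ 0≤p 0≤s p≤q r≤s = ≤-trans (*-monoˡ-≤ 0≤p r≤s) (*-monoʳ-≤ 0≤s p≤q)

  0≤p² : ∀ p → 0ℚ ≤ p * p
  0≤p² p with ≤-total 0ℚ p
  ... | inj₁ 0≤p = 0≤* 0≤p 0≤p
  ... | inj₂ p≤0 = subst (0ℚ ≤_) (solve 1 (λ p → (:- p) :* (:- p) := p :* p) refl p)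
                  (0≤* 0≤-p 0≤-p)
    where
    open +-*-Solver
    0≤-p : 0ℚ ≤ - p
    0≤-p = neg-antimono-≤ p≤0

  0≤1 : 0ℚ ≤ 1ℚ
  0≤1 = nonNegative⁻¹ 1ℚ

  0≤q-p : ∀ {p q} → p ≤ q → 0ℚ ≤ q - p
  0≤q-p {p} {q} p≤q = subst (_≤ q - p) (+-inverseʳ p) (+-monoˡ-≤ (- p) p≤q)

  0≤q-p⇒p≤q : ∀ {p q} → 0ℚ ≤ q - p → p ≤ q
  0≤q-p⇒p≤q {p} {q} 0≤q-p = subst₂ _≤_ (+-identityˡ p)
    (solve 2 (λ p q → (q :- p) :+ p := q) refl p q) (+-monoˡ-≤ p 0≤q-p)
    where open +-*-Solver

  fromℚᵘ-homo-* : ∀ p q → fromℚᵘ p * fromℚᵘ q ≡ fromℚᵘ (p ℚᵘ.* q)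
  fromℚᵘ-homo-* p q = toℚᵘ-injective
    (ℚᵘ.≃-trans (toℚᵘ-homo-* (fromℚᵘ p) (fromℚᵘ q))
      (ℚᵘ.≃-trans (ℚᵘ.*-cong (toℚᵘ-fromℚᵘ p) (toℚᵘ-fromℚᵘ q))
        (ℚᵘ.≃-sym (toℚᵘ-fromℚᵘ (p ℚᵘ.* q)))))

  fromℚᵘ-homo-+ : ∀ p q → fromℚᵘ p + fromℚᵘ q ≡ fromℚᵘ (p ℚᵘ.+ q)
  fromℚᵘ-homo-+ p q = toℚᵘ-injective
    (ℚᵘ.≃-trans (toℚᵘ-homo-+ (fromℚᵘ p) (fromℚᵘ q))
      (ℚᵘ.≃-trans (ℚᵘ.+-cong (toℚᵘ-fromℚᵘ p) (toℚᵘ-fromℚᵘ q))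
        (ℚᵘ.≃-sym (toℚᵘ-fromℚᵘ (p ℚᵘ.+ q)))))

  ι-suc : ∀ n → ℤ.+ suc n / 1 ≡ 1ℚ + ℤ.+ n / 1
  ι-suc n = sym (trans (fromℚᵘ-homo-+ (ℚᵘ.mkℚᵘ (ℤ.+ 1) 0) (ℚᵘ.mkℚᵘ (ℤ.+ n) 0))
    (fromℚᵘ-cong {ℚᵘ.mkℚᵘ (ℤ.+ 1) 0 ℚᵘ.+ ℚᵘ.mkℚᵘ (ℤ.+ n) 0} {ℚᵘ.mkℚᵘ (ℤ.+ suc n) 0}
      (ℚᵘ.*≡* (cong (ℤ._* ℤ.+ 1) (cong (ℤ._+_ (ℤ.+ 1)) (ℤ.*-identityʳ (ℤ.+ n)))))))

  ι-* : ∀ m n → ℤ.+ (m ℕ.* n) / 1 ≡ (ℤ.+ m / 1) * (ℤ.+ n / 1)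
  ι-* m n = sym (trans (fromℚᵘ-homo-* (ℚᵘ.mkℚᵘ (ℤ.+ m) 0) (ℚᵘ.mkℚᵘ (ℤ.+ n) 0))
    (fromℚᵘ-cong {ℚᵘ.mkℚᵘ (ℤ.+ m) 0 ℚᵘ.* ℚᵘ.mkℚᵘ (ℤ.+ n) 0} {ℚᵘ.mkℚᵘ (ℤ.+ (m ℕ.* n)) 0}
      (ℚᵘ.*≡* (cong (ℤ._* ℤ.+ 1) (sym (ℤ.pos-* m n))))))

  opaque
    -- Opaque, so that reciprocals are never normalised as fractions and are handled only through
    -- the equations below; `/≡1/*` splits any fraction into a reciprocal and an integer.
    1/_ : ∀ n .{{_ : NonZero n}} → ℚ
    1/ n = ℤ.+ 1 / n

    1/-def : ∀ n .{{_ : NonZero n}} → 1/ n ≡ ℤ.+ 1 / n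
    1/-def n = refl

    1/1≡1 : 1/ 1 ≡ 1ℚ
    1/1≡1 = refl

    1/-* : ∀ m n .{{_ : NonZero m}} .{{_ : NonZero n}} .{{_ : NonZero (m ℕ.* n)}} → 1/
        (m ℕ.* n) ≡ 1/ m * 1/ n
    1/-* (suc m) (suc n) = sym (fromℚᵘ-homo-* (ℚᵘ.mkℚᵘ (ℤ.+ 1) m) (ℚᵘ.mkℚᵘ (ℤ.+ 1) n))

    /≡1/* : ∀ i n .{{_ : NonZero n}} → i / n ≡ 1/ n * (i / 1)
    /≡1/* i (suc n) = sym (trans (fromℚᵘ-homo-* (ℚᵘ.mkℚᵘ (ℤ.+ 1) n) (ℚᵘ.mkℚᵘ i 0))
      (fromℚᵘ-cong {ℚᵘ.mkℚᵘ (ℤ.+ 1) n ℚᵘ.* ℚᵘ.mkℚᵘ i 0} {ℚᵘ.mkℚᵘ i n}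
        (ℚᵘ.*≡* (cong₂ ℤ._*_ (ℤ.*-identityˡ i) (cong ℤ.+_ (sym (ℕ.*-identityʳ (suc n))))))))

    1/n*n : ∀ n .{{_ : NonZero n}} → 1/ n * (ℤ.+ n / 1) ≡ 1ℚ
    1/n*n n@(suc n-1) = trans (sym (/≡1/* (ℤ.+ n) n))
      (fromℚᵘ-cong {ℚᵘ.mkℚᵘ (ℤ.+ n) n-1} {ℚᵘ.mkℚᵘ (ℤ.+ 1) 0} (ℚᵘ.*≡* (ℤ.*-comm (ℤ.+ n) (ℤ.+ 1))))

    0≤1/n : ∀ n .{{_ : NonZero n}} → 0ℚ ≤ 1/ n
    0≤1/n n = nonNegative⁻¹ (1/ n) {{normalize-nonNeg 1 n}}

  1/-cong : ∀ {m n} .{{_ : NonZero m}} .{{_ : NonZero n}} → m ≡ n → 1/ m ≡ 1/ n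
  1/-cong refl = refl

  -- Finite sums and products

  opaque
    ∑ ∏ : ∀ {n} → Vector ℚ n → ℚ
    ∑ = S.sum
    ∏ = Π.sum

    ∑-cong : ∀ {n} {f g : Vector ℚ n} → f ≗ g → ∑ f ≡ ∑ g
    ∑-cong = S.sum-cong-≗

    ∏-cong : ∀ {n} {f g : Vector ℚ n} → f ≗ g → ∏ f ≡ ∏ g
    ∏-cong = Π.sum-cong-≗

    ∑-suc : ∀ {n} (f : Vector ℚ (suc n)) → ∑ f ≡ f zero + ∑ (f ∘ suc)
    ∑-suc f = refl

    ∏-suc : ∀ {n} (f : Vector ℚ (suc n)) → ∏ f ≡ f zero * ∏ (f ∘ suc)
    ∏-suc f = refl

    ∑-[] : ∀ (f : Vector ℚ 0) → ∑ f ≡ 0ℚ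
    ∑-[] f = refl

    ∏-[] : ∀ (f : Vector ℚ 0) → ∏ f ≡ 1ℚ
    ∏-[] f = refl

    ∑-comm : ∀ {m n} (f : Fin m → Fin n → ℚ) → ∑ (λ i → ∑ λ j → f i j) ≡ ∑ λ j → ∑ λ i → f i j
    ∑-comm = S.∑-comm

    ∑-distrib-+ : ∀ {n} (f g : Vector ℚ n) → ∑ (λ i → f i + g i) ≡ ∑ f + ∑ g
    ∑-distrib-+ = S.∑-distrib-+

    ∏-distrib-* : ∀ {n} (f g : Vector ℚ n) → ∏ (λ i → f i * g i) ≡ ∏ f * ∏ g
    ∏-distrib-* = Π.∑-distrib-+

    *-distribˡ-∑ : ∀ {n} c (f : Vector ℚ n) → c * ∑ f ≡ ∑ λ i → c * f i
    *-distribˡ-∑ = S.*-distribˡ-sum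

    *-distribʳ-∑ : ∀ {n} c (f : Vector ℚ n) → ∑ f * c ≡ ∑ λ i → f i * c
    *-distribʳ-∑ = S.*-distribʳ-sum

    ∑-const : ∀ n c → ∑ {n} (λ _ → c) ≡ (ℤ.+ n / 1) * c
    ∑-const zero c = sym (*-zeroˡ c)
    ∑-const (suc n) c = trans (cong (c +_) (∑-const n c))
      (trans (solve 2 (λ c n → c :+ n :* c := (con 1ℚ :+ n) :* c) refl c (ℤ.+ n / 1))
        (cong (_* c) (sym (ι-suc n))))
      where open +-*-Solver

    ∏-const : ∀ n c → ∏ {n} (λ _ → c) ≡ c ^ n
    ∏-const n c = Π.sum-replicate n

    ∑-mono : ∀ {n} {f g : Vector ℚ n} → (∀ i → f i ≤ g i) → ∑ f ≤ ∑ g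
    ∑-mono {zero} f≤g = ≤-refl
    ∑-mono {suc n} f≤g = +-mono-≤ (f≤g zero) (∑-mono (f≤g ∘ suc))

    ∑-zero : ∀ {n} {f : Vector ℚ n} → (∀ i → f i ≡ 0ℚ) → ∑ f ≡ 0ℚ
    ∑-zero {zero} f≡0 = refl
    ∑-zero {suc n} f≡0 = trans (cong₂ _+_ (f≡0 zero) (∑-zero (f≡0 ∘ suc))) (+-identityˡ 0ℚ)

    0≤∑ : ∀ {n} {f : Vector ℚ n} → (∀ i → 0ℚ ≤ f i) → 0ℚ ≤ ∑ f
    0≤∑ {zero} 0≤f = ≤-refl
    0≤∑ {suc n} 0≤f = +-mono-≤ (0≤f zero) (0≤∑ (0≤f ∘ suc))

    ∑-distrib-- : ∀ {n} (f g : Vector ℚ n) → ∑ (λ i → f i - g i) ≡ ∑ f - ∑ g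
    ∑-distrib-- {zero} f g = refl
    ∑-distrib-- {suc n} f g = trans (cong (f zero - g zero +_) (∑-distrib-- (f ∘ suc) (g ∘ suc)))
      (solve 4 (λ a b c e → (a :- b) :+ (c :- e) := (a :+ c) :- (b :+ e)) refl
         (f zero) (g zero) (∑ (f ∘ suc)) (∑ (g ∘ suc)))
      where open +-*-Solver

    ∑*∑ : ∀ {m n} (f : Vector ℚ m) (g : Vector ℚ n) → ∑ f * ∑ g ≡ ∑ λ i → ∑ λ j → f i * g j
    ∑*∑ f g = trans (*-distribʳ-∑ (∑ g) f) (S.sum-cong-≗ λ i → *-distribˡ-∑ (f i) g)

    ∑-+ : ∀ m {n} (f : Vector ℚ (m ℕ.+ n)) → ∑ f ≡ ∑ (λ i → f (i ↑ˡ n)) + ∑ (λ j → f (m ↑ʳ j))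
    ∑-+ zero f = sym (+-identityˡ _)
    ∑-+ (suc m) {n} f = trans (cong (f zero +_) (∑-+ m (f ∘ suc)))
        (sym (+-assoc (f zero) (∑ λ i → f (suc (i ↑ˡ n))) (∑ λ j → f (suc m ↑ʳ j))))

    ∑-combine : ∀ m {n} (f : Vector ℚ (m ℕ.* n)) → ∑ f ≡ ∑ λ i → ∑ λ j → f (combine {m} {n} i j)
    ∑-combine zero f = refl
    ∑-combine (suc m) {n} f = trans (∑-+ n f)
        (cong (∑ (λ i → f (i ↑ˡ m ℕ.* n)) +_) (∑-combine m (λ k → f (n ↑ʳ k))))

    0≤∏ : ∀ {n} {f : Vector ℚ n} → (∀ i → 0ℚ ≤ f i) → 0ℚ ≤ ∏ f
    0≤∏ {zero} 0≤f = 0≤1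
    0≤∏ {suc n} 0≤f = 0≤* (0≤f zero) (0≤∏ (0≤f ∘ suc))

    ∏-zero : ∀ {n} {f : Vector ℚ n} i → f i ≡ 0ℚ → ∏ f ≡ 0ℚ
    ∏-zero {f = f} zero fi≡0 = trans (cong (_* ∏ (f ∘ suc)) fi≡0) (*-zeroˡ (∏ (f ∘ suc)))
    ∏-zero {f = f} (suc i) fi≡0 = trans (cong (f zero *_) (∏-zero i fi≡0)) (*-zeroʳ (f zero))

    ∏-one : ∀ {n} {f : Vector ℚ n} → (∀ i → f i ≡ 1ℚ) → ∏ f ≡ 1ℚ
    ∏-one {zero} f≡1 = refl
    ∏-one {suc n} f≡1 = trans (cong₂ _*_ (f≡1 zero) (∏-one (f≡1 ∘ suc))) (*-identityˡ 1ℚ)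

    ∣∏∣ : ∀ {n} (f : Vector ℚ n) → ∣ ∏ f ∣ ≡ ∏ λ i → ∣ f i ∣
    ∣∏∣ {zero} f = refl
    ∣∏∣ {suc n} f = trans (∣p*q∣≡∣p∣*∣q∣ (f zero) (∏ (f ∘ suc)))
        (cong (∣ f zero ∣ *_) (∣∏∣ (f ∘ suc)))

  -- Distributivity of products over sums, by induction on `p`: `combine` splits a tuple index into
  -- its first coordinate and the rest. Every passage from tensor indices to a p-th power rests on
  -- this.
  ∑-finToFun : ∀ {d} p (f : Fin p → Fin d → ℚ) →
               ∑ (λ (u : Fin (d ℕ.^ p)) → ∏ λ j → f j (finToFun u j)) ≡ ∏ λ j → ∑ (f j)
  ∑-finToFun zero f = trans (∑-suc _) (trans (cong₂ _+_ (∏-[] _) (∑-[] _)) (sym (∏-[] _)))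
  ∑-finToFun {d} (suc p) f = begin
    ∑ (λ (u : Fin (d ℕ.^ suc p)) → ∏ λ j → f j (finToFun u j))
      ≡⟨ ∑-combine d _ ⟩
    ∑ (λ i → ∑ λ u → ∏ λ j → f j (finToFun (combine {d} i u) j))
      ≡⟨ ∑-cong (λ i → ∑-cong λ u → trans (∏-suc _) (cong₂ _*_
           (cong (λ z → f zero (proj₁ z)) (Fin.remQuot-combine i u))
           (cong (λ z → ∏ λ j → f (suc j) (finToFun (proj₂ z) j)) (Fin.remQuot-combine i u)))) ⟩
    ∑ (λ i → ∑ λ u → f zero i * ∏ λ j → f (suc j) (finToFun u j))
      ≡⟨ sym (∑*∑ (f zero) _) ⟩
    ∑ (f zero) * ∑ (λ (u : Fin (d ℕ.^ p)) → ∏ λ j → f (suc j) (finToFun u j))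
      ≡⟨ cong (∑ (f zero) *_) (∑-finToFun p (f ∘ suc)) ⟩
    ∑ (f zero) * ∏ (λ j → ∑ (f (suc j)))
      ≡⟨ sym (∏-suc _) ⟩
    ∏ (λ j → ∑ (f j)) ∎
    where open ≡-Reasoning

  𝟙 : Dec P → ℚ
  𝟙 P? = if does P? then 1ℚ else 0ℚ

  𝟙-yes : (P? : Dec P) → P → 𝟙 P? ≡ 1ℚ
  𝟙-yes (yes _) p = refl
  𝟙-yes (no ¬p) p = ⊥-elim (¬p p)

  𝟙-no : (P? : Dec P) → ¬ P → 𝟙 P? ≡ 0ℚ
  𝟙-no (yes p) ¬p = ⊥-elim (¬p p)
  𝟙-no (no _) ¬p = refl

  0≤𝟙 : (P? : Dec P) → 0ℚ ≤ 𝟙 P?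
  0≤𝟙 (yes _) = 0≤1
  0≤𝟙 (no _) = ≤-refl

  𝟙≤1 : (P? : Dec P) → 𝟙 P? ≤ 1ℚ
  𝟙≤1 (yes _) = ≤-refl
  𝟙≤1 (no _) = 0≤1

  𝟙-cong : (P? : Dec P) (Q? : Dec Q) → (P → Q) → (Q → P) → 𝟙 P? ≡ 𝟙 Q?
  𝟙-cong P? (yes q) _ Q→P = 𝟙-yes P? (Q→P q)
  𝟙-cong P? (no ¬q) P→Q _ = 𝟙-no P? (¬q ∘ P→Q)

  δ : ∀ {n} → Fin n → Fin n → ℚ
  δ a b = 𝟙 (a Fin.≟ b)

  δ-sym : ∀ {n} (a b : Fin n) → δ a b ≡ δ b a
  δ-sym a b = 𝟙-cong (a Fin.≟ b) (b Fin.≟ a) sym sym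

  ∑-δ : ∀ {n} (a : Fin n) (f : Vector ℚ n) → ∑ (λ b → δ a b * f b) ≡ f a
  ∑-δ zero f = trans (∑-suc _)
    (trans (cong₂ _+_ (*-identityˡ (f zero)) (∑-zero λ b → *-zeroˡ (f (suc b))))
        (+-identityʳ (f zero)))
  ∑-δ (suc a) f = trans (∑-suc _)
    (trans (cong₂ _+_ (*-zeroˡ (f zero))
        (trans (∑-cong λ b → cong (_* f (suc b)) (δ-suc b)) (∑-δ a (f ∘ suc))))
      (+-identityˡ (f (suc a))))
    where
    δ-suc : ∀ b → δ (suc a) (suc b) ≡ δ a b
    δ-suc b = 𝟙-cong (suc a Fin.≟ suc b) (a Fin.≟ b) Fin.suc-injective (cong suc)

  -- Uniform expectations

  opaque
    total : (A → ℚ) → List A → ℚ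
    total f xs = List.foldr _+_ 0ℚ (List.map f xs)

    total-++ : ∀ (f : A → ℚ) xs ys → total f (xs List.++ ys) ≡ total f xs + total f ys
    total-++ f [] ys = sym (+-identityˡ _)
    total-++ f (x ∷ xs) ys = trans (cong (f x +_) (total-++ f xs ys))
        (sym (+-assoc (f x) (total f xs) (total f ys)))

    total-cong : ∀ {f g : A → ℚ} → f ≗ g → ∀ xs → total f xs ≡ total g xs
    total-cong f≗g [] = refl
    total-cong f≗g (x ∷ xs) = cong₂ _+_ (f≗g x) (total-cong f≗g xs)

    total-mono : ∀ {f g : A → ℚ} → (∀ x → f x ≤ g x) → ∀ xs → total f xs ≤ total g xs
    total-mono f≤g [] = ≤-refl
    total-mono f≤g (x ∷ xs) = +-mono-≤ (f≤g x) (total-mono f≤g xs)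

    total-+ : ∀ (f g : A → ℚ) xs → total (λ x → f x + g x) xs ≡ total f xs + total g xs
    total-+ f g [] = refl
    total-+ f g (x ∷ xs) = trans (cong (f x + g x +_) (total-+ f g xs))
      (solve 4 (λ a b c e → (a :+ b) :+ (c :+ e) := (a :+ c) :+ (b :+ e)) refl (f x) (g x)
          (total f xs) (total g xs))
      where open +-*-Solver

    total-* : ∀ c (f : A → ℚ) xs → total (λ x → c * f x) xs ≡ c * total f xs
    total-* c f [] = sym (*-zeroʳ c)
    total-* c f (x ∷ xs) = trans (cong (c * f x +_) (total-* c f xs))
        (sym (*-distribˡ-+ c (f x) (total f xs)))

    total-const : ∀ c (xs : List A) → total (λ _ → c) xs ≡ (ℤ.+ List.length xs / 1) * c
    total-const c [] = sym (*-zeroˡ c)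
    total-const c (x ∷ xs) = trans (cong (c +_) (total-const c xs))
      (trans (solve 2 (λ c n → c :+ n :* c := (con 1ℚ :+ n) :* c) refl c (ℤ.+ List.length xs / 1))
        (cong (_* c) (sym (ι-suc (List.length xs)))))
      where open +-*-Solver

    total-map : ∀ (f : B → ℚ) (g : A → B) xs → total f (List.map g xs) ≡ total (f ∘ g) xs
    total-map f g xs = cong (List.foldr _+_ 0ℚ) (sym (List.map-∘ xs))

    total-concatMap : ∀ (f : B → ℚ) (g : A → List B) xs → total f
        (List.concat (List.map g xs)) ≡ total (total f ∘ g) xs
    total-concatMap f g [] = refl
    total-concatMap f g (x ∷ xs) = trans (total-++ f (g x) (List.concat (List.map g xs)))
        (cong (total f (g x) +_) (total-concatMap f g xs))

    total-filter : ∀ {P : Pred A 0ℓ} (P? : Decidable P) xs →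
                   ℤ.+ List.length (List.filter P? xs) / 1 ≡ total (𝟙 ∘ P?) xs
    total-filter P? [] = refl
    total-filter P? (x ∷ xs) with P? x
    ... | yes _ = trans (ι-suc (List.length (List.filter P? xs)))
        (cong (1ℚ +_) (total-filter P? xs))
    ... | no _ = trans (total-filter P? xs) (sym (+-identityˡ (total (𝟙 ∘ P?) xs)))

  length-ι : ∀ (xs : List A) → ℤ.+ List.length xs / 1 ≡ total (λ _ → 1ℚ) xs
  length-ι xs = sym (trans (total-const 1ℚ xs) (*-identityʳ _))

  ι-injective : ∀ {m n} → ℤ.+ m / 1 ≡ ℤ.+ n / 1 → m ≡ n
  ι-injective {m} {n} eq = ℤ.+-injective
      (trans (sym (ℤ.*-identityʳ (ℤ.+ m)))
      (trans (ℚᵘ.drop-*≡* (/-injective-≃ (ℚᵘ.mkℚᵘ (ℤ.+ m) 0) (ℚᵘ.mkℚᵘ (ℤ.+ n) 0) eq))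
      (ℤ.*-identityʳ (ℤ.+ n))))

  opaque
    E : List⁺ A → (A → ℚ) → ℚ
    E Ω f = 1/ List⁺.length Ω * total f (toList Ω)

  module _ (Ω : List⁺ A) where
    opaque
      unfolding E

      E-cong : ∀ {f g : A → ℚ} → f ≗ g → E Ω f ≡ E Ω g
      E-cong f≗g = cong (1/ List⁺.length Ω *_) (total-cong f≗g (toList Ω))

      E-mono : ∀ {f g : A → ℚ} → (∀ ω → f ω ≤ g ω) → E Ω f ≤ E Ω g
      E-mono f≤g = *-monoˡ-≤ (0≤1/n (List⁺.length Ω)) (total-mono f≤g (toList Ω))

      E-+ : ∀ (f g : A → ℚ) → E Ω (λ ω → f ω + g ω) ≡ E Ω f + E Ω g
      E-+ f g = trans (cong (1/ List⁺.length Ω *_) (total-+ f g (toList Ω)))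
        (*-distribˡ-+ (1/ List⁺.length Ω) (total f (toList Ω)) (total g (toList Ω)))

      E-*ˡ : ∀ c (f : A → ℚ) → E Ω (λ ω → c * f ω) ≡ c * E Ω f
      E-*ˡ c f = trans (cong (1/ List⁺.length Ω *_) (total-* c f (toList Ω)))
        (solve 3 (λ a b c → a :* (b :* c) := b :* (a :* c)) refl (1/ List⁺.length Ω) c
            (total f (toList Ω)))
        where open +-*-Solver

      E-*ʳ : ∀ c (f : A → ℚ) → E Ω (λ ω → f ω * c) ≡ E Ω f * c
      E-*ʳ c f = trans (E-cong λ ω → *-comm (f ω) c) (trans (E-*ˡ c f) (*-comm c (E Ω f)))

      E-const : ∀ c → E Ω (λ _ → c) ≡ c
      E-const c = trans (cong (1/ List⁺.length Ω *_) (total-const c (toList Ω)))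
        (trans (sym (*-assoc (1/ List⁺.length Ω) (ℤ.+ List⁺.length Ω / 1) c))
            (trans (cong (_* c) (1/n*n (List⁺.length Ω))) (*-identityˡ c)))

      E-∑ : ∀ {n} (f : Fin n → A → ℚ) → E Ω (λ ω → ∑ λ i → f i ω) ≡ ∑ λ i → E Ω (f i)
      E-∑ {zero} f = trans (E-cong λ ω → ∑-[] _) (trans (E-const 0ℚ) (sym (∑-[] _)))
      E-∑ {suc n} f = trans (E-cong λ ω → ∑-suc _)
        (trans (E-+ (f zero) _) (trans (cong (E Ω (f zero) +_) (E-∑ (f ∘ suc))) (sym (∑-suc _))))

      ℙ≡E : ∀ {P : Pred A 0ℓ} (P? : Decidable P) → ℙ Ω P? ≡ E Ω (𝟙 ∘ P?)
      ℙ≡E P? = trans (/≡1/* (ℤ.+ List.length (List.filter P? (toList Ω))) (List⁺.length Ω))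
          (cong (1/ List⁺.length Ω *_) (total-filter P? (toList Ω)))

      E-map : ∀ (g : A → B) (f : B → ℚ) → E (List⁺.map g Ω) f ≡ E Ω (f ∘ g)
      E-map g f = cong₂ _*_ (1/-cong (cong suc (List.length-map g (List⁺.tail Ω))))
          (total-map f g (toList Ω))

  module _ (Ω : List⁺ A) (Ω′ : List⁺ B) where
    opaque
      unfolding E

      total-⊗ : ∀ (f : A × B → ℚ) →
        total f (toList (Ω ⊗ Ω′)) ≡ total (λ a → total (λ b → f (a , b)) (toList Ω′)) (toList Ω)
      total-⊗ f = trans (cong (total f) (sym (List⁺.toList->>= (λ a → List⁺.map (a ,_) Ω′) Ω)))
        (trans (total-concatMap f _ (toList Ω))
            (total-cong (λ a → total-map f (a ,_) (toList Ω′)) (toList Ω)))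

      -- Counting is done in ℚ: a length is the total of the constant 1, so that `total-⊗` applies,
      -- and `ι-injective` leads back to ℕ.
      length-⊗ : List⁺.length (Ω ⊗ Ω′) ≡ List⁺.length Ω ℕ.* List⁺.length Ω′
      length-⊗ = ι-injective (begin
        ℤ.+ List⁺.length (Ω ⊗ Ω′) / 1
          ≡⟨ length-ι (toList (Ω ⊗ Ω′)) ⟩
        total (λ _ → 1ℚ) (toList (Ω ⊗ Ω′))
          ≡⟨ total-⊗ (λ _ → 1ℚ) ⟩
        total (λ _ → total (λ _ → 1ℚ) (toList Ω′)) (toList Ω)
          ≡⟨ total-const _ (toList Ω) ⟩
        ℤ.+ List⁺.length Ω / 1 * total (λ _ → 1ℚ) (toList Ω′)
          ≡⟨ cong (ℤ.+ List⁺.length Ω / 1 *_) (sym (length-ι (toList Ω′))) ⟩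
        ℤ.+ List⁺.length Ω / 1 * (ℤ.+ List⁺.length Ω′ / 1)
          ≡⟨ sym (ι-* (List⁺.length Ω) (List⁺.length Ω′)) ⟩
        ℤ.+ (List⁺.length Ω ℕ.* List⁺.length Ω′) / 1 ∎)
        where open ≡-Reasoning

      E-⊗ : ∀ (f : A × B → ℚ) → E (Ω ⊗ Ω′) f ≡ E Ω λ a → E Ω′ λ b → f (a , b)
      E-⊗ f = begin
        1/ List⁺.length (Ω ⊗ Ω′) * total f (toList (Ω ⊗ Ω′))
          ≡⟨ cong₂ _*_ (trans (1/-cong length-⊗) (1/-* (List⁺.length Ω) (List⁺.length Ω′)))
              (total-⊗ f) ⟩
        1/ List⁺.length Ω * 1/ List⁺.length Ω′ * total (λ a → total (λ b → f (a , b)) (toList Ω′))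
            (toList Ω)
          ≡⟨ *-assoc (1/ List⁺.length Ω) (1/ List⁺.length Ω′) _ ⟩
        1/ List⁺.length Ω * (1/ List⁺.length Ω′ * total
            (λ a → total (λ b → f (a , b)) (toList Ω′)) (toList Ω))
          ≡⟨ cong (1/ List⁺.length Ω *_) (sym (total-* (1/ List⁺.length Ω′) _ (toList Ω))) ⟩
        E Ω (λ a → E Ω′ λ b → f (a , b)) ∎
        where open ≡-Reasoning

  E-⊗-* : ∀ (Ω : List⁺ A) (Ω′ : List⁺ B) (f : A → ℚ) (g : B → ℚ) →
          E (Ω ⊗ Ω′) (λ (a , b) → f a * g b) ≡ E Ω f * E Ω′ g
  E-⊗-* Ω Ω′ f g = trans (E-⊗ Ω Ω′ _)
    (trans (E-cong Ω λ a → E-*ˡ Ω′ (f a) g) (E-*ʳ Ω (E Ω′ g) f))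

  E-⨂ : ∀ {p} (Ω : Fin (suc p) → List⁺ A) (f : Vector A (suc p) → ℚ) →
        E (⨂ Ω) f ≡ E (Ω zero) λ a → E (⨂ (Ω ∘ suc)) λ v → f (a Vector.∷ v)
  E-⨂ Ω f = trans (E-map (Ω zero ⊗ ⨂ (Ω ∘ suc)) _ f) (E-⊗ (Ω zero) (⨂ (Ω ∘ suc)) _)

  E-⨂-∏ : ∀ {p} (Ω : Fin p → List⁺ A) (f : Fin p → A → ℚ) →
          E (⨂ Ω) (λ v → ∏ λ j → f j (v j)) ≡ ∏ λ j → E (Ω j) (f j)
  E-⨂-∏ {p = zero} Ω f = trans (E-cong (⨂ Ω) λ v → ∏-[] _) (trans (E-const (⨂ Ω) 1ℚ) (sym (∏-[] _)))
  E-⨂-∏ {p = suc p} Ω f = begin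
    E (⨂ Ω) (λ v → ∏ λ j → f j (v j))
      ≡⟨ trans (E-⨂ Ω _) (E-cong (Ω zero) λ a → E-cong (⨂ (Ω ∘ suc)) λ v → ∏-suc _) ⟩
    E (Ω zero) (λ a → E (⨂ (Ω ∘ suc)) λ v → f zero a * ∏ λ j → f (suc j) (v j))
      ≡⟨ E-cong (Ω zero) (λ a → E-*ˡ (⨂ (Ω ∘ suc)) (f zero a) _) ⟩
    E (Ω zero) (λ a → f zero a * E (⨂ (Ω ∘ suc)) λ v → ∏ λ j → f (suc j) (v j))
      ≡⟨ E-*ʳ (Ω zero) _ (f zero) ⟩
    E (Ω zero) (f zero) * E (⨂ (Ω ∘ suc)) (λ v → ∏ λ j → f (suc j) (v j))
      ≡⟨ cong (E (Ω zero) (f zero) *_) (E-⨂-∏ (Ω ∘ suc) (f ∘ suc)) ⟩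
    E (Ω zero) (f zero) * ∏ (λ j → E (Ω (suc j)) (f (suc j)))
      ≡⟨ sym (∏-suc _) ⟩
    ∏ (λ j → E (Ω j) (f j)) ∎
    where open ≡-Reasoning

  -- k-wise independence

  𝟙-× : (P? : Dec P) (Q? : Dec Q) (S? : Dec S) → (P → Q × S) → (Q × S → P) →
        𝟙 P? ≡ 𝟙 Q? * 𝟙 S?
  𝟙-× P? (yes q) S? to from =
    trans (𝟙-cong P? S? (proj₂ ∘ to) (λ s → from (q , s))) (sym (*-identityˡ (𝟙 S?)))
  𝟙-× P? (no ¬q) S? to from =
    trans (𝟙-no P? (¬q ∘ proj₁ ∘ to)) (sym (*-zeroˡ (𝟙 S?)))

  ∣[]≔inside∣ : ∀ {d} (I : Subset d) i → i ∉ I → Subset.∣ I [ i ]≔ inside ∣ ≡ suc Subset.∣ I ∣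
  ∣[]≔inside∣ (inside Vec.∷ I) zero i∉I = ⊥-elim (i∉I here)
  ∣[]≔inside∣ (outside Vec.∷ I) zero i∉I = refl
  ∣[]≔inside∣ (inside Vec.∷ I) (suc i) i∉I = cong suc (∣[]≔inside∣ I i (i∉I ∘ there))
  ∣[]≔inside∣ (outside Vec.∷ I) (suc i) i∉I = ∣[]≔inside∣ I i (i∉I ∘ there)

  ∈-[]≔inside⁻ : ∀ {d} (I : Subset d) {i j} → j ≢ i → j ∈ I [ i ]≔ inside → j ∈ I
  ∈-[]≔inside⁻ I {i} {j} j≢i j∈ = Vec.lookup⇒[]= j I
    (trans (sym (Vec.lookup∘update′ j≢i I inside)) (Vec.[]=⇒lookup j∈))

  module _ {d r : ℕ} {R : Set} (e : R ↔ Fin r) where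
    open Inverse e using (to; from; strictlyInverseˡ; strictlyInverseʳ)

    _≟ᴿ_ : (a b : R) → Dec (a ≡ b)
    _≟ᴿ_ = Fin.inj⇒≟ (↔⇒↣ e)

    -- A cylinder with one more prescribed point is the old cylinder cut by the event f i ≡ a.
    -- Overwriting `g` at `i` leaves it unchanged on `I` because i ∉ I.
    𝟙-agreeOn-[]≔inside : ∀ {I i} → i ∉ I → ∀ (g f : Fin d → R) a →
      𝟙 (agreeOn? e (I [ i ]≔ inside) (Vector.updateAt g i (λ _ → a)) f) ≡
      𝟙 (f i ≟ᴿ a) * 𝟙 (agreeOn? e I g f)
    𝟙-agreeOn-[]≔inside {I} {i} i∉I g f a = 𝟙-×
      (agreeOn? e (I [ i ]≔ inside) g′ f) (f i ≟ᴿ a) (agreeOn? e I g f) restrict extend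
      where
      g′ : Fin d → R
      g′ = Vector.updateAt g i (λ _ → a)

      restrict : AgreeOn (I [ i ]≔ inside) f g′ → f i ≡ a × AgreeOn I f g
      restrict f≡g′ =
        trans (f≡g′ i (Vec.[]≔-updates I i)) (Vector.updateAt-updates i g) , λ j j∈I →
          let j≢i = λ { refl → i∉I j∈I }
          in trans (f≡g′ j (Vec.[]≔-minimal I j i j≢i j∈I)) (Vector.updateAt-minimal j i g j≢i)

      extend : f i ≡ a × AgreeOn I f g → AgreeOn (I [ i ]≔ inside) f g′
      extend (fi≡a , f≡g) j j∈ with j Fin.≟ i
      ... | yes refl = trans fi≡a (sym (Vector.updateAt-updates i g))
      ... | no j≢i = trans (f≡g j (∈-[]≔inside⁻ I j≢i j∈)) (sym (Vector.updateAt-minimal j i g j≢i))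

    -- Expands a function of one hash value in point indicators, since k-wise independence speaks
    -- only about the probabilities of prescribed values.
    ∑-𝟙≟ : ∀ (x : R) (φ : R → ℚ) → ∑ (λ t → 𝟙 (x ≟ᴿ from t) * φ (from t)) ≡ φ x
    ∑-𝟙≟ x φ = begin
      ∑ (λ t → 𝟙 (x ≟ᴿ from t) * φ (from t))
        ≡⟨ ∑-cong (λ t → cong (_* φ (from t)) (𝟙-cong (x ≟ᴿ from t) (to x Fin.≟ t)
             (λ eq → trans (cong to eq) (strictlyInverseˡ t))
             (λ eq → trans (sym (strictlyInverseʳ x)) (cong from eq)))) ⟩
      ∑ (λ t → δ (to x) t * φ (from t))
        ≡⟨ ∑-δ (to x) (φ ∘ from) ⟩
      φ (from (to x))
        ≡⟨ cong φ (strictlyInverseʳ x) ⟩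
      φ x ∎
      where open ≡-Reasoning

    -- A product of functions that each read the hash function at one point. The list form lets the
    -- induction below move one factor at a time into the cylinder.
    Observables : Set
    Observables = List (Fin d × (R → ℚ))

    evaluate : Observables → (Fin d → R) → ℚ
    evaluate qs f = List.foldr (λ (i , φ) → φ (f i) *_) 1ℚ qs

    module _ .{{_ : NonZero r}} where
      private
        1/r^_ : ℕ → ℚ
        1/r^ n = (1/ (r ℕ.^ n)) {{ℕ.m^n≢0 r n}}

      -- The expectation that the product would have if all values were independent and uniform on
      -- `R`.
      averages : Observables → ℚ
      averages qs = List.foldr (λ (i , φ) → 1/ r * ∑ (φ ∘ from) *_) 1ℚ qs

      module _ {k : ℕ} (H : List⁺ (Fin d → R)) (indep : KWiseIndependent k e H) where

        -- Summing over the values at a new point i refines the cylinder of all f that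
        -- agree with g on I to cylinders over I ∪ {i}.
        E-evaluate-on-cylinder : ∀ qs I g →
          AllPairs (λ p q → proj₁ p ≢ proj₁ q) qs → All (λ q → proj₁ q ∉ I) qs →
          List.length qs ℕ.+ Subset.∣ I ∣ ℕ.≤ k →
          E H (λ f → 𝟙 (agreeOn? e I g f) * evaluate qs f) ≡
          1/r^ Subset.∣ I ∣ * averages qs
        E-evaluate-on-cylinder [] I g [] [] ∣I∣≤k = begin
          E H (λ f → 𝟙 (agreeOn? e I g f) * 1ℚ)
            ≡⟨ E-*ʳ H 1ℚ _ ⟩
          E H (λ f → 𝟙 (agreeOn? e I g f)) * 1ℚ
            ≡⟨ cong (_* 1ℚ) (trans (sym (ℙ≡E H (agreeOn? e I g)))
                (trans (indep I ∣I∣≤k g) (sym (1/-def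
                (r ℕ.^ Subset.∣ I ∣) {{ℕ.m^n≢0 r Subset.∣ I ∣}})))) ⟩
          1/r^ Subset.∣ I ∣ * 1ℚ ∎
          where open ≡-Reasoning
        E-evaluate-on-cylinder ((i , φ) ∷ qs) I g (i∉qs ∷ qs-distinct)
            (i∉I ∷ qs∉I) ∣qs∣+∣I∣≤k = begin
          E H (λ f → 𝟙 (agreeOn? e I g f) * (φ (f i) * evaluate qs f))
            ≡⟨ E-cong H expand ⟩
          E H (λ f → ∑ λ t → φ (from t) * (𝟙 (agreeOn? e I′ (g′ t) f) * evaluate qs f))
            ≡⟨ E-∑ H _ ⟩
          ∑ (λ t → E H (λ f → φ (from t) * (𝟙 (agreeOn? e I′ (g′ t) f) * evaluate qs f)))
            ≡⟨ ∑-cong (λ t → trans (E-*ˡ H (φ (from t)) _) (cong (φ (from t) *_)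
                 (E-evaluate-on-cylinder qs I′ (g′ t) qs-distinct qs∉I′ ∣qs∣+∣I′∣≤k))) ⟩
          ∑ (λ t → φ (from t) * (1/r^ Subset.∣ I′ ∣ * averages qs))
            ≡⟨ sym (*-distribʳ-∑ _ (φ ∘ from)) ⟩
          ∑ (φ ∘ from) * (1/r^ Subset.∣ I′ ∣ * averages qs)
            ≡⟨ cong (λ z → ∑ (φ ∘ from) * (z * averages qs)) 1/r^∣I′∣ ⟩
          ∑ (φ ∘ from) * (1/ r * 1/r^ Subset.∣ I ∣ * averages qs)
            ≡⟨ solve 4 (λ s a b m → s :* (a :* b :* m) := b :* (a :* s :* m)) refl
                 (∑ (φ ∘ from)) (1/ r) (1/r^ Subset.∣ I ∣) (averages qs) ⟩
          1/r^ Subset.∣ I ∣ * (1/ r * ∑ (φ ∘ from) * averages qs) ∎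
          where
          open ≡-Reasoning
          open +-*-Solver

          I′ : Subset d
          I′ = I [ i ]≔ inside

          g′ : Fin r → Fin d → R
          g′ t = Vector.updateAt g i (λ _ → from t)

          qs∉I′ : All (λ q → proj₁ q ∉ I′) qs
          qs∉I′ = All.zipWith (λ (i≢j , j∉I) → j∉I ∘ ∈-[]≔inside⁻ I (i≢j ∘ sym)) (i∉qs , qs∉I)

          ∣qs∣+∣I′∣≤k : List.length qs ℕ.+ Subset.∣ I′ ∣ ℕ.≤ k
          ∣qs∣+∣I′∣≤k = subst (ℕ._≤ k)
            (trans (sym (ℕ.+-suc (List.length qs) Subset.∣ I ∣))
                   (cong (List.length qs ℕ.+_) (sym (∣[]≔inside∣ I i i∉I))))
            ∣qs∣+∣I∣≤k

          1/r^∣I′∣ : 1/r^ Subset.∣ I′ ∣ ≡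
                     1/ r * 1/r^ Subset.∣ I ∣
          1/r^∣I′∣ = trans
            (1/-cong {{ℕ.m^n≢0 r Subset.∣ I′ ∣}} {{ℕ.m^n≢0 r (suc Subset.∣ I ∣)}}
                (cong (r ℕ.^_) (∣[]≔inside∣ I i i∉I)))
            (1/-* r (r ℕ.^ Subset.∣ I ∣) {{_}} {{ℕ.m^n≢0 r Subset.∣ I ∣}} {{ℕ.m^n≢0 r
                (suc Subset.∣ I ∣)}})

          expand : ∀ f → 𝟙 (agreeOn? e I g f) * (φ (f i) * evaluate qs f) ≡
                         ∑ λ t → φ (from t) * (𝟙 (agreeOn? e I′ (g′ t) f) * evaluate qs f)
          expand f = begin
            𝟙 (agreeOn? e I g f) * (φ (f i) * evaluate qs f)
              ≡⟨ solve 3 (λ a b c → a :* (b :* c) := b :* (a :* c)) refl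
                   (𝟙 (agreeOn? e I g f)) (φ (f i)) (evaluate qs f) ⟩
            φ (f i) * (𝟙 (agreeOn? e I g f) * evaluate qs f)
              ≡⟨ cong (_* (𝟙 (agreeOn? e I g f) * evaluate qs f)) (sym (∑-𝟙≟ (f i) φ)) ⟩
            ∑ (λ t → 𝟙 (f i ≟ᴿ from t) * φ (from t)) * (𝟙 (agreeOn? e I g f) * evaluate qs f)
              ≡⟨ *-distribʳ-∑ _ (λ t → 𝟙 (f i ≟ᴿ from t) * φ (from t)) ⟩
            ∑ (λ t → 𝟙 (f i ≟ᴿ from t) * φ (from t) * (𝟙 (agreeOn? e I g f) * evaluate qs f))
              ≡⟨ ∑-cong (λ t → trans
                   (solve 4 (λ x p a v → x :* p :* (a :* v) := p :* (x :* a :* v)) refl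
                     (𝟙 (f i ≟ᴿ from t)) (φ (from t)) (𝟙 (agreeOn? e I g f)) (evaluate qs f))
                   (cong (λ z → φ (from t) * (z * evaluate qs f))
                     (sym (𝟙-agreeOn-[]≔inside i∉I g f (from t))))) ⟩
            ∑ (λ t → φ (from t) * (𝟙 (agreeOn? e I′ (g′ t) f) * evaluate qs f)) ∎

        -- The cylinder over the empty set is the whole family and has probability 1/r⁰ = 1. This is
        -- the form in which k-wise independence is used from here on.
        E-evaluate : ∀ qs → AllPairs (λ p q → proj₁ p ≢ proj₁ q) qs → List.length qs ℕ.≤ k →
                     E H (evaluate qs) ≡ averages qs
        E-evaluate qs qs-distinct ∣qs∣≤k = begin
          E H (evaluate qs)
            ≡⟨ E-cong H (λ f → sym (trans
                 (cong (_* evaluate qs f) (𝟙-yes (agreeOn? e ⊥ g f)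
                     (λ i i∈⊥ → ⊥-elim (Subset.∉⊥ i∈⊥))))
                 (*-identityˡ (evaluate qs f)))) ⟩
          E H (λ f → 𝟙 (agreeOn? e ⊥ g f) * evaluate qs f)
            ≡⟨ E-evaluate-on-cylinder qs ⊥ g qs-distinct (All.universal (λ _ → Subset.∉⊥) qs)
                 (subst (ℕ._≤ k) (sym (trans (cong (List.length qs ℕ.+_) (Subset.∣⊥∣≡0 d))
                                             (ℕ.+-identityʳ _))) ∣qs∣≤k) ⟩
          1/r^ Subset.∣ ⊥ {d} ∣ * averages qs
            ≡⟨ cong (_* averages qs) (trans
                (1/-cong {{ℕ.m^n≢0 r Subset.∣ ⊥ {d} ∣}} (cong (r ℕ.^_) (Subset.∣⊥∣≡0 d))) 1/1≡1) ⟩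
          1ℚ * averages qs
            ≡⟨ *-identityˡ (averages qs) ⟩
          averages qs ∎
          where
          open ≡-Reasoning
          -- Any function serves, as agreement on the empty set is vacuous; the non-empty list
          -- supplies one.
          g : Fin d → R
          g = List⁺.head H

  -- Moments of signs and collisions of hashes

  σ : Sign → ℚ
  σ Sign.+ = 1ℚ
  σ Sign.- = - 1ℚ

  σ*σ : ∀ s → σ s * σ s ≡ 1ℚ
  σ*σ Sign.+ = refl
  σ*σ Sign.- = refl

  opaque
    unfolding ∑
    ∑-σ : 1/ 2 * ∑ (σ ∘ Inverse.from Sign↔Fin2) ≡ 0ℚ
    ∑-σ = *-zeroʳ (1/ 2)

  -- The value of E[s(a) s(b) s(c) s(e)] for 4-wise independent signs s.
  paired : ∀ {d} → Fin d → Fin d → Fin d → Fin d → ℚ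
  paired a b c e =
    if does (a Fin.≟ b) then δ c e else
    if does (a Fin.≟ c) then δ b e else
    if does (a Fin.≟ e) then δ b c else 0ℚ

  module _ {d : ℕ} (𝓢 : List⁺ (Fin d → Sign)) (indep : KWiseIndependent 4 Sign↔Fin2 𝓢) where
    open +-*-Solver

    -- At equal points the square of a sign is 1; at distinct points `E-evaluate` produces the mean
    -- of a single sign as a factor, and `∑-σ` makes it 0.
    E-σσ : ∀ a b → E 𝓢 (λ s → σ (s a) * σ (s b)) ≡ δ a b
    E-σσ a b = by-cases (a Fin.≟ b)
      where
      m : ℚ
      m = averages {d} Sign↔Fin2 ((b , σ) ∷ [])

      by-cases : (a≟b : Dec (a ≡ b)) → E 𝓢 (λ s → σ (s a) * σ (s b)) ≡ 𝟙 a≟b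
      by-cases (yes refl) = trans (E-cong 𝓢 λ s → σ*σ (s a)) (E-const 𝓢 1ℚ)
      by-cases (no a≢b) = trans (E-cong 𝓢 λ s → cong (σ (s a) *_) (sym (*-identityʳ (σ (s b)))))
        (trans (E-evaluate Sign↔Fin2 𝓢 indep ((a , σ) ∷ (b , σ) ∷ [])
                  ((a≢b ∷ []) ∷ [] ∷ []) (ℕ.s≤s (ℕ.s≤s ℕ.z≤n)))
               (trans (cong (_* m) ∑-σ) (*-zeroˡ m)))

    private
      -- When two of the four points coincide, their common sign `z` squares to 1, and the second
      -- moment at the remaining points `x` and `y` is left.
      pair : ∀ {a b c e x y} → (∀ (s : Fin d → Sign) → ∃[ z ] σ (s a) * σ (s b) *
          (σ (s c) * σ (s e)) ≡ σ z * σ z * (σ (s x) * σ (s y))) →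
        E 𝓢 (λ s → σ (s a) * σ (s b) * (σ (s c) * σ (s e))) ≡ δ x y
      pair {x = x} {y} eq = trans
        (E-cong 𝓢 λ s → let z , p = eq s in
          trans p (trans (cong (_* (σ (s x) * σ (s y))) (σ*σ z)) (*-identityˡ (σ (s x) * σ (s y)))))
        (E-σσ x y)

      ac,be : ∀ a b e → a * b * (a * e) ≡ a * a * (b * e)
      ac,be = solve 3 (λ a b e → a :* b :* (a :* e) := a :* a :* (b :* e)) refl

      ae,bc : ∀ a b c → a * b * (c * a) ≡ a * a * (b * c)
      ae,bc = solve 3 (λ a b c → a :* b :* (c :* a) := a :* a :* (b :* c)) refl

      bc,ae : ∀ a b e → a * b * (b * e) ≡ b * b * (a * e)
      bc,ae = solve 3 (λ a b e → a :* b :* (b :* e) := b :* b :* (a :* e)) refl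

      be,ac : ∀ a b c → a * b * (c * b) ≡ b * b * (a * c)
      be,ac = solve 3 (λ a b c → a :* b :* (c :* b) := b :* b :* (a :* c)) refl

    E-σσσσ : ∀ a b c e → E 𝓢 (λ s → σ (s a) * σ (s b) * (σ (s c) * σ (s e))) ≡ paired a b c e
    E-σσσσ a b c e = by-cases (a Fin.≟ b) (a Fin.≟ c) (a Fin.≟ e) (b Fin.≟ c) (b Fin.≟ e)
        (c Fin.≟ e)
      where
      m : ℚ
      m = averages {d} Sign↔Fin2 ((b , σ) ∷ (c , σ) ∷ (e , σ) ∷ [])

      by-cases : (a≟b : Dec (a ≡ b)) (a≟c : Dec (a ≡ c)) (a≟e : Dec (a ≡ e)) →
        Dec (b ≡ c) → Dec (b ≡ e) → Dec (c ≡ e) →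
        E 𝓢 (λ s → σ (s a) * σ (s b) * (σ (s c) * σ (s e))) ≡
        (if does a≟b then δ c e else if does a≟c then δ b e else if does a≟e then δ b c else 0ℚ)
      by-cases (yes refl) _ _ _ _ _ = pair λ s → s a , refl
      by-cases (no _) (yes refl) _ _ _ _ = pair λ s → s a , ac,be (σ (s a)) (σ (s b)) (σ (s e))
      by-cases (no _) (no _) (yes refl) _ _ _ = pair λ s → s a , ae,bc (σ (s a)) (σ (s b)) (σ (s c))
      -- From here on `a` differs from all other points, so `paired` is 0. If two of the others
      -- coincide, `pair` leaves the `δ` of `a` and a point already known to differ from it.
      by-cases (no _) (no _) (no a≢e) (yes refl) _ _ =
        trans (pair λ s → s b , bc,ae (σ (s a)) (σ (s b)) (σ (s e))) (𝟙-no (a Fin.≟ e) a≢e)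
      by-cases (no _) (no a≢c) (no _) (no _) (yes refl) _ =
        trans (pair λ s → s b , be,ac (σ (s a)) (σ (s b)) (σ (s c))) (𝟙-no (a Fin.≟ c) a≢c)
      by-cases (no a≢b) (no _) (no _) (no _) (no _) (yes refl) =
        trans (pair λ s → s c , *-comm (σ (s a) * σ (s b)) (σ (s c) * σ (s c)))
            (𝟙-no (a Fin.≟ b) a≢b)
      -- Four distinct points: the only place that uses the full strength of 4-wise independence.
      by-cases (no a≢b) (no a≢c) (no a≢e) (no b≢c) (no b≢e) (no c≢e) = trans
        (E-cong 𝓢 λ s → solve 4 (λ a b c e → a :* b :* (c :* e) := a :*
            (b :* (c :* (e :* con 1ℚ)))) refl
                          (σ (s a)) (σ (s b)) (σ (s c)) (σ (s e)))
        (trans (E-evaluate Sign↔Fin2 𝓢 indep ((a , σ) ∷ (b , σ) ∷ (c , σ) ∷ (e , σ) ∷ [])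
                  ((a≢b ∷ a≢c ∷ a≢e ∷ []) ∷ (b≢c ∷ b≢e ∷ []) ∷ (c≢e ∷ []) ∷ [] ∷ []) ℕ.≤-refl)
               (trans (cong (_* m) ∑-σ) (*-zeroˡ m)))

  -- Collision probability of the composite hash

  %-cancelˡ : ∀ D .{{_ : NonZero D}} x {m n} → m ℕ.≤ n → n ℕ.< D → (m ℕ.+ x) % D ≡
      (n ℕ.+ x) % D → m ≡ n
  %-cancelˡ D x {m} {n} m≤n n<D eq with n ℕ.∸ m in n∸m≡k
  ... | zero = ℕ.≤-antisym m≤n (ℕ.m∸n≡0⇒m≤n n∸m≡k)
  -- Equal residues make `D` divide the difference, but a positive difference below `D` is not a
  -- multiple of it.
  ... | suc k = ⊥-elim (ℕ.<⇒≱ n<D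
      (ℕ.≤-trans (ℕ.∣⇒≤ D∣1+k) (ℕ.≤-trans (ℕ.≤-reflexive (sym n∸m≡k)) (ℕ.m∸n≤m n m))))
    where
    open ≡-Reasoning
    q q′ : ℕ
    q = (m ℕ.+ x) ℕ./ D
    q′ = (n ℕ.+ x) ℕ./ D

    qD+1+k≡q′D : q ℕ.* D ℕ.+ suc k ≡ q′ ℕ.* D
    qD+1+k≡q′D = ℕ.+-cancelˡ-≡ ((m ℕ.+ x) % D) _ _ (begin
      (m ℕ.+ x) % D ℕ.+ (q ℕ.* D ℕ.+ suc k)  ≡⟨ sym (ℕ.+-assoc ((m ℕ.+ x) % D) (q ℕ.* D) (suc k)) ⟩
      (m ℕ.+ x) % D ℕ.+ q ℕ.* D ℕ.+ suc k    ≡⟨ cong₂ ℕ._+_ (sym (ℕ.m≡m%n+[m/n]*n (m ℕ.+ x) D))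
          (sym n∸m≡k) ⟩
      m ℕ.+ x ℕ.+ (n ℕ.∸ m)                  ≡⟨ cong (ℕ._+ (n ℕ.∸ m)) (ℕ.+-comm m x) ⟩
      x ℕ.+ m ℕ.+ (n ℕ.∸ m)                  ≡⟨ ℕ.+-assoc x m (n ℕ.∸ m) ⟩
      x ℕ.+ (m ℕ.+ (n ℕ.∸ m))                ≡⟨ cong (x ℕ.+_) (ℕ.m+[n∸m]≡n m≤n) ⟩
      x ℕ.+ n                                ≡⟨ ℕ.+-comm x n ⟩
      n ℕ.+ x                                ≡⟨ ℕ.m≡m%n+[m/n]*n (n ℕ.+ x) D ⟩
      (n ℕ.+ x) % D ℕ.+ q′ ℕ.* D             ≡⟨ cong (ℕ._+ q′ ℕ.* D) (sym eq) ⟩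
      (m ℕ.+ x) % D ℕ.+ q′ ℕ.* D             ∎)

    D∣1+k : D ℕ.∣ suc k
    D∣1+k = ℕ.∣m+n∣m⇒∣n (ℕ.divides q′ qD+1+k≡q′D) (ℕ.divides q refl)

  mod-injective : ∀ D .{{_ : NonZero D}} x {a b : Fin D} →
                  (toℕ a ℕ.+ x) mod D ≡ (toℕ b ℕ.+ x) mod D → a ≡ b
  mod-injective D x {a} {b} eq with ℕ.≤-total (toℕ a) (toℕ b)
  ... | inj₁ a≤b = Fin.toℕ-injective (%-cancelˡ D x a≤b (Fin.toℕ<n b)
    (trans (sym (Fin.toℕ-fromℕ< _)) (trans (cong toℕ eq) (Fin.toℕ-fromℕ< _))))
  ... | inj₂ b≤a = sym (Fin.toℕ-injective (%-cancelˡ D x b≤a (Fin.toℕ<n a)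
    (trans (sym (Fin.toℕ-fromℕ< _)) (trans (cong toℕ (sym eq)) (Fin.toℕ-fromℕ< _)))))

  ∑-𝟙-injective : ∀ {m n} (f : Fin m → Fin n) → (∀ {a b} → f a ≡ f b → a ≡ b) → ∀ t →
                  ∑ (λ a → 𝟙 (f a Fin.≟ t)) ≤ 1ℚ
  ∑-𝟙-injective {zero} f f-inj t = ≤-trans (≤-reflexive (∑-[] _)) (0≤1)
  ∑-𝟙-injective {suc m} f f-inj t with f zero Fin.≟ t in eq
  ... | yes f0≡t = ≤-reflexive (trans (∑-suc _) (trans (cong₂ _+_
    (𝟙-yes (f zero Fin.≟ t) f0≡t)
    (∑-zero λ a → 𝟙-no (f (suc a) Fin.≟ t) λ fa≡t → Fin.0≢1+n (f-inj (trans f0≡t (sym fa≡t)))))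
    (+-identityʳ 1ℚ)))
  ... | no f0≢t = subst (_≤ 1ℚ)
    (sym (trans (∑-suc _) (trans (cong (_+ ∑ (λ a → 𝟙 (f (suc a) Fin.≟ t)))
        (𝟙-no (f zero Fin.≟ t) f0≢t)) (+-identityˡ _))))
    (∑-𝟙-injective (f ∘ suc) (Fin.suc-injective ∘ f-inj) t)

  -- The number c collects the values of the hash functions conditioned on so far.
  offset : ∀ {d D p} → ℕ → Vector (Fin d → Fin D) p → (Fin p → Fin d) → ℕ
  offset c h u = c ℕ.+ Vector.foldr ℕ._+_ 0 (λ j → toℕ (h j (u j)))

  module _ {d D : ℕ} .{{_ : NonZero D}} where
    -- `F` is expanded in the indicators of the pairs (α, β); at two distinct points each of them
    -- has expectation 1/D². In other words, the pair of hash values is uniform.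
    E-collision₂ : ∀ (H : List⁺ (Fin d → Fin D)) → KWiseIndependent 2 (↔-id (Fin D)) H →
      ∀ {a b} → a ≢ b → ∀ (F : Fin D → Fin D → ℚ) →
      E H (λ h → F (h a) (h b)) ≡ 1/ D * (1/ D * ∑ λ α → ∑ λ β → F α β)
    E-collision₂ H indep {a} {b} a≢b F = begin
      E H (λ h → F (h a) (h b))
        ≡⟨ E-cong H (λ h → sym (trans (∑-δ (h a) _) (∑-δ (h b) _))) ⟩
      E H (λ h → ∑ λ α → δ (h a) α * ∑ λ β → δ (h b) β * F α β)
        ≡⟨ E-cong H (λ h → ∑-cong λ α → trans (*-distribˡ-∑ (δ (h a) α) _) (∑-cong λ β →
             solve 3 (λ x y f → x :* (y :* f) := f :* (x :* (y :* con 1ℚ))) refl (δ (h a) α)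
                 (δ (h b) β) (F α β))) ⟩
      E H (λ h → ∑ λ α → ∑ λ β → F α β * evaluate (↔-id (Fin D)) (qs α β) h)
        ≡⟨ trans (E-∑ H _) (∑-cong λ α → trans (E-∑ H _) (∑-cong λ β → E-*ˡ H (F α β) _)) ⟩
      ∑ (λ α → ∑ λ β → F α β * E H (evaluate (↔-id (Fin D)) (qs α β)))
        ≡⟨ ∑-cong (λ α → ∑-cong λ β → cong (F α β *_) (trans
             (E-evaluate (↔-id (Fin D)) H indep (qs α β) ((a≢b ∷ []) ∷ [] ∷ []) ℕ.≤-refl)
             (cong₂ _*_ (average α) (cong (_* 1ℚ) (average β))))) ⟩
      ∑ (λ α → ∑ λ β → F α β * (1/ D * (1/ D * 1ℚ)))
        ≡⟨ ∑-cong (λ α → sym (*-distribʳ-∑ _ _)) ⟩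
      ∑ (λ α → ∑ (λ β → F α β) * (1/ D * (1/ D * 1ℚ)))
        ≡⟨ sym (*-distribʳ-∑ _ _) ⟩
      ∑ (λ α → ∑ λ β → F α β) * (1/ D * (1/ D * 1ℚ))
        ≡⟨ solve 2 (λ s x → s :* (x :* (x :* con 1ℚ)) := x :* (x :* s)) refl
            (∑ λ α → ∑ λ β → F α β) (1/ D) ⟩
      1/ D * (1/ D * ∑ (λ α → ∑ λ β → F α β)) ∎
      where
      open ≡-Reasoning
      open +-*-Solver
      qs : Fin D → Fin D → List (Fin d × (Fin D → ℚ))
      qs α β = (a , λ t → δ t α) ∷ (b , λ t → δ t β) ∷ []

      average : ∀ α → 1/ D * ∑ (λ t → δ t α) ≡ 1/ D
      average α = trans (cong (1/ D *_) (trans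
        (∑-cong λ t → trans (δ-sym t α) (sym (*-identityʳ (δ α t)))) (∑-δ α (λ _ → 1ℚ))))
            (*-identityʳ (1/ D))

    -- Given the other hash functions, h j (u j) and h j (v j) are independent and
    -- uniform, and for each value of the latter at most one of the former collides.
    E-collision : ∀ {p} (𝓗 : Fin p → List⁺ (Fin d → Fin D)) →
      (∀ j → KWiseIndependent 2 (↔-id (Fin D)) (𝓗 j)) →
      ∀ {u v : Fin p → Fin d} {j} → u j ≢ v j → ∀ c c′ →
      E (⨂ 𝓗) (λ h → 𝟙 (offset c h u mod D Fin.≟ offset c′ h v mod D)) ≤ 1/ D
    E-collision {suc p} 𝓗 indep {u} {v} {zero} u0≢v0 c c′ = begin
      E (⨂ 𝓗) (λ h → 𝟙 (offset c h u mod D Fin.≟ offset c′ h v mod D))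
        ≡⟨ E-⨂ 𝓗 _ ⟩
      E (𝓗 zero) (λ g → F (g (u zero)) (g (v zero)))
        ≡⟨ E-collision₂ (𝓗 zero) (indep zero) u0≢v0 F ⟩
      1/ D * (1/ D * ∑ λ α → ∑ λ β → F α β)
        ≤⟨ *-monoˡ-≤ (0≤1/n D) (*-monoˡ-≤ (0≤1/n D) ∑∑F≤D) ⟩
      1/ D * (1/ D * (ℤ.+ D / 1))
        ≡⟨ trans (cong (1/ D *_) (1/n*n D)) (*-identityʳ (1/ D)) ⟩
      1/ D ∎
      where
      open ≤-Reasoning
      hash : ℕ → Fin D → Vector (Fin d → Fin D) p → (Fin p → Fin d) → Fin D
      hash c α h u = (c ℕ.+ (toℕ α ℕ.+ Vector.foldr ℕ._+_ 0 (λ j → toℕ (h j (u j))))) mod D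

      F : Fin D → Fin D → ℚ
      F α β = E (⨂ (𝓗 ∘ suc)) λ h → 𝟙 (hash c α h (u ∘ suc) Fin.≟ hash c′ β h (v ∘ suc))

      hash-injective : ∀ c h u {α β} → hash c α h u ≡ hash c β h u → α ≡ β
      hash-injective c h u {α} {β} eq = mod-injective D (c ℕ.+ r)
        (trans (cong (_mod D) (move α)) (trans eq (cong (_mod D) (sym (move β)))))
        where
        r : ℕ
        r = Vector.foldr ℕ._+_ 0 (λ j → toℕ (h j (u j)))
        move : ∀ (α : Fin D) → toℕ α ℕ.+ (c ℕ.+ r) ≡ c ℕ.+ (toℕ α ℕ.+ r)
        move α = trans (sym (ℕ.+-assoc (toℕ α) c r))
            (trans (cong (ℕ._+ r) (ℕ.+-comm (toℕ α) c)) (ℕ.+-assoc c (toℕ α) r))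

      ∑∑F≤D : ∑ (λ α → ∑ λ β → F α β) ≤ ℤ.+ D / 1
      ∑∑F≤D = begin
        ∑ (λ α → ∑ λ β → F α β)
          ≡⟨ ∑-comm F ⟩
        ∑ (λ β → ∑ λ α → F α β)
          ≡⟨ ∑-cong (λ β → sym (E-∑ (⨂ (𝓗 ∘ suc)) _)) ⟩
        ∑ (λ β → E (⨂ (𝓗 ∘ suc)) λ h → ∑ λ α → 𝟙 (hash c α h (u ∘ suc) Fin.≟ hash c′ β h (v ∘ suc)))
          ≤⟨ ∑-mono (λ β → ≤-trans
               (E-mono (⨂ (𝓗 ∘ suc)) λ h → ∑-𝟙-injective (λ α → hash c α h (u ∘ suc))
                   (hash-injective c h (u ∘ suc)) _)
               (≤-reflexive (E-const (⨂ (𝓗 ∘ suc)) 1ℚ))) ⟩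
        ∑ {D} (λ β → 1ℚ)
          ≡⟨ trans (∑-const D 1ℚ) (*-identityʳ _) ⟩
        ℤ.+ D / 1 ∎
    -- The differing coordinate lies further on. The first hash function is fixed, and its values at
    -- `u zero` and `v zero` move into the counters; as these values may differ, two counters are
    -- kept.
    E-collision {suc p} 𝓗 indep {u} {v} {suc j} uj≢vj c c′ = begin
      E (⨂ 𝓗) (λ h → 𝟙 (offset c h u mod D Fin.≟ offset c′ h v mod D))
        ≡⟨ E-⨂ 𝓗 _ ⟩
      E (𝓗 zero) (λ g → E (⨂ (𝓗 ∘ suc)) λ h → 𝟙
          (offset c (g Vector.∷ h) u mod D Fin.≟ offset c′ (g Vector.∷ h) v mod D))
        ≡⟨ E-cong (𝓗 zero) (λ g → E-cong (⨂ (𝓗 ∘ suc)) λ h → cong₂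
            (λ m n → 𝟙 (m mod D Fin.≟ n mod D))
             (sym (ℕ.+-assoc c _ _)) (sym (ℕ.+-assoc c′ _ _))) ⟩
      E (𝓗 zero) (λ g → E (⨂ (𝓗 ∘ suc)) λ h →
        𝟙 (offset (c ℕ.+ toℕ (g (u zero))) h (u ∘ suc) mod D Fin.≟ offset
            (c′ ℕ.+ toℕ (g (v zero))) h (v ∘ suc) mod D))
        ≤⟨ E-mono (𝓗 zero) (λ g → E-collision (𝓗 ∘ suc) (indep ∘ suc) uj≢vj _ _) ⟩
      E (𝓗 zero) (λ _ → 1/ D)
        ≡⟨ E-const (𝓗 zero) (1/ D) ⟩
      1/ D ∎
      where open ≤-Reasoning

  -- Sums over quadruples

  ∑⁴ : ∀ {n} → (Fin n → Fin n → Fin n → Fin n → ℚ) → ℚ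
  ∑⁴ f = ∑ λ a → ∑ λ b → ∑ λ c → ∑ λ e → f a b c e

  module _ {n : ℕ} {f g : Fin n → Fin n → Fin n → Fin n → ℚ} where
    ∑⁴-cong : (∀ a b c e → f a b c e ≡ g a b c e) → ∑⁴ f ≡ ∑⁴ g
    ∑⁴-cong f≡g = ∑-cong λ a → ∑-cong λ b → ∑-cong λ c → ∑-cong λ e → f≡g a b c e

    ∑⁴-mono : (∀ a b c e → f a b c e ≤ g a b c e) → ∑⁴ f ≤ ∑⁴ g
    ∑⁴-mono f≤g = ∑-mono λ a → ∑-mono λ b → ∑-mono λ c → ∑-mono λ e → f≤g a b c e

  module _ {n : ℕ} (f g : Fin n → Fin n → Fin n → Fin n → ℚ) where
    ∑⁴-distrib-+ : ∑⁴ (λ a b c e → f a b c e + g a b c e) ≡ ∑⁴ f + ∑⁴ g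
    ∑⁴-distrib-+ = trans
      (∑-cong λ a → trans (∑-cong λ b → trans (∑-cong λ c → ∑-distrib-+ _ _) (∑-distrib-+ _ _))
          (∑-distrib-+ _ _))
      (∑-distrib-+ _ _)

    ∑⁴-distrib-- : ∑⁴ (λ a b c e → f a b c e - g a b c e) ≡ ∑⁴ f - ∑⁴ g
    ∑⁴-distrib-- = trans
      (∑-cong λ a → trans (∑-cong λ b → trans (∑-cong λ c → ∑-distrib-- _ _) (∑-distrib-- _ _))
          (∑-distrib-- _ _))
      (∑-distrib-- _ _)

  *-distribˡ-∑⁴ : ∀ {n} q (f : Fin n → Fin n → Fin n → Fin n → ℚ) →
                  q * ∑⁴ f ≡ ∑⁴ λ a b c e → q * f a b c e
  *-distribˡ-∑⁴ q f = trans (*-distribˡ-∑ q _) (∑-cong λ a → trans (*-distribˡ-∑ q _)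
    (∑-cong λ b → trans (*-distribˡ-∑ q _) (∑-cong λ c → *-distribˡ-∑ q _)))

  ∑∑*∑∑ : ∀ {n} (f : Fin n → Fin n → ℚ) →
          ∑ (λ a → ∑ (f a)) * ∑ (λ a → ∑ (f a)) ≡ ∑⁴ λ a b c e → f a b * f c e
  ∑∑*∑∑ f = trans (*-distribʳ-∑ _ (λ a → ∑ (f a))) (∑-cong λ a →
    trans (*-distribʳ-∑ _ (f a)) (∑-cong λ b →
    trans (*-distribˡ-∑ (f a b) (λ c → ∑ (f c))) (∑-cong λ c → *-distribˡ-∑ (f a b) (f c))))

  E-∑⁴ : ∀ {A : Set} (Ω : List⁺ A) {n} (f : Fin n → Fin n → Fin n → Fin n → A → ℚ) →
         E Ω (λ ω → ∑⁴ λ a b c e → f a b c e ω) ≡ ∑⁴ λ a b c e → E Ω (f a b c e)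
  E-∑⁴ Ω f = trans (E-∑ Ω _) (∑-cong λ a → trans (E-∑ Ω _) (∑-cong λ b →
    trans (E-∑ Ω _) (∑-cong λ c → E-∑ Ω _)))

  module _ {d : ℕ} (p : ℕ) where
    ∑∑-∏ : ∀ (f : Fin d → Fin d → ℚ) →
           ∑ (λ (u : Fin (d ℕ.^ p)) → ∑ λ (v : Fin (d ℕ.^ p)) → ∏ λ j → f (finToFun u j)
               (finToFun v j)) ≡
           (∑ λ a → ∑ λ b → f a b) ^ p
    ∑∑-∏ f = trans
      (∑-cong λ u → ∑-finToFun p (λ j → f (finToFun u j)))
      (trans (∑-finToFun p (λ j a → ∑ (f a))) (∏-const p _))

    -- The innermost sum is contracted first: with the outer tuples fixed, `∑-finToFun` turns it
    -- into a product over `j` again, now with one tuple fewer.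
    ∑⁴-∏ : ∀ (f : Fin d → Fin d → Fin d → Fin d → ℚ) →
           ∑⁴ (λ (u v u′ v′ : Fin (d ℕ.^ p)) → ∏ λ j → f (finToFun u j) (finToFun v j)
               (finToFun u′ j) (finToFun v′ j)) ≡
           ∑⁴ f ^ p
    ∑⁴-∏ f = trans
      (∑-cong λ u → trans
        (∑-cong λ v → trans
          (∑-cong λ u′ → ∑-finToFun p (λ j → f (finToFun u j) (finToFun v j) (finToFun u′ j)))
          (∑-finToFun p (λ j c → ∑ (f (finToFun u j) (finToFun v j) c))))
        (∑-finToFun p (λ j b → ∑ λ c → ∑ (f (finToFun u j) b c))))
      (trans (∑-finToFun p (λ j a → ∑ λ b → ∑ λ c → ∑ (f a b c))) (∏-const p _))

  module _ {d : ℕ} (f g : Vector ℚ d) where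
    open +-*-Solver
    open ≡-Reasoning

    private
      w : Fin d → Fin d → Fin d → Fin d → ℚ
      w a b c e = f a * g b * (f c * g e)

      ⟨f,g⟩ ⟨f,f⟩ ⟨g,g⟩ : ℚ
      ⟨f,g⟩ = ∑ λ a → f a * g a
      ⟨f,f⟩ = ∑ λ a → f a * f a
      ⟨g,g⟩ = ∑ λ a → g a * g a

    -- This and the next two lemmas evaluate the three pairings of four indices. Pairing `a` with
    -- `c` and `b` with `e` matches like with like and gives squared norms; the other two match `f`
    -- with `g` and give the squared inner product.
    ∑⁴-δab*δce : ∑⁴ (λ a b c e → δ a b * δ c e * w a b c e) ≡ ⟨f,g⟩ * ⟨f,g⟩
    ∑⁴-δab*δce = begin
      ∑⁴ (λ a b c e → δ a b * δ c e * w a b c e)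
        ≡⟨ ∑⁴-cong (λ a b c e → solve 6
            (λ x y a b c e → x :* y :* (a :* b :* (c :* e)) := (x :* (a :* b)) :*
            (y :* (c :* e))) refl
             (δ a b) (δ c e) (f a) (g b) (f c) (g e)) ⟩
      ∑⁴ (λ a b c e → (δ a b * (f a * g b)) * (δ c e * (f c * g e)))
        ≡⟨ sym (∑∑*∑∑ (λ a b → δ a b * (f a * g b))) ⟩
      ∑ (λ a → ∑ (λ b → δ a b * (f a * g b))) * ∑ (λ c → ∑ (λ e → δ c e * (f c * g e)))
        ≡⟨ cong (λ z → z * z) (∑-cong λ a → ∑-δ a (λ b → f a * g b)) ⟩
      ⟨f,g⟩ * ⟨f,g⟩ ∎

    ∑⁴-δac*δbe : ∑⁴ (λ a b c e → δ a c * δ b e * w a b c e) ≡ ⟨f,f⟩ * ⟨g,g⟩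
    ∑⁴-δac*δbe = begin
      ∑⁴ (λ a b c e → δ a c * δ b e * w a b c e)
        ≡⟨ ∑-cong (λ a → ∑-cong λ b → begin
             ∑ (λ c → ∑ λ e → δ a c * δ b e * w a b c e)
               ≡⟨ ∑-cong (λ c → ∑-cong λ e → solve 6
                   (λ x y a b c e → x :* y :* (a :* b :* (c :* e)) := (x :* (a :* c)) :*
                   (y :* (b :* e))) refl
                    (δ a c) (δ b e) (f a) (g b) (f c) (g e)) ⟩
             ∑ (λ c → ∑ λ e → (δ a c * (f a * f c)) * (δ b e * (g b * g e)))
               ≡⟨ sym (∑*∑ (λ c → δ a c * (f a * f c)) (λ e → δ b e * (g b * g e))) ⟩
             ∑ (λ c → δ a c * (f a * f c)) * ∑ (λ e → δ b e * (g b * g e))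
               ≡⟨ cong₂ _*_ (∑-δ a (λ c → f a * f c)) (∑-δ b (λ e → g b * g e)) ⟩
             f a * f a * (g b * g b) ∎) ⟩
      ∑ (λ a → ∑ λ b → f a * f a * (g b * g b))
        ≡⟨ sym (∑*∑ (λ a → f a * f a) (λ b → g b * g b)) ⟩
      ⟨f,f⟩ * ⟨g,g⟩ ∎

    ∑⁴-δae*δbc : ∑⁴ (λ a b c e → δ a e * δ b c * w a b c e) ≡ ⟨f,g⟩ * ⟨f,g⟩
    ∑⁴-δae*δbc = begin
      ∑⁴ (λ a b c e → δ a e * δ b c * w a b c e)
        ≡⟨ ∑-cong (λ a → ∑-cong λ b → begin
             ∑ (λ c → ∑ λ e → δ a e * δ b c * w a b c e)
               ≡⟨ ∑-cong (λ c → ∑-cong λ e → solve 6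
                   (λ x y a b c e → x :* y :* (a :* b :* (c :* e)) := (y :* (c :* b)) :*
                   (x :* (a :* e))) refl
                    (δ a e) (δ b c) (f a) (g b) (f c) (g e)) ⟩
             ∑ (λ c → ∑ λ e → (δ b c * (f c * g b)) * (δ a e * (f a * g e)))
               ≡⟨ sym (∑*∑ (λ c → δ b c * (f c * g b)) (λ e → δ a e * (f a * g e))) ⟩
             ∑ (λ c → δ b c * (f c * g b)) * ∑ (λ e → δ a e * (f a * g e))
               ≡⟨ cong₂ _*_ (∑-δ b (λ c → f c * g b)) (∑-δ a (λ e → f a * g e)) ⟩
             f b * g b * (f a * g a)
               ≡⟨ *-comm (f b * g b) (f a * g a) ⟩
             f a * g a * (f b * g b) ∎) ⟩
      ∑ (λ a → ∑ λ b → f a * g a * (f b * g b))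
        ≡⟨ sym (∑*∑ (λ a → f a * g a) (λ b → f b * g b)) ⟩
      ⟨f,g⟩ * ⟨f,g⟩ ∎

  -- Cauchy-Schwarz and differences of powers

  p+p≤q+q⇒p≤q : ∀ {p q} → p + p ≤ q + q → p ≤ q
  p+p≤q+q⇒p≤q {p} {q} 2p≤2q with ≤-total p q
  ... | inj₁ p≤q = p≤q
  ... | inj₂ q≤p = ≮⇒≥ λ q<p → <-irrefl refl (<-≤-trans (+-mono-< q<p q<p) 2p≤2q)

  -- Lagrange's identity: twice the gap between the two sides is the double sum of the squares (f a
  -- g b - f b g a)². Doubling makes the sum symmetric in `a` and `b` and avoids restricting it to a
  -- < b.
  cauchy-schwarz : ∀ {d} (f g : Vector ℚ d) →
    ∑ (λ a → f a * g a) * ∑ (λ a → f a * g a) ≤ ∑ (λ a → f a * f a) * ∑ (λ a → g a * g a)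
  cauchy-schwarz {d} f g = p+p≤q+q⇒p≤q (begin
    ∑ (λ a → f a * g a) * ∑ (λ a → f a * g a) + ∑ (λ a → f a * g a) * ∑ (λ a → f a * g a)
      ≡⟨ double (∑*∑ (λ a → f a * g a) (λ a → f a * g a))
          (∑*∑ (λ a → f a * g a) (λ a → f a * g a)) ⟩
    ∑ (λ a → ∑ λ b → (f a * g a) * (f b * g b) + (f a * g a) * (f b * g b))
      ≤⟨ ∑-mono (λ a → ∑-mono λ b → 0≤q-p⇒p≤q (subst (0ℚ ≤_)
           (solve 4 (λ fa fb ga gb → (fa :* gb :- fb :* ga) :* (fa :* gb :- fb :* ga) :=
              ((fa :* fa) :* (gb :* gb) :+ (fb :* fb) :* (ga :* ga)) :-
                  ((fa :* ga) :* (fb :* gb) :+ (fa :* ga) :* (fb :* gb)))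
              refl (f a) (f b) (g a) (g b))
           (0≤p² (f a * g b - f b * g a)))) ⟩
    ∑ (λ a → ∑ λ b → (f a * f a) * (g b * g b) + (f b * f b) * (g a * g a))
      ≡⟨ sym (double (∑*∑ (λ a → f a * f a) (λ a → g a * g a))
           (trans (∑*∑ (λ a → f a * f a) (λ a → g a * g a))
               (∑-comm λ a b → (f a * f a) * (g b * g b)))) ⟩
    ∑ (λ a → f a * f a) * ∑ (λ a → g a * g a) + ∑ (λ a → f a * f a) * ∑ (λ a → g a * g a) ∎)
    where
    open +-*-Solver
    open ≤-Reasoning
    double : ∀ {p q} {h k : Fin d → Fin d → ℚ} → p ≡ ∑ (λ a → ∑ (h a)) → q ≡ ∑ (λ a → ∑ (k a)) →
             p + q ≡ ∑ λ a → ∑ λ b → h a b + k a b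
    double p≡ q≡ = trans (cong₂ _+_ p≡ q≡)
      (sym (trans (∑-cong λ a → ∑-distrib-+ _ _) (∑-distrib-+ _ _)))

  0≤^ : ∀ {q} → 0ℚ ≤ q → ∀ n → 0ℚ ≤ q ^ n
  0≤^ 0≤q zero = 0≤1
  0≤^ 0≤q (suc n) = 0≤* 0≤q (0≤^ 0≤q n)

  ^-mono-≤ : ∀ {p q} → 0ℚ ≤ p → p ≤ q → ∀ n → p ^ n ≤ q ^ n
  ^-mono-≤ 0≤p p≤q zero = ≤-refl
  ^-mono-≤ 0≤p p≤q (suc n) = *-mono-≤ 0≤p (0≤^ (≤-trans 0≤p p≤q) n) p≤q (^-mono-≤ 0≤p p≤q n)

  2ℚ 3ℚ : ℚ
  2ℚ = 1ℚ + 1ℚ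
  3ℚ = 1ℚ + 2ℚ

  ι-3^ : ∀ n → ℤ.+ (3 ℕ.^ n) / 1 ≡ 3ℚ ^ n
  ι-3^ zero = refl
  ι-3^ (suc n) = trans (ι-* 3 (3 ℕ.^ n)) (cong (3ℚ *_) (ι-3^ n))

  0≤3^n-1 : ∀ n → 0ℚ ≤ 3ℚ ^ n - 1ℚ
  0≤3^n-1 n = 0≤q-p (subst (_≤ 3ℚ ^ n) (1^n n) (^-mono-≤ (0≤1) 1≤3 n))
    where
    1≤3 : 1ℚ ≤ 3ℚ
    1≤3 = +-mono-≤ (≤-refl {1ℚ}) (0≤* {2ℚ} {1ℚ} (+-mono-≤ (0≤1) (0≤1)) (0≤1))
    1^n : ∀ n → 1ℚ ^ n ≡ 1ℚ
    1^n zero = refl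
    1^n (suc n) = trans (*-identityˡ (1ℚ ^ n)) (1^n n)

  -- From t − a ≤ 2 n and t ≤ 3 n:  t^(k+1) − a^(k+1) = t (t^k − a^k) + (t − a) a^k.
  ^-difference : ∀ {t a n} → 0ℚ ≤ t → 0ℚ ≤ a → a ≤ n → t - a ≤ 2ℚ * n →
                 ∀ k → t ^ k - a ^ k ≤ (3ℚ ^ k - 1ℚ) * n ^ k
  ^-difference 0≤t 0≤a a≤n t-a≤2n zero = ≤-refl
  ^-difference {t} {a} {n} 0≤t 0≤a a≤n t-a≤2n (suc k) = begin
    t * t ^ k - a * a ^ k
      ≡⟨ solve 4 (λ t a x y → t :* x :- a :* y := t :* (x :- y) :+ (t :- a) :* y) refl t a (t ^ k)
          (a ^ k) ⟩
    t * (t ^ k - a ^ k) + (t - a) * a ^ k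
      ≤⟨ +-mono-≤
           (≤-trans (*-monoˡ-≤ 0≤t (^-difference 0≤t 0≤a a≤n t-a≤2n k))
                    (*-monoʳ-≤ (0≤* (0≤3^n-1 k) (0≤^ 0≤n k)) t≤3n))
           (≤-trans (*-monoʳ-≤ (0≤^ 0≤a k) t-a≤2n)
                    (*-monoˡ-≤ (0≤* {2ℚ} {n} (+-mono-≤ (0≤1) (0≤1)) 0≤n) (^-mono-≤ 0≤a a≤n k))) ⟩
    3ℚ * n * ((3ℚ ^ k - 1ℚ) * n ^ k) + 2ℚ * n * n ^ k
      ≡⟨ solve 3 (λ n x y → (con 1ℚ :+ (con 1ℚ :+ con 1ℚ)) :* n :* ((x :- con 1ℚ) :* y) :+
          (con 1ℚ :+ con 1ℚ) :* n :* y :=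
                            ((con 1ℚ :+ (con 1ℚ :+ con 1ℚ)) :* x :- con 1ℚ) :* (n :* y)) refl n
                                (3ℚ ^ k) (n ^ k) ⟩
    (3ℚ * 3ℚ ^ k - 1ℚ) * (n * n ^ k) ∎
    where
    open +-*-Solver
    open ≤-Reasoning
    0≤n : 0ℚ ≤ n
    0≤n = ≤-trans 0≤a a≤n
    t≤3n : t ≤ 3ℚ * n
    t≤3n = begin
      t                ≡⟨ solve 2 (λ t a → t := (t :- a) :+ a) refl t a ⟩
      (t - a) + a      ≤⟨ +-mono-≤ t-a≤2n a≤n ⟩
      2ℚ * n + n       ≡⟨ solve 1 (λ n → (con 1ℚ :+ con 1ℚ) :* n :+ n :=
          (con 1ℚ :+ (con 1ℚ :+ con 1ℚ)) :* n) refl n ⟩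
      3ℚ * n           ∎

  -- The contribution of one coordinate

  paired-≡ : ∀ {d} {a b c e : Fin d} → a ≡ b → c ≡ e → paired a b c e ≡ 1ℚ
  paired-≡ {a = a} {b} {c} {e} a≡b c≡e with a Fin.≟ b
  ... | yes _ = 𝟙-yes (c Fin.≟ e) c≡e
  ... | no a≢b = ⊥-elim (a≢b a≡b)

  module _ {d : ℕ} (a b c e : Fin d) where
    0≤paired : 0ℚ ≤ paired a b c e
    0≤paired with a Fin.≟ b | a Fin.≟ c | a Fin.≟ e
    ... | yes _ | _ | _ = 0≤𝟙 (c Fin.≟ e)
    ... | no _ | yes _ | _ = 0≤𝟙 (b Fin.≟ e)
    ... | no _ | no _ | yes _ = 0≤𝟙 (b Fin.≟ c)
    ... | no _ | no _ | no _ = ≤-refl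

    -- A union bound: `paired` indicates that at least one of the three pairings holds, and so it is
    -- at most the sum of their indicators, one of which stands on the left. The inequality is
    -- strict when all four points coincide.
    paired-≤ : paired a b c e - δ a b * δ c e ≤ δ a c * δ b e + δ a e * δ b c
    paired-≤ = by-cases (a Fin.≟ b) (a Fin.≟ c) (a Fin.≟ e)
      where
      open ≤-Reasoning
      by-cases : ∀ {P Q R : Set} (a≟b : Dec P) (a≟c : Dec Q) (a≟e : Dec R) →
        (if does a≟b then δ c e else if does a≟c then δ b e else if does a≟e then δ b c else 0ℚ)
          - 𝟙 a≟b * δ c e ≤ 𝟙 a≟c * δ b e + 𝟙 a≟e * δ b c
      by-cases (yes _) a≟c a≟e = begin
        δ c e - 1ℚ * δ c e                 ≡⟨ trans (cong (λ z → δ c e - z) (*-identityˡ (δ c e)))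
            (+-inverseʳ (δ c e)) ⟩
        0ℚ                                 ≤⟨ +-mono-≤ (0≤* (0≤𝟙 a≟c) (0≤𝟙 (b Fin.≟ e)))
            (0≤* (0≤𝟙 a≟e) (0≤𝟙 (b Fin.≟ c))) ⟩
        𝟙 a≟c * δ b e + 𝟙 a≟e * δ b c      ∎
      by-cases (no _) (yes _) a≟e = begin
        δ b e - 0ℚ * δ c e                 ≡⟨ minus-zero (δ b e) (δ c e) ⟩
        δ b e                              ≡⟨ solve 1 (λ x → x := con 1ℚ :* x :+ con 0ℚ) refl
            (δ b e) ⟩
        1ℚ * δ b e + 0ℚ                    ≤⟨ +-monoʳ-≤ (1ℚ * δ b e)
            (0≤* (0≤𝟙 a≟e) (0≤𝟙 (b Fin.≟ c))) ⟩
        1ℚ * δ b e + 𝟙 a≟e * δ b c         ∎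
        where
        open +-*-Solver
        minus-zero : ∀ x y → x - 0ℚ * y ≡ x
        minus-zero = solve 2 (λ x y → x :- con 0ℚ :* y := x) refl
      by-cases (no _) (no _) (yes _) = ≤-reflexive
        (solve 3 (λ x y z → x :- con 0ℚ :* y := con 0ℚ :* z :+ con 1ℚ :* x) refl (δ b c) (δ c e)
            (δ b e))
        where open +-*-Solver
      by-cases (no _) (no _) (no _) = ≤-reflexive
        (solve 3 (λ x y z → con 0ℚ :- con 0ℚ :* y := con 0ℚ :* z :+ con 0ℚ :* x) refl (δ b c)
            (δ c e) (δ b e))
        where open +-*-Solver

  module _ {d : ℕ} (f g : Vector ℚ d) (0≤f : ∀ a → 0ℚ ≤ f a) (0≤g : ∀ a → 0ℚ ≤ g a) where
    private
      w : Fin d → Fin d → Fin d → Fin d → ℚ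
      w a b c e = f a * g b * (f c * g e)

      0≤w : ∀ a b c e → 0ℚ ≤ w a b c e
      0≤w a b c e = 0≤* (0≤* (0≤f a) (0≤g b)) (0≤* (0≤f c) (0≤g e))

      t s n : ℚ
      t = ∑⁴ λ a b c e → paired a b c e * w a b c e
      s = ∑⁴ λ a b c e → δ a b * δ c e * w a b c e
      n = ∑ (λ a → f a * f a) * ∑ (λ a → g a * g a)

      -- One `n` is the exact value of the pairing of `a` with `c` and `b` with `e`; the other
      -- bounds the crossed pairing, a squared inner product, by Cauchy-Schwarz.
      t-s≤2n : t - s ≤ 2ℚ * n
      t-s≤2n = begin
        t - s
          ≡⟨ sym (∑⁴-distrib-- _ _) ⟩
        ∑⁴ (λ a b c e → paired a b c e * w a b c e - δ a b * δ c e * w a b c e)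
          ≡⟨ ∑⁴-cong (λ a b c e → solve 3 (λ x y z → x :* z :- y :* z := (x :- y) :* z) refl
              (paired a b c e) (δ a b * δ c e) (w a b c e)) ⟩
        ∑⁴ (λ a b c e → (paired a b c e - δ a b * δ c e) * w a b c e)
          ≤⟨ ∑⁴-mono (λ a b c e → *-monoʳ-≤ (0≤w a b c e) (paired-≤ a b c e)) ⟩
        ∑⁴ (λ a b c e → (δ a c * δ b e + δ a e * δ b c) * w a b c e)
          ≡⟨ ∑⁴-cong (λ a b c e → *-distribʳ-+ (w a b c e) (δ a c * δ b e) (δ a e * δ b c)) ⟩
        ∑⁴ (λ a b c e → δ a c * δ b e * w a b c e + δ a e * δ b c * w a b c e)
          ≡⟨ trans (∑⁴-distrib-+ _ _) (cong₂ _+_ (∑⁴-δac*δbe f g) (∑⁴-δae*δbc f g)) ⟩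
        n + ∑ (λ a → f a * g a) * ∑ (λ a → f a * g a)
          ≤⟨ +-monoʳ-≤ n (cauchy-schwarz f g) ⟩
        n + n
          ≡⟨ solve 1 (λ n → n :+ n := (con 1ℚ :+ con 1ℚ) :* n) refl n ⟩
        2ℚ * n ∎
        where
        open ≤-Reasoning
        open +-*-Solver

    ∑⁴-paired-power : ∀ p → t ^ p - s ^ p ≤ (3ℚ ^ p - 1ℚ) * n ^ p
    ∑⁴-paired-power = ^-difference
      (0≤∑ λ a → 0≤∑ λ b → 0≤∑ λ c → 0≤∑ λ e → 0≤* (0≤paired a b c e) (0≤w a b c e))
      (0≤∑ λ a → 0≤∑ λ b → 0≤∑ λ c → 0≤∑ λ e → 0≤* (0≤* (0≤𝟙 (a Fin.≟ b)) (0≤𝟙 (c Fin.≟ e)))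
          (0≤w a b c e))
      (subst (_≤ n) (sym (∑⁴-δab*δce f g)) (cauchy-schwarz f g))
      t-s≤2n

  -- The sketches of a rational vector

  -- Exchanging the sums puts the bucket `t` innermost. Only the bucket t = a u survives there, and
  -- what it leaves is the test for a collision.
  ∑-∑δ*∑δ : ∀ {m n k} (a : Fin m → Fin k) (b : Fin n → Fin k) (f : Vector ℚ m) (g : Vector ℚ n) →
    ∑ (λ t → ∑ (λ u → δ (a u) t * f u) * ∑ (λ v → δ (b v) t * g v)) ≡
    ∑ λ u → ∑ λ v → δ (a u) (b v) * (f u * g v)
  ∑-∑δ*∑δ a b f g = begin
    ∑ (λ t → ∑ (λ u → δ (a u) t * f u) * ∑ (λ v → δ (b v) t * g v))
      ≡⟨ ∑-cong (λ t → ∑*∑ (λ u → δ (a u) t * f u) (λ v → δ (b v) t * g v)) ⟩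
    ∑ (λ t → ∑ λ u → ∑ λ v → (δ (a u) t * f u) * (δ (b v) t * g v))
      ≡⟨ trans (∑-comm _) (∑-cong λ u → ∑-comm _) ⟩
    ∑ (λ u → ∑ λ v → ∑ λ t → (δ (a u) t * f u) * (δ (b v) t * g v))
      ≡⟨ ∑-cong (λ u → ∑-cong λ v → trans
           (∑-cong λ t → solve 4 (λ x f y g → (x :* f) :* (y :* g) := x :* (y :* (f :* g))) refl
               (δ (a u) t) (f u) (δ (b v) t) (g v))
           (trans (∑-δ (a u) (λ t → δ (b v) t * (f u * g v)))
               (cong (_* (f u * g v)) (δ-sym (b v) (a u))))) ⟩
    ∑ (λ u → ∑ λ v → δ (a u) (b v) * (f u * g v)) ∎
    where
    open ≡-Reasoning
    open +-*-Solver

  σ-* : ∀ s t → σ (s Sign.* t) ≡ σ s * σ t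
  σ-* Sign.+ t = sym (*-identityˡ (σ t))
  σ-* Sign.- Sign.+ = refl
  σ-* Sign.- Sign.- = refl

  σ-foldr : ∀ {n} (s : Vector Sign n) → σ (Vector.foldr Sign._*_ Sign.+ s) ≡ ∏ (σ ∘ s)
  σ-foldr {zero} s = sym (∏-[] _)
  σ-foldr {suc n} s = trans (σ-* (s zero) _)
      (trans (cong (σ (s zero) *_) (σ-foldr (s ∘ suc))) (sym (∏-suc _)))

  foldr-+-cong : ∀ {n} {f g : Vector ℕ n} → f ≗ g → Vector.foldr ℕ._+_ 0 f ≡ Vector.foldr ℕ._+_ 0 g
  foldr-+-cong {zero} f≗g = refl
  foldr-+-cong {suc n} f≗g = cong₂ ℕ._+_ (f≗g zero) (foldr-+-cong (f≗g ∘ suc))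

  tensor : ∀ {d} p → Vector ℚ d → Fin (d ℕ.^ p) → ℚ
  tensor {d} p x u = ∏ λ j → x (finToFun {d} {p} u j)

  ⟨tensor,tensor⟩ : ∀ {d} p (x y : Vector ℚ d) →
    ∑ (λ u → tensor p x u * tensor p y u) ≡ ∑ (λ a → x a * y a) ^ p
  ⟨tensor,tensor⟩ {d} p x y = trans
    (∑-cong λ u → sym (∏-distrib-* (λ j → x (finToFun {d} {p} u j))
        (λ j → y (finToFun {d} {p} u j))))
    (trans (∑-finToFun p (λ j a → x a * y a)) (∏-const p _))

  module _ {d D p : ℕ} .{{_ : NonZero D}} where
    private
      Tuple : Set
      Tuple = Fin (d ℕ.^ p)

      infixl 9 _!_
      _!_ : Tuple → Fin p → Fin d
      _!_ = finToFun

      infix 4 _≋_ _≋?_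
      -- Coordinatewise equality stands in for equality of indices: the sketches see an index only
      -- through its coordinates, and a failure of `_≋_` yields the coordinate that `E-collision`
      -- asks for.
      _≋_ : Tuple → Tuple → Set
      u ≋ v = ∀ j → u ! j ≡ v ! j

      _≋?_ : ∀ u v → Dec (u ≋ v)
      u ≋? v = Fin.all? λ j → u ! j Fin.≟ v ! j

      Δ : Tuple → Tuple → ℚ
      Δ u v = ∏ λ j → δ (u ! j) (v ! j)

      κ : Tuple → Tuple → Tuple → Tuple → ℚ
      κ u v u′ v′ = ∏ λ j → paired (u ! j) (v ! j) (u′ ! j) (v′ ! j)

      Δ-≋ : ∀ {u v} → u ≋ v → Δ u v ≡ 1ℚ
      Δ-≋ u≋v = ∏-one λ j → 𝟙-yes (_ Fin.≟ _) (u≋v j)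

      ≢-witness : ∀ {u v} → ¬ u ≋ v → ∃[ j ] u ! j ≢ v ! j
      ≢-witness {u} {v} = Fin.¬∀⟶∃¬ p _ (λ j → u ! j Fin.≟ v ! j)

      Δ-≢ : ∀ {u v} → ¬ u ≋ v → Δ u v ≡ 0ℚ
      Δ-≢ {u} {v} u≢v = let j , uj≢vj = ≢-witness {u} {v} u≢v in ∏-zero j (𝟙-no (_ Fin.≟ _) uj≢vj)

    sketch : Vector (Fin d → Fin D) p → Vector (Fin d → Sign) p → Vector ℚ d → Fin D → ℚ
    sketch h s x t = ∑ λ u → δ (compositeHash h u) t * (σ (compositeSign s u) * tensor p x u)

    ⟨sketch,sketch⟩ : Vector ℚ d → Vector ℚ d → Vector (Fin d → Fin D) p × Vector
        (Fin d → Sign) p → ℚ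
    ⟨sketch,sketch⟩ x y (h , s) = ∑ λ t → sketch h s x t * sketch h s y t

    module _ (𝓗 : Fin p → List⁺ (Fin d → Fin D)) (𝓢 : Fin p → List⁺ (Fin d → Sign))
      (𝓗-indep : ∀ j → KWiseIndependent 2 (↔-id (Fin D)) (𝓗 j))
      (𝓢-indep : ∀ j → KWiseIndependent 4 Sign↔Fin2 (𝓢 j))
      where

      private
        collide : Tuple → Tuple → Vector (Fin d → Fin D) p → ℚ
        collide u v h = δ (compositeHash h u) (compositeHash h v)

        signs : Tuple → Tuple → Vector (Fin d → Sign) p → ℚ
        signs u v s = σ (compositeSign s u) * σ (compositeSign s v)

        Pr : Tuple → Tuple → Tuple → Tuple → ℚ
        Pr u v u′ v′ = E (⨂ 𝓗) λ h → collide u v h * collide u′ v′ h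

        signs-∏ : ∀ u v s → signs u v s ≡ ∏ λ j → σ (s j (u ! j)) * σ (s j (v ! j))
        signs-∏ u v s = trans (cong₂ _*_ (σ-foldr _) (σ-foldr _)) (sym (∏-distrib-* _ _))

        E-signs : ∀ u v → E (⨂ 𝓢) (signs u v) ≡ Δ u v
        E-signs u v = trans (E-cong (⨂ 𝓢) (signs-∏ u v))
          (trans (E-⨂-∏ 𝓢 (λ j s → σ (s (u ! j)) * σ (s (v ! j))))
                 (∏-cong λ j → E-σσ (𝓢 j) (𝓢-indep j) (u ! j) (v ! j)))

        E-signs⁴ : ∀ u v u′ v′ → E (⨂ 𝓢) (λ s → signs u v s * signs u′ v′ s) ≡ κ u v u′ v′
        E-signs⁴ u v u′ v′ = trans
          (E-cong (⨂ 𝓢) λ s → trans (cong₂ _*_ (signs-∏ u v s) (signs-∏ u′ v′ s))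
              (sym (∏-distrib-* _ _)))
          (trans (E-⨂-∏ 𝓢 (λ j s → σ (s (u ! j)) * σ (s (v ! j)) *
                                   (σ (s (u′ ! j)) * σ (s (v′ ! j)))))
                 (∏-cong λ j → E-σσσσ (𝓢 j) (𝓢-indep j) (u ! j) (v ! j) (u′ ! j) (v′ ! j)))

        collide-≋ : ∀ {u v} → u ≋ v → ∀ h → collide u v h ≡ 1ℚ
        collide-≋ u≋v h = 𝟙-yes (_ Fin.≟ _)
            (cong (_mod D) (foldr-+-cong λ j → cong (λ a → toℕ (h j a)) (u≋v j)))

        0≤collide : ∀ u v h → 0ℚ ≤ collide u v h
        0≤collide u v h = 0≤𝟙 (compositeHash h u Fin.≟ compositeHash h v)

        collide≤1 : ∀ u v h → collide u v h ≤ 1ℚ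
        collide≤1 u v h = 𝟙≤1 (compositeHash h u Fin.≟ compositeHash h v)

        E-collide-≢ : ∀ {u v} → ¬ u ≋ v → E (⨂ 𝓗) (collide u v) ≤ 1/ D
        E-collide-≢ {u} {v} u≢v = E-collision 𝓗 𝓗-indep (proj₂ (≢-witness {u} {v} u≢v)) 0 0

        Pr-≋ : ∀ {u v u′ v′} → u ≋ v → u′ ≋ v′ → Pr u v u′ v′ ≡ 1ℚ
        Pr-≋ {u} {v} {u′} {v′} u≋v u′≋v′ = trans
          (E-cong (⨂ 𝓗) λ h → cong₂ _*_ (collide-≋ {u} {v} u≋v h) (collide-≋ {u′} {v′} u′≋v′ h))
          (E-const (⨂ 𝓗) 1ℚ)

        -- The second collision is bounded by 1, which is attained when u′ ≋ v′; hence a single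
        -- factor 1/D.
        Pr-≢ˡ : ∀ {u v} u′ v′ → ¬ u ≋ v → Pr u v u′ v′ ≤ 1/ D
        Pr-≢ˡ {u} {v} u′ v′ u≢v = ≤-trans
          (E-mono (⨂ 𝓗) λ h → subst (collide u v h * collide u′ v′ h ≤_)
              (*-identityʳ (collide u v h))
            (*-monoˡ-≤ (0≤collide u v h) (collide≤1 u′ v′ h)))
          (E-collide-≢ {u} {v} u≢v)

        Pr-≢ʳ : ∀ u v {u′ v′} → ¬ u′ ≋ v′ → Pr u v u′ v′ ≤ 1/ D
        Pr-≢ʳ u v {u′} {v′} u′≢v′ = subst (_≤ 1/ D)
          (E-cong (⨂ 𝓗) λ h → *-comm (collide u′ v′ h) (collide u v h)) (Pr-≢ˡ {u′} {v′} u v u′≢v′)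

        0≤Pr : ∀ u v u′ v′ → 0ℚ ≤ Pr u v u′ v′
        0≤Pr u v u′ v′ = subst (_≤ Pr u v u′ v′) (E-const (⨂ 𝓗) 0ℚ)
          (E-mono (⨂ 𝓗) λ h → 0≤* (0≤collide u v h) (0≤collide u′ v′ h))

        0≤κ : ∀ u v u′ v′ → 0ℚ ≤ κ u v u′ v′
        0≤κ u v u′ v′ = 0≤∏ λ j → 0≤paired (u ! j) (v ! j) (u′ ! j) (v′ ! j)

        κ-≋ : ∀ {u v u′ v′} → u ≋ v → u′ ≋ v′ → κ u v u′ v′ ≡ 1ℚ
        κ-≋ {u} {v} {u′} {v′} u≋v u′≋v′ = ∏-one λ j → paired-≡ (u≋v j) (u′≋v′ j)

        -- If u ≋ v and u′ ≋ v′, both sides vanish; otherwise Δ u v * Δ u′ v′ does.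
        ∣Prκ-ΔΔ∣≤ : ∀ u v u′ v′ →
          ∣ Pr u v u′ v′ * κ u v u′ v′ - Δ u v * Δ u′ v′ ∣ ≤ 1/ D * (κ u v u′ v′ - Δ u v * Δ u′ v′)
        ∣Prκ-ΔΔ∣≤ u v u′ v′ = by-cases (u ≋? v) (u′ ≋? v′)
          where
          open +-*-Solver

          off-diagonal : Δ u v * Δ u′ v′ ≡ 0ℚ → Pr u v u′ v′ ≤ 1/ D →
            ∣ Pr u v u′ v′ * κ u v u′ v′ - Δ u v * Δ u′ v′ ∣ ≤ 1/ D *
                (κ u v u′ v′ - Δ u v * Δ u′ v′)
          off-diagonal ΔΔ≡0 Pr≤1/D = subst₂ _≤_
            (sym (trans (cong ∣_∣ (minus-ΔΔ (Pr u v u′ v′ * κ u v u′ v′)))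
                (0≤p⇒∣p∣≡p (0≤* (0≤Pr u v u′ v′) (0≤κ u v u′ v′)))))
            (cong (1/ D *_) (sym (minus-ΔΔ (κ u v u′ v′))))
            (*-monoʳ-≤ (0≤κ u v u′ v′) Pr≤1/D)
            where
            minus-ΔΔ : ∀ q → q - Δ u v * Δ u′ v′ ≡ q
            minus-ΔΔ q = trans (cong (λ z → q - z) ΔΔ≡0) (+-identityʳ q)

          by-cases : Dec (u ≋ v) → Dec (u′ ≋ v′) →
            ∣ Pr u v u′ v′ * κ u v u′ v′ - Δ u v * Δ u′ v′ ∣ ≤ 1/ D *
                (κ u v u′ v′ - Δ u v * Δ u′ v′)
          by-cases (no u≢v) _ = off-diagonal
            (trans (cong (_* Δ u′ v′) (Δ-≢ {u} {v} u≢v)) (*-zeroˡ (Δ u′ v′)))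
                (Pr-≢ˡ {u} {v} u′ v′ u≢v)
          by-cases (yes _) (no u′≢v′) = off-diagonal
            (trans (cong (Δ u v *_) (Δ-≢ {u′} {v′} u′≢v′)) (*-zeroʳ (Δ u v)))
                (Pr-≢ʳ u v {u′} {v′} u′≢v′)
          by-cases (yes u≋v) (yes u′≋v′) = ≤-reflexive (trans
            (cong₂ (λ a b → ∣ a - b ∣) (cong₂ _*_ (Pr-≋ {u} {v} {u′} {v′} u≋v u′≋v′)
                (κ-≋ {u} {v} {u′} {v′} u≋v u′≋v′)) ΔΔ≡1)
            (sym (trans (cong₂ (λ a b → 1/ D * (a - b)) (κ-≋ {u} {v} {u′} {v′} u≋v u′≋v′) ΔΔ≡1)
                (*-zeroʳ (1/ D)))))
            where
            ΔΔ≡1 : Δ u v * Δ u′ v′ ≡ 1ℚ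
            ΔΔ≡1 = cong₂ _*_ (Δ-≋ {u} {v} u≋v) (Δ-≋ {u′} {v′} u′≋v′)

      -- Mean and variance of the inner product of the sketches

      module _ (x y : Vector ℚ d) where
        private
          Ω : List⁺ (Vector (Fin d → Fin D) p × Vector (Fin d → Sign) p)
          Ω = ⨂ 𝓗 ⊗ ⨂ 𝓢

          Z : Vector (Fin d → Fin D) p × Vector (Fin d → Sign) p → ℚ
          Z = ⟨sketch,sketch⟩ x y

          μ : ℚ
          μ = ∑ (λ a → x a * y a) ^ p

          XY : Tuple → Tuple → ℚ
          XY u v = tensor p x u * tensor p y v

          G : Tuple → Tuple → Vector (Fin d → Fin D) p × Vector (Fin d → Sign) p → ℚ
          G u v (h , s) = collide u v h * signs u v s * XY u v

          Z≡∑∑G : ∀ ω → Z ω ≡ ∑ λ u → ∑ λ v → G u v ω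
          Z≡∑∑G (h , s) = trans (∑-∑δ*∑δ (compositeHash h) (compositeHash h) _ _)
            (∑-cong λ u → ∑-cong λ v →
              solve 5 (λ c a x b y → c :* (a :* x :* (b :* y)) := c :* (a :* b) :* (x :* y)) refl
                (collide u v h) (σ (compositeSign s u)) (tensor p x u) (σ (compositeSign s v))
                    (tensor p y v))
            where open +-*-Solver

          -- The signs alone remove every term with u and v different; in the remaining ones the
          -- collision is certain, so hashing introduces no bias.
          E-G : ∀ u v → E Ω (G u v) ≡ Δ u v * XY u v
          E-G u v = trans (E-*ʳ Ω (XY u v) _) (cong (_* XY u v)
            (trans (E-⊗-* (⨂ 𝓗) (⨂ 𝓢) (collide u v) (signs u v))
              (trans (cong (E (⨂ 𝓗) (collide u v) *_) (E-signs u v)) (by-cases (u ≋? v)))))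
            where
            by-cases : Dec (u ≋ v) → E (⨂ 𝓗) (collide u v) * Δ u v ≡ Δ u v
            by-cases (yes u≋v) = trans
              (cong (_* Δ u v) (trans (E-cong (⨂ 𝓗) (collide-≋ {u} {v} u≋v)) (E-const (⨂ 𝓗) 1ℚ)))
                  (*-identityˡ (Δ u v))
            by-cases (no u≢v) = trans (cong (E (⨂ 𝓗) (collide u v) *_) (Δ-≢ {u} {v} u≢v))
              (trans (*-zeroʳ (E (⨂ 𝓗) (collide u v))) (sym (Δ-≢ {u} {v} u≢v)))

          ∑∑ΔXY : ∑ (λ u → ∑ λ v → Δ u v * XY u v) ≡ μ
          ∑∑ΔXY = begin
            ∑ (λ u → ∑ λ v → Δ u v * XY u v)
              ≡⟨ ∑-cong (λ u → ∑-cong λ v → sym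
                  (trans (∏-distrib-* _ _) (cong (Δ u v *_) (∏-distrib-* _ _)))) ⟩
            ∑ (λ u → ∑ λ v → ∏ λ j → δ (u ! j) (v ! j) * (x (u ! j) * y (v ! j)))
              ≡⟨ ∑∑-∏ p (λ a b → δ a b * (x a * y b)) ⟩
            ∑ (λ a → ∑ λ b → δ a b * (x a * y b)) ^ p
              ≡⟨ cong (_^ p) (∑-cong λ a → ∑-δ a (λ b → x a * y b)) ⟩
            μ ∎
            where open ≡-Reasoning

        E-⟨sketch,sketch⟩ : E (⨂ 𝓗 ⊗ ⨂ 𝓢) (⟨sketch,sketch⟩ x y) ≡ ∑ (λ a → x a * y a) ^ p
        E-⟨sketch,sketch⟩ = trans (E-cong Ω Z≡∑∑G)
          (trans (trans (E-∑ Ω _) (∑-cong λ u → trans (E-∑ Ω _) (∑-cong λ v → E-G u v))) ∑∑ΔXY)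

        private
          W : Tuple → Tuple → Tuple → Tuple → ℚ
          W u v u′ v′ = XY u v * XY u′ v′

          -- Hashes and signs are independent, so each term splits into a collision probability and
          -- a sign moment. Only the latter is a product over coordinates; `Pr` stays as it is.
          E-Z² : E Ω (λ ω → Z ω * Z ω) ≡ ∑⁴ λ u v u′ v′ → Pr u v u′ v′ * κ u v u′ v′ * W u v u′ v′
          E-Z² = begin
            E Ω (λ ω → Z ω * Z ω)
              ≡⟨ E-cong Ω (λ ω → trans (cong (λ z → z * z) (Z≡∑∑G ω)) (∑∑*∑∑ (λ u v → G u v ω))) ⟩
            E Ω (λ ω → ∑⁴ λ u v u′ v′ → G u v ω * G u′ v′ ω)
              ≡⟨ E-∑⁴ Ω _ ⟩
            ∑⁴ (λ u v u′ v′ → E Ω (λ ω → G u v ω * G u′ v′ ω))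
              ≡⟨ ∑⁴-cong (λ u v u′ v′ → trans (E-cong Ω λ (h , s) →
                   solve 6 (λ c s w c′ s′ w′ → c :* s :* w :* (c′ :* s′ :* w′) := c :* c′ :*
                       (s :* s′) :* (w :* w′)) refl
                     (collide u v h) (signs u v s) (XY u v) (collide u′ v′ h) (signs u′ v′ s)
                         (XY u′ v′))
                   (trans (E-*ʳ Ω (W u v u′ v′) _) (cong (_* W u v u′ v′)
                     (trans (E-⊗-* (⨂ 𝓗) (⨂ 𝓢) (λ h → collide u v h * collide u′ v′ h)
                         (λ s → signs u v s * signs u′ v′ s))
                            (cong (Pr u v u′ v′ *_) (E-signs⁴ u v u′ v′)))))) ⟩
            ∑⁴ (λ u v u′ v′ → Pr u v u′ v′ * κ u v u′ v′ * W u v u′ v′) ∎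
            where
            open ≡-Reasoning
            open +-*-Solver

          -- Brings the squared mean into the shape of `E-Z²`, so that the diagonal cancels term by
          -- term before absolute values are taken.
          μ² : μ * μ ≡ ∑⁴ λ u v u′ v′ → Δ u v * Δ u′ v′ * W u v u′ v′
          μ² = trans (cong (λ z → z * z) (sym ∑∑ΔXY)) (trans (∑∑*∑∑ (λ u v → Δ u v * XY u v))
            (∑⁴-cong λ u v u′ v′ → solve 4
                (λ a x b y → a :* x :* (b :* y) := a :* b :* (x :* y)) refl
              (Δ u v) (XY u v) (Δ u′ v′) (XY u′ v′)))
            where open +-*-Solver

          w : Fin d → Fin d → Fin d → Fin d → ℚ
          w a b c e = ∣ x a ∣ * ∣ y b ∣ * (∣ x c ∣ * ∣ y e ∣)

          ŵ : Tuple → Tuple → Tuple → Tuple → Vector ℚ p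
          ŵ u v u′ v′ j = w (u ! j) (v ! j) (u′ ! j) (v′ ! j)

          ∣W∣ : ∀ u v u′ v′ → ∣ W u v u′ v′ ∣ ≡ ∏ (ŵ u v u′ v′)
          ∣W∣ u v u′ v′ = begin
            ∣ XY u v * XY u′ v′ ∣
              ≡⟨ trans (∣p*q∣≡∣p∣*∣q∣ (XY u v) (XY u′ v′)) (cong₂ _*_ (∣XY∣ u v) (∣XY∣ u′ v′)) ⟩
            ∏ (λ j → ∣ x (u ! j) ∣ * ∣ y (v ! j) ∣) * ∏ (λ j → ∣ x (u′ ! j) ∣ * ∣ y (v′ ! j) ∣)
              ≡⟨ sym (∏-distrib-* _ _) ⟩
            ∏ (ŵ u v u′ v′) ∎
            where
            open ≡-Reasoning
            ∣XY∣ : ∀ u v → ∣ XY u v ∣ ≡ ∏ λ j → ∣ x (u ! j) ∣ * ∣ y (v ! j) ∣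
            ∣XY∣ u v = trans (∣p*q∣≡∣p∣*∣q∣ (tensor p x u) (tensor p y v))
              (trans (cong₂ _*_ (∣∏∣ (λ j → x (u ! j))) (∣∏∣ (λ j → y (v ! j))))
                  (sym (∏-distrib-* _ _)))

          t s n : ℚ
          t = ∑⁴ λ a b c e → paired a b c e * w a b c e
          s = ∑⁴ λ a b c e → δ a b * δ c e * w a b c e
          n = ∑ (λ a → ∣ x a ∣ * ∣ x a ∣) * ∑ (λ a → ∣ y a ∣ * ∣ y a ∣)

          ∑⁴-κ∣W∣ : ∑⁴ (λ u v u′ v′ → κ u v u′ v′ * ∣ W u v u′ v′ ∣) ≡ t ^ p
          ∑⁴-κ∣W∣ = trans
            (∑⁴-cong λ u v u′ v′ → trans (cong (κ u v u′ v′ *_) (∣W∣ u v u′ v′))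
                (sym (∏-distrib-* _ _)))
            (∑⁴-∏ p (λ a b c e → paired a b c e * w a b c e))

          ∑⁴-ΔΔ∣W∣ : ∑⁴ (λ u v u′ v′ → Δ u v * Δ u′ v′ * ∣ W u v u′ v′ ∣) ≡ s ^ p
          ∑⁴-ΔΔ∣W∣ = trans
            (∑⁴-cong λ u v u′ v′ → trans (cong₂ _*_ (sym (∏-distrib-* _ _)) (∣W∣ u v u′ v′))
                (sym (∏-distrib-* _ _)))
            (∑⁴-∏ p (λ a b c e → δ a b * δ c e * w a b c e))

          ∣q∣²≡q² : ∀ q → ∣ q ∣ * ∣ q ∣ ≡ q * q
          ∣q∣²≡q² q = trans (sym (∣p*q∣≡∣p∣*∣q∣ q q)) (0≤p⇒∣p∣≡p (0≤p² q))

        Var-⟨sketch,sketch⟩ : let Z = ⟨sketch,sketch⟩ x y; μ = ∑ (λ a → x a * y a) ^ p in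
          E (⨂ 𝓗 ⊗ ⨂ 𝓢) (λ ω → (Z ω - μ) * (Z ω - μ)) ≤
          1/ D * ((3ℚ ^ p - 1ℚ) * (∑ (λ a → x a * x a) * ∑ (λ a → y a * y a)) ^ p)
        Var-⟨sketch,sketch⟩ = begin
          E Ω (λ ω → (Z ω - μ) * (Z ω - μ))
            ≡⟨ E-cong Ω (λ ω → solve 2 (λ z m → (z :- m) :* (z :- m) := z :* z :+
                (:- (m :+ m) :* z :+ m :* m)) refl (Z ω) μ) ⟩
          E Ω (λ ω → Z ω * Z ω + (- (μ + μ) * Z ω + μ * μ))
            ≡⟨ trans (E-+ Ω (λ ω → Z ω * Z ω) _) (cong (E Ω (λ ω → Z ω * Z ω) +_)
                 (trans (E-+ Ω (λ ω → - (μ + μ) * Z ω) _)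
                     (cong₂ _+_ (trans (E-*ˡ Ω (- (μ + μ)) Z)
                     (cong (- (μ + μ) *_) E-⟨sketch,sketch⟩)) (E-const Ω (μ * μ))))) ⟩
          E Ω (λ ω → Z ω * Z ω) + (- (μ + μ) * μ + μ * μ)
            ≡⟨ solve 2 (λ e m → e :+ (:- (m :+ m) :* m :+ m :* m) := e :- m :* m) refl
                (E Ω (λ ω → Z ω * Z ω)) μ ⟩
          E Ω (λ ω → Z ω * Z ω) - μ * μ
            ≡⟨ trans (cong₂ _-_ E-Z² μ²) (sym (∑⁴-distrib-- _ _)) ⟩
          ∑⁴ (λ u v u′ v′ → Pr u v u′ v′ * κ u v u′ v′ * W u v u′ v′ - Δ u v * Δ u′ v′ * W u v u′ v′)
            -- After this step `Pr` is gone, and both remaining sums are sums of products over the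
            -- coordinates, that is, p-th powers.
            ≤⟨ ∑⁴-mono (λ u v u′ v′ → term u v u′ v′) ⟩
          ∑⁴ (λ u v u′ v′ → 1/ D * (κ u v u′ v′ * ∣ W u v u′ v′ ∣ - Δ u v * Δ u′ v′ * ∣ W u v u′ v′ ∣))
            ≡⟨ trans (sym (*-distribˡ-∑⁴ (1/ D) _))
                (cong (1/ D *_) (trans (∑⁴-distrib-- _ _) (cong₂ _-_ ∑⁴-κ∣W∣ ∑⁴-ΔΔ∣W∣))) ⟩
          1/ D * (t ^ p - s ^ p)
            ≤⟨ *-monoˡ-≤ (0≤1/n D) (∑⁴-paired-power (∣_∣ ∘ x) (∣_∣ ∘ y) (λ a → 0≤∣p∣ (x a))
                (λ a → 0≤∣p∣ (y a)) p) ⟩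
          1/ D * ((3ℚ ^ p - 1ℚ) * n ^ p)
            ≡⟨ cong (λ z → 1/ D * ((3ℚ ^ p - 1ℚ) * z ^ p))
                (cong₂ _*_ (∑-cong λ a → ∣q∣²≡q² (x a)) (∑-cong λ a → ∣q∣²≡q² (y a))) ⟩
          1/ D * ((3ℚ ^ p - 1ℚ) * (∑ (λ a → x a * x a) * ∑ (λ a → y a * y a)) ^ p) ∎
          where
          open ≤-Reasoning
          open +-*-Solver
          term : ∀ u v u′ v′ → Pr u v u′ v′ * κ u v u′ v′ * W u v u′ v′ - Δ u v * Δ u′ v′ * W u v u′ v′ ≤
            1/ D * (κ u v u′ v′ * ∣ W u v u′ v′ ∣ - Δ u v * Δ u′ v′ * ∣ W u v u′ v′ ∣)
          term u v u′ v′ = begin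
            Pr u v u′ v′ * κ u v u′ v′ * W u v u′ v′ - Δ u v * Δ u′ v′ * W u v u′ v′
              ≡⟨ solve 3 (λ a b c → a :* c :- b :* c := (a :- b) :* c) refl
                  (Pr u v u′ v′ * κ u v u′ v′) (Δ u v * Δ u′ v′) (W u v u′ v′) ⟩
            q * W u v u′ v′
              ≤⟨ p≤∣p∣ _ ⟩
            ∣ q * W u v u′ v′ ∣
              ≡⟨ ∣p*q∣≡∣p∣*∣q∣ q (W u v u′ v′) ⟩
            ∣ q ∣ * ∣ W u v u′ v′ ∣
              ≤⟨ *-monoʳ-≤ (0≤∣p∣ (W u v u′ v′)) (∣Prκ-ΔΔ∣≤ u v u′ v′) ⟩
            1/ D * (κ u v u′ v′ - Δ u v * Δ u′ v′) * ∣ W u v u′ v′ ∣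
              ≡⟨ solve 4 (λ r a b c → r :* (a :- b) :* c := r :* (a :* c :- b :* c)) refl (1/ D)
                  (κ u v u′ v′) (Δ u v * Δ u′ v′) ∣ W u v u′ v′ ∣ ⟩
            1/ D * (κ u v u′ v′ * ∣ W u v u′ v′ ∣ - Δ u v * Δ u′ v′ * ∣ W u v u′ v′ ∣) ∎
            where
            q : ℚ
            q = Pr u v u′ v′ * κ u v u′ v′ - Δ u v * Δ u′ v′

  -- Cauchy sequences

  infixl 9 _at_
  _at_ : ∀ {n} → Vector ℝ n → ℕ → Vector ℚ n
  (x at n) i = seq (x i) n

  opaque
    unfolding ∑ E total 1/_

    seq-sum : ∀ {m} (x : Vector ℝ m) n → seq (ℝ.sum x) n ≡ ∑ (x at n)
    seq-sum {zero} x n = refl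
    seq-sum {suc m} x n = cong (seq (x zero) n +_) (seq-sum (x ∘ suc) n)

    seq-product : ∀ {m} (x : Vector ℝ m) n → seq (ℝ.product x) n ≡ ∏ (x at n)
    seq-product {zero} x n = refl
    seq-product {suc m} x n = cong (seq (x zero) n *_) (seq-product (x ∘ suc) n)

    seq-𝔼 : ∀ {A : Set} (Ω : List⁺ A) (X : A → ℝ) n → seq (𝔼 Ω X) n ≡ E Ω (λ ω → seq (X ω) n)
    seq-𝔼 Ω X n = cong (1/ List⁺.length Ω *_) (seq-total (toList Ω))
      where
      seq-total : ∀ xs → seq (List.foldr ℝ._+_ ℝ.0ℝ (List.map X xs)) n ≡ total
          (λ ω → seq (X ω) n) xs
      seq-total [] = refl
      seq-total (x ∷ xs) = cong (seq (X x) n +_) (seq-total xs)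

  seq-^ : ∀ x k n → seq (x ℝ.^ k) n ≡ seq x n ^ k
  seq-^ x zero n = refl
  seq-^ x (suc k) n = cong (seq x n *_) (seq-^ x k n)

  seq-Var : ∀ {A : Set} (Ω : List⁺ A) (X : A → ℝ) n → let X̂ = λ ω → seq (X ω) n in
            seq (Var Ω X) n ≡ E Ω (λ ω → (X̂ ω - E Ω X̂) * (X̂ ω - E Ω X̂))
  seq-Var Ω X n = trans (seq-𝔼 Ω (λ ω → (X ω ℝ.- 𝔼 Ω X) ℝ.^ 2) n)
    (E-cong Ω λ ω → trans (seq-^ (X ω ℝ.- 𝔼 Ω X) 2 n)
      (trans (cong (seq (X ω ℝ.- 𝔼 Ω X) n *_) (*-identityʳ (seq (X ω ℝ.- 𝔼 Ω X) n)))
        (cong (λ m → (seq (X ω) n - m) * (seq (X ω) n - m)) (seq-𝔼 Ω X n))))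

  seq-±1 : ∀ s n → seq (±1 s) n ≡ σ s
  seq-±1 Sign.+ n = refl
  seq-±1 Sign.- n = refl

  seq-⟨,⟩ : ∀ {m} (x y : Vector ℝ m) n → seq ⟨ x , y ⟩ n ≡ ∑ λ i → seq (x i) n * seq (y i) n
  seq-⟨,⟩ x y n = seq-sum _ n

  seq-⊗ : ∀ {d} p (x : Vector ℝ d) n u → seq ((x ^⊗ p) u) n ≡ ∏ λ j → (x at n)
      (finToFun {d} {p} u j)
  seq-⊗ {d} p x n u = seq-product (λ j → x (finToFun {d} {p} u j)) n

  seq-⟨^⊗,^⊗⟩ : ∀ {d} p (x y : Vector ℝ d) n →
                 seq ⟨ x ^⊗ p , y ^⊗ p ⟩ n ≡ ∑ (λ a → (x at n) a * (y at n) a) ^ p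
  seq-⟨^⊗,^⊗⟩ p x y n = trans (seq-⟨,⟩ (x ^⊗ p) (y ^⊗ p) n)
    (trans (∑-cong λ u → cong₂ _*_ (seq-⊗ p x n u) (seq-⊗ p y n u))
        (⟨tensor,tensor⟩ p (x at n) (y at n)))

  module _ {d D p : ℕ} .{{_ : ℕ.NonZero D}} (x : Vector ℝ d) (n : ℕ) where
    seq-countSketch : ∀ h s t →
      seq (countSketch (compositeHash {d} {D} {p} h) (compositeSign s) (x ^⊗ p) t) n ≡ sketch h s
          (x at n) t
    seq-countSketch h s t = trans (seq-sum _ n) (∑-cong λ u → term u (compositeHash h u Fin.≟ t))
      where
      term : ∀ u {P : Set} (P? : Dec P) →
        seq (if does P? then ±1 (compositeSign s u) ℝ.* (x ^⊗ p) u else ℝ.0ℝ) n ≡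
        𝟙 P? * (σ (compositeSign s u) * tensor p (x at n) u)
      term u (yes _) = trans (cong₂ _*_ (seq-±1 (compositeSign s u) n) (seq-⊗ p x n u))
        (sym (*-identityˡ (σ (compositeSign s u) * tensor p (x at n) u)))
      term u (no _) = sym (*-zeroˡ (σ (compositeSign s u) * tensor p (x at n) u))

  -- Equality of reals and the square root

  pointwise-≃ : ∀ x y → (∀ n → seq x n ≡ seq y n) → x ≃ y
  pointwise-≃ x y x≡y ε 0<ε = 0 , λ n _ →
    subst (_< ε) (sym (cong ∣_∣ (trans (cong (_- seq y n) (x≡y n)) (+-inverseʳ (seq y n))))) 0<ε

  ≃-trans : ∀ x y z → x ≃ y → y ≃ z → x ≃ z
  ≃-trans x y z x≃y y≃z ε 0<ε =
    let M , p = x≃y (½ * ε) (ℝ.half-pos 0<ε)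
        N , q = y≃z (½ * ε) (ℝ.half-pos 0<ε)
    in M ℕ.⊔ N , λ n K≤n → begin-strict
      ∣ seq x n - seq z n ∣
        ≡⟨ cong ∣_∣ (solve 3 (λ x y z → x :- z := (x :- y) :+ (y :- z)) refl (seq x n) (seq y n)
            (seq z n)) ⟩
      ∣ (seq x n - seq y n) + (seq y n - seq z n) ∣
        ≤⟨ ∣p+q∣≤∣p∣+∣q∣ (seq x n - seq y n) (seq y n - seq z n) ⟩
      ∣ seq x n - seq y n ∣ + ∣ seq y n - seq z n ∣
        <⟨ +-mono-< (p n (ℕ.m⊔n≤o⇒m≤o M N K≤n)) (q n (ℕ.m⊔n≤o⇒n≤o M N K≤n)) ⟩
      ½ * ε + ½ * ε
        ≡⟨ ℝ.half+half ε ⟩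
      ε ∎
    where
    open ≤-Reasoning
    open +-*-Solver

  *-cong-≃ : ∀ x x′ y y′ → x ≃ x′ → y ≃ y′ → (x ℝ.* y) ≃ (x′ ℝ.* y′)
  *-cong-≃ x x′ y y′ x≃x′ y≃y′ ε 0<ε =
    let A , 0<A , K , x≤A  = ℝ.eventualBound (seq x) (cauchy x)
        B , 0<B , L , y′≤B = ℝ.eventualBound (seq y′) (cauchy y′)
        C   = A + B
        0<C = +-mono-< 0<A 0<B
        C≢0 = >-nonZero 0<C
        -- Chosen so that C * δ = ε/2. The constant `C` eventually bounds `x` and `y′`, the
        -- cofactors in x y - x′ y′ = x (y - y′) + y′ (x - x′).
        δ   = (½ * ε) * (ℚ.1/ C) {{C≢0}}
        0<δ = ℝ.quotient-pos (½ * ε) C (ℝ.half-pos 0<ε) {{positive 0<C}}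
        M , p = x≃x′ δ 0<δ
        N , q = y≃y′ δ 0<δ
    in (K ℕ.⊔ L) ℕ.⊔ (M ℕ.⊔ N) , λ n ≤n →
      let KL≤n = ℕ.m⊔n≤o⇒m≤o (K ℕ.⊔ L) (M ℕ.⊔ N) ≤n
          MN≤n = ℕ.m⊔n≤o⇒n≤o (K ℕ.⊔ L) (M ℕ.⊔ N) ≤n
          x≤C  = ≤-trans (x≤A n (ℕ.m⊔n≤o⇒m≤o K L KL≤n)) (ℝ.p≤p+q A B 0<B)
          y′≤C = ≤-trans (y′≤B n (ℕ.m⊔n≤o⇒n≤o K L KL≤n)) (ℝ.q≤p+q A B 0<A)
      in begin-strict
      ∣ seq x n * seq y n - seq x′ n * seq y′ n ∣
        ≡⟨ cong ∣_∣ (solve 4 (λ x y x′ y′ → x :* y :- x′ :* y′ := x :* (y :- y′) :+ y′ :*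
            (x :- x′)) refl
                       (seq x n) (seq y n) (seq x′ n) (seq y′ n)) ⟩
      ∣ seq x n * (seq y n - seq y′ n) + seq y′ n * (seq x n - seq x′ n) ∣
        ≤⟨ ∣p+q∣≤∣p∣+∣q∣ (seq x n * (seq y n - seq y′ n)) (seq y′ n * (seq x n - seq x′ n)) ⟩
      ∣ seq x n * (seq y n - seq y′ n) ∣ + ∣ seq y′ n * (seq x n - seq x′ n) ∣
        <⟨ +-mono-< (ℝ.∣uv∣<Cδ {seq x n} 0<C x≤C (q n (ℕ.m⊔n≤o⇒n≤o M N MN≤n)))
                    (ℝ.∣uv∣<Cδ {seq y′ n} 0<C y′≤C (p n (ℕ.m⊔n≤o⇒m≤o M N MN≤n))) ⟩
      C * δ + C * δ
        ≡⟨ cong₂ _+_ (ℝ.C*[ε/C] (½ * ε) C {{C≢0}}) (ℝ.C*[ε/C] (½ * ε) C {{C≢0}}) ⟩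
      ½ * ε + ½ * ε
        ≡⟨ ℝ.half+half ε ⟩
      ε ∎
    where
    open ≤-Reasoning
    open +-*-Solver

  ^-cong-≃ : ∀ x y → x ≃ y → ∀ k → (x ℝ.^ k) ≃ (y ℝ.^ k)
  ^-cong-≃ x y x≃y zero = pointwise-≃ (x ℝ.^ 0) (y ℝ.^ 0) λ _ → refl
  ^-cong-≃ x y x≃y (suc k) = *-cong-≃ x y (x ℝ.^ k) (y ℝ.^ k) x≃y (^-cong-≃ x y x≃y k)

  -- With r the approximate root and η = 1/(n+1), there is an s with r² ≤ q < s² ≤ (r + η)². The
  -- error is therefore below (2r + η) η, and r ≤ B, η ≤ 1 bound the first factor.
  ∣approxRoot²-q∣< : ∀ q n {B} → 0ℚ ≤ q → ∣ ℝ.approxRoot q n ∣ ≤ B → (ℤ.+ 1 / suc n) ≤ 1ℚ →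
    ∣ ℝ.approxRoot q n * ℝ.approxRoot q n - q ∣ < (B + B + 1ℚ) * (ℤ.+ 1 / suc n)
  ∣approxRoot²-q∣< q n {B} 0≤q r≤B η≤1 =
    let instance q⁺≥0 = nonNegative (p≤q⊔p q 0ℚ)
        s , q<s² , s≤r+η , 0≤s = ℝ.<[root+1/suc]² (q ⊔ 0ℚ) n
    in begin-strict
    ∣ r * r - q ∣
      ≡⟨ trans (sym (∣-p∣≡∣p∣ (r * r - q)))
          (trans (cong ∣_∣ (solve 2 (λ r q → :- (r :* r :- q) := q :- r :* r) refl r q))
           (0≤p⇒∣p∣≡p (0≤q-p (subst (r * r ≤_) q⊔0≡q (ℝ.root²≤ (q ⊔ 0ℚ) n))))) ⟩
    q - r * r
      <⟨ +-monoˡ-< (- (r * r)) (subst (_< s * s) q⊔0≡q q<s²) ⟩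
    s * s - r * r
      ≤⟨ +-monoˡ-≤ (- (r * r)) (ℝ.square-mono 0≤s s≤r+η) ⟩
    (r + η) * (r + η) - r * r
      ≡⟨ solve 2 (λ r η → (r :+ η) :* (r :+ η) :- r :* r := (r :+ r :+ η) :* η) refl r η ⟩
    (r + r + η) * η
      ≤⟨ *-monoʳ-≤ (≤-trans (0≤1/n (suc n)) (≤-reflexive (1/-def (suc n))))
          (+-mono-≤ (+-mono-≤ r≤B′ r≤B′) η≤1) ⟩
    (B + B + 1ℚ) * η ∎
    where
    open ≤-Reasoning
    open +-*-Solver
    r η : ℚ
    r = ℝ.approxRoot q n
    η = ℤ.+ 1 / suc n
    r≤B′ : r ≤ B
    r≤B′ = ≤-trans (p≤∣p∣ r) r≤B
    q⊔0≡q : q ⊔ 0ℚ ≡ q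
    q⊔0≡q = p≥q⇒p⊔q≡p 0≤q

  -- The roots are rounded down, so this need not hold term by term. The approximate roots form a
  -- Cauchy sequence and are eventually bounded by some `B`, which makes the error (2B + 1)/(n + 1)
  -- a null sequence.
  √*√-≃ : ∀ x → (∀ n → 0ℚ ≤ seq x n) → (√ x ℝ.* √ x) ≃ x
  √*√-≃ x 0≤x ε 0<ε =
    let B , 0<B , K , r≤B = ℝ.eventualBound (seq (√ x)) (cauchy (√ x))
        C   = B + B + 1ℚ
        0<C = +-mono-<-≤ (+-mono-< 0<B 0<B) 0≤1
        C≢0 = >-nonZero 0<C
        L , η≤1 = ℝ.archimedean 1ℚ (positive⁻¹ 1ℚ)
        M , η≤δ = ℝ.archimedean (ε * (ℚ.1/ C) {{C≢0}}) (ℝ.quotient-pos ε C 0<ε {{positive 0<C}})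
    in K ℕ.⊔ (L ℕ.⊔ M) , λ n ≤n →
      let LM≤n = ℕ.m⊔n≤o⇒n≤o K (L ℕ.⊔ M) ≤n in
      <-≤-trans
        (∣approxRoot²-q∣< (seq x n) n (0≤x n) (r≤B n (ℕ.m⊔n≤o⇒m≤o K (L ℕ.⊔ M) ≤n))
            (η≤1 n (ℕ.m⊔n≤o⇒m≤o L M LM≤n)))
        (≤-trans (*-monoˡ-≤ (<⇒≤ 0<C) (η≤δ n (ℕ.m⊔n≤o⇒n≤o L M LM≤n)))
                 (≤-reflexive (ℝ.C*[ε/C] ε C {{C≢0}})))

  -- Regrouping the power is exact at each index. Every term of ⟨ x , x ⟩ is a sum of squares, which
  -- gives the termwise nonnegativity that `√*√-≃` asks for.
  ‖‖₂^2p-≃ : ∀ {d} (x : Vector ℝ d) p → (‖ x ‖₂ ℝ.^ (2 ℕ.* p)) ≃ (⟨ x , x ⟩ ℝ.^ p)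
  ‖‖₂^2p-≃ x p = ≃-trans (‖ x ‖₂ ℝ.^ (2 ℕ.* p)) ((‖ x ‖₂ ℝ.* ‖ x ‖₂) ℝ.^ p) (⟨ x , x ⟩ ℝ.^ p)
    (pointwise-≃ (‖ x ‖₂ ℝ.^ (2 ℕ.* p)) ((‖ x ‖₂ ℝ.* ‖ x ‖₂) ℝ.^ p) λ n → begin
      seq (‖ x ‖₂ ℝ.^ (2 ℕ.* p)) n         ≡⟨ seq-^ ‖ x ‖₂ (2 ℕ.* p) n ⟩
      seq ‖ x ‖₂ n ^ (2 ℕ.* p)             ≡⟨ sym (^-assocʳ (seq ‖ x ‖₂ n) 2 p) ⟩
      (seq ‖ x ‖₂ n * (seq ‖ x ‖₂ n * 1ℚ)) ^ p
        ≡⟨ cong (λ z → (seq ‖ x ‖₂ n * z) ^ p) (*-identityʳ (seq ‖ x ‖₂ n)) ⟩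
      (seq ‖ x ‖₂ n * seq ‖ x ‖₂ n) ^ p    ≡⟨ sym (seq-^ (‖ x ‖₂ ℝ.* ‖ x ‖₂) p n) ⟩
      seq ((‖ x ‖₂ ℝ.* ‖ x ‖₂) ℝ.^ p) n    ∎)
    (^-cong-≃ (‖ x ‖₂ ℝ.* ‖ x ‖₂) ⟨ x , x ⟩ (√*√-≃ ⟨ x , x ⟩ λ n →
      subst (0ℚ ≤_) (sym (seq-⟨,⟩ x x n)) (0≤∑ λ i → 0≤p² (seq (x i) n))) p)
    where open ≡-Reasoning

  -- The slack ε in the order on ℝ absorbs the null sequence between `y` and `z`.
  pointwise-≤-≃ : ∀ x y z → (∀ n → seq x n ≤ seq y n) → z ≃ y → x ℝ.≤ z
  pointwise-≤-≃ x y z x≤y z≃y ε 0<ε =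
    let N , p = z≃y ε 0<ε
    in N , λ n N≤n → begin
      seq x n                      ≤⟨ x≤y n ⟩
      seq y n                      ≡⟨ solve 2 (λ y z → y := z :+ :- (z :- y)) refl (seq y n)
          (seq z n) ⟩
      seq z n + - (seq z n - seq y n)
        ≤⟨ +-monoʳ-≤ (seq z n) (≤-trans (p≤∣p∣ _)
            (≤-trans (≤-reflexive (∣-p∣≡∣p∣ (seq z n - seq y n))) (<⇒≤ (p n N≤n)))) ⟩
      seq z n + ε                  ∎
    where
    open ≤-Reasoning
    open +-*-Solver

  -- Transfer of the rational results to the reals

  ι-pred : ∀ i → (i ℤ.- ℤ.+ 1) / 1 ≡ i / 1 - 1ℚ
  ι-pred i = sym (trans (fromℚᵘ-homo-+ (ℚᵘ.mkℚᵘ i 0) (ℚᵘ.mkℚᵘ ℤ.-1ℤ 0))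
    (fromℚᵘ-cong {ℚᵘ.mkℚᵘ i 0 ℚᵘ.+ ℚᵘ.mkℚᵘ ℤ.-1ℤ 0} {ℚᵘ.mkℚᵘ (i ℤ.- ℤ.+ 1) 0}
      (ℚᵘ.*≡* (cong (ℤ._* ℤ.+ 1) (cong (ℤ._+ ℤ.-1ℤ) (ℤ.*-identityʳ i))))))

  [3^p-1]/D : ∀ p D .{{_ : ℕ.NonZero D}} → (ℤ.+ (3 ℕ.^ p) ℤ.- ℤ.+ 1) / D ≡ 1/ D * (3ℚ ^ p - 1ℚ)
  [3^p-1]/D p D = trans (/≡1/* (ℤ.+ (3 ℕ.^ p) ℤ.- ℤ.+ 1) D)
    (cong (1/ D *_) (trans (ι-pred (ℤ.+ (3 ℕ.^ p))) (cong (_- 1ℚ) (ι-3^ p))))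

  module _ {d D : ℕ} (p : ℕ) .{{_ : ℕ.NonZero D}} (x y : Vector ℝ d) (n : ℕ) where
    private
      xx yy : ℚ
      xx = ∑ λ a → (x at n) a * (x at n) a
      yy = ∑ λ a → (y at n) a * (y at n) a

    -- Stated with powers of inner products in place of norms, because only this root-free form
    -- matches the rational bound exactly at every index.
    seq-bound : seq (fromℚ ((ℤ.+ (3 ℕ.^ p) ℤ.- ℤ.+ 1) / D) ℝ.* ⟨ x , x ⟩ ℝ.^ p ℝ.* ⟨ y , y ⟩ ℝ.^ p) n ≡
                1/ D * ((3ℚ ^ p - 1ℚ) * (xx * yy) ^ p)
    seq-bound = begin
      (ℤ.+ (3 ℕ.^ p) ℤ.- ℤ.+ 1) / D * seq (⟨ x , x ⟩ ℝ.^ p) n * seq (⟨ y , y ⟩ ℝ.^ p) n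
        ≡⟨ cong₂ _*_ (cong₂ _*_ ([3^p-1]/D p D) (seq-⟨,⟩^ x)) (seq-⟨,⟩^ y) ⟩
      1/ D * (3ℚ ^ p - 1ℚ) * xx ^ p * yy ^ p
        ≡⟨ solve 4 (λ a b c e → a :* b :* c :* e := a :* (b :* (c :* e))) refl (1/ D)
            (3ℚ ^ p - 1ℚ) (xx ^ p) (yy ^ p) ⟩
      1/ D * ((3ℚ ^ p - 1ℚ) * (xx ^ p * yy ^ p))
        ≡⟨ cong (λ z → 1/ D * ((3ℚ ^ p - 1ℚ) * z)) (sym (^-distrib-* xx yy p)) ⟩
      1/ D * ((3ℚ ^ p - 1ℚ) * (xx * yy) ^ p) ∎
      where
      open ≡-Reasoning
      open +-*-Solver
      seq-⟨,⟩^ : ∀ (z : Vector ℝ d) → seq (⟨ z , z ⟩ ℝ.^ p) n ≡ ∑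
          (λ a → (z at n) a * (z at n) a) ^ p
      seq-⟨,⟩^ z = trans (seq-^ ⟨ z , z ⟩ p n) (cong (_^ p) (seq-⟨,⟩ z z n))

  seq-⟨countSketch,countSketch⟩ : ∀ {d D p} .{{_ : ℕ.NonZero D}} (x y : Vector ℝ d) n
    (h : Vector (Fin d → Fin D) p) (s : Vector (Fin d → Sign) p) →
    seq ⟨ countSketch (compositeHash h) (compositeSign s) (x ^⊗ p)
        , countSketch (compositeHash h) (compositeSign s) (y ^⊗ p) ⟩ n ≡
    ⟨sketch,sketch⟩ (x at n) (y at n) (h , s)
  seq-⟨countSketch,countSketch⟩ {p = p} x y n h s = trans
    (seq-⟨,⟩ (countSketch (compositeHash h) (compositeSign s) (x ^⊗ p))
             (countSketch (compositeHash h) (compositeSign s) (y ^⊗ p)) n)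
    (∑-cong λ t → cong₂ _*_ (seq-countSketch x n h s t) (seq-countSketch y n h s t))

  ⟨^⊗,^⊗⟩ : ∀ {d} p (x y : Vector ℝ d) → ⟨ x ^⊗ p , y ^⊗ p ⟩ ≃ (⟨ x , y ⟩ ℝ.^ p)
  ⟨^⊗,^⊗⟩ p x y = pointwise-≃ ⟨ x ^⊗ p , y ^⊗ p ⟩ (⟨ x , y ⟩ ℝ.^ p) λ n → trans
      (seq-⟨^⊗,^⊗⟩ p x y n)
    (sym (trans (seq-^ ⟨ x , y ⟩ p n) (cong (_^ p) (seq-⟨,⟩ x y n))))

  module _ {d D p : ℕ} .{{_ : ℕ.NonZero D}} (x y : Vector ℝ d)
    (𝓗 : Fin p → List⁺ (Fin d → Fin D)) (𝓢 : Fin p → List⁺ (Fin d → Sign))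
    (𝓗-indep : ∀ j → KWiseIndependent 2 (↔-id (Fin D)) (𝓗 j))
    (𝓢-indep : ∀ j → KWiseIndependent 4 Sign↔Fin2 (𝓢 j))
    (Z : Vector (Fin d → Fin D) p × Vector (Fin d → Sign) p → ℝ)
    (seq-Z : ∀ n ω → seq (Z ω) n ≡ ⟨sketch,sketch⟩ (x at n) (y at n) ω)
    where

    private
      μ variance bound : ℕ → ℚ
      μ n = ∑ (λ a → (x at n) a * (y at n) a) ^ p
      variance n = E (⨂ 𝓗 ⊗ ⨂ 𝓢) λ ω →
        (⟨sketch,sketch⟩ (x at n) (y at n) ω - μ n) * (⟨sketch,sketch⟩ (x at n) (y at n) ω - μ n)
      bound n = 1/ D * ((3ℚ ^ p - 1ℚ) *
        (∑ (λ a → (x at n) a * (x at n) a) * ∑ (λ a → (y at n) a * (y at n) a)) ^ p)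

      E-Z : ∀ n → E (⨂ 𝓗 ⊗ ⨂ 𝓢) (λ ω → seq (Z ω) n) ≡ μ n
      E-Z n = trans (E-cong (⨂ 𝓗 ⊗ ⨂ 𝓢) (seq-Z n))
        (E-⟨sketch,sketch⟩ 𝓗 𝓢 𝓗-indep 𝓢-indep (x at n) (y at n))

      seq-VarZ : ∀ n → seq (Var (⨂ 𝓗 ⊗ ⨂ 𝓢) Z) n ≡ variance n
      seq-VarZ n = trans (seq-Var (⨂ 𝓗 ⊗ ⨂ 𝓢) Z n)
        (E-cong (⨂ 𝓗 ⊗ ⨂ 𝓢) λ ω → cong₂ (λ z m → (z - m) * (z - m)) (seq-Z n ω) (E-Z n))

      variance≤bound : ∀ n → variance n ≤ bound n
      variance≤bound n = Var-⟨sketch,sketch⟩ 𝓗 𝓢 𝓗-indep 𝓢-indep (x at n) (y at n)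

    -- `Z` enters only through its terms, each of which is the inner product of the sketches of two
    -- rational vectors; both sides then agree at every index.
    𝔼-sketches : 𝔼 (⨂ 𝓗 ⊗ ⨂ 𝓢) Z ≃ ⟨ x ^⊗ p , y ^⊗ p ⟩
    𝔼-sketches = pointwise-≃ (𝔼 (⨂ 𝓗 ⊗ ⨂ 𝓢) Z) ⟨ x ^⊗ p , y ^⊗ p ⟩ λ n →
      trans (trans (seq-𝔼 (⨂ 𝓗 ⊗ ⨂ 𝓢) Z n) (E-Z n)) (sym (seq-⟨^⊗,^⊗⟩ p x y n))

    Var-sketches : Var (⨂ 𝓗 ⊗ ⨂ 𝓢) Z ℝ.≤
      (fromℚ ((ℤ.+ (3 ℕ.^ p) ℤ.- ℤ.+ 1) / D) ℝ.* ‖ x ‖₂ ℝ.^ (2 ℕ.* p) ℝ.* ‖ y ‖₂ ℝ.^ (2 ℕ.* p))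
    Var-sketches = pointwise-≤-≃ (Var (⨂ 𝓗 ⊗ ⨂ 𝓢) Z) (c ℝ.* X ℝ.* Y) (c ℝ.* X′ ℝ.* Y′)
      (λ n → ≤-trans (≤-reflexive (seq-VarZ n))
        (≤-trans (variance≤bound n) (≤-reflexive (sym (seq-bound p x y n)))))
      -- The inequality above is termwise for the inner products; the norms of the claim are equal
      -- to them only up to a null sequence.
      (*-cong-≃ (c ℝ.* X′) (c ℝ.* X) Y′ Y
        (*-cong-≃ c c X′ X (pointwise-≃ c c λ _ → refl) (‖‖₂^2p-≃ x p))
        (‖‖₂^2p-≃ y p))
      where
      c X X′ Y Y′ : ℝ
      c  = fromℚ ((ℤ.+ (3 ℕ.^ p) ℤ.- ℤ.+ 1) / D)
      X  = ⟨ x , x ⟩ ℝ.^ p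
      X′ = ‖ x ‖₂ ℝ.^ (2 ℕ.* p)
      Y  = ⟨ y , y ⟩ ℝ.^ p
      Y′ = ‖ y ‖₂ ℝ.^ (2 ℕ.* p)

open import Defs
open import Data.Integer.Base using (+_)

theorem9 : ∀ (d D p : ℕ) .{{_ : NonZero d}} .{{_ : NonZero D}} .{{_ : NonZero p}}
    (x y : Vector ℝ d)
    (𝓗 : Fin p → List⁺ (Fin d → Fin D)) (𝓢 : Fin p → List⁺ (Fin d → Sign)) →
    (∀ j → KWiseIndependent 2 (↔-id (Fin D)) (𝓗 j)) →
    (∀ j → KWiseIndependent 4 Sign↔Fin2 (𝓢 j)) →
    let
    Ω = ⨂ 𝓗 ⊗ ⨂ 𝓢
    C = λ (h , s) → countSketch (compositeHash h) (compositeSign s)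
    Z = λ ω → ⟨ C ω (x ^⊗ p) , C ω (y ^⊗ p) ⟩
    in
    (𝔼 Ω Z ≃ ⟨ x ^⊗ p , y ^⊗ p ⟩)
    × (⟨ x ^⊗ p , y ^⊗ p ⟩ ≃ ⟨ x , y ⟩ ^ p)
    × (Var Ω Z ≤ fromℚ ((+ (3 ℕ.^ p) ℤ.- + 1) ℚ./ D) * ‖ x ‖₂ ^ (2 ℕ.* p) * ‖ y ‖₂ ^ (2 ℕ.* p))
theorem9 d D p x y 𝓗 𝓢 𝓗-indep 𝓢-indep =
  let
    C = λ (h , s) → countSketch (compositeHash h) (compositeSign s)
    Z = λ ω → ⟨ C ω (x ^⊗ p) , C ω (y ^⊗ p) ⟩
    seq-Z = λ n (h , s) → Moments.seq-⟨countSketch,countSketch⟩ x y n h s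
  in
    Moments.𝔼-sketches x y 𝓗 𝓢 𝓗-indep 𝓢-indep Z seq-Z
  , Moments.⟨^⊗,^⊗⟩ p x y
  , Moments.Var-sketches x y 𝓗 𝓢 𝓗-indep 𝓢-indep Z seq-Z
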